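{- Let $G$ be a bridgeless cubic graph. Then $G$ admits a $6$-edge-coloring $f$ such that $|E(f)|\geq \frac{7}{9}\cdot |E(G)|$.
   Context: Graphs are finite, undirected, without loops, possibly with parallel edges. A $6$-edge-coloring is a proper edge-coloring with colors from $\{1,\dots,6\}$. For an edge-coloring $c$ and a vertex $v$, let $S_c(v)$ be the set of colors on edges incident with $v$. An edge $uv$ of a cubic graph is poor if $|S_c(u)\cup S_c(v)|=3$, rich if $|S_c(u)\cup S_c(v)|=5$, and normal if it is poor or rich. $E(f)$ denotes the set of edges that are normal with respect to the edge-coloring $f$. -}

module Defs where

open import Data.Nat using (ℕ; _*_; _≤_)
open import Data.Fin using (Fin; _≟_)
open import Data.Fin.Subset using (Subset; _∪_; ∣_∣)
open import Data.Product using (_×_; _,_; proj₁; proj₂)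
open import Data.Sum using (_⊎_)
open import Data.List using (List; length; filter)
open import Data.List.Relation.Unary.Any using (any?)
open import Data.Vec using (tabulate)
open import Relation.Nullary using (¬_; does)
open import Relation.Nullary.Decidable using (_×-dec_; _⊎-dec_)
open import Relation.Binary.PropositionalEquality using (_≡_; _≢_)
open import Data.Fin.Base using ()
open import Data.List using (allFin)
open import Data.Nat using () renaming (_≟_ to _≟ℕ_)

record Multigraph : Set where
  field
    n     : ℕ
    m     : ℕ
    ends  : Fin m → Fin n × Fin n
    noLoop : ∀ e → proj₁ (ends e) ≢ proj₂ (ends e)
open Multigraph public

Incident : (G : Multigraph) → Fin (m G) → Fin (n G) → Set
Incident G e v = proj₁ (ends G e) ≡ v ⊎ proj₂ (ends G e) ≡ v

incident? : (G : Multigraph) → (v : Fin (n G)) → (e : Fin (m G)) → Relation.Nullary.Dec (Incident G e v)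
incident? G v e = (proj₁ (ends G e) ≟ v) ⊎-dec (proj₂ (ends G e) ≟ v)

degree : (G : Multigraph) → Fin (n G) → ℕ
degree G v = length (filter (incident? G v) (allFin (m G)))

Cubic : Multigraph → Set
Cubic G = ∀ v → degree G v ≡ 3

Joins : (G : Multigraph) → Fin (m G) → Fin (n G) → Fin (n G) → Set
Joins G e' x y = ends G e' ≡ (x , y) ⊎ ends G e' ≡ (y , x)

data ReachAvoiding (G : Multigraph) (e : Fin (m G)) (u : Fin (n G)) : Fin (n G) → Set where
  here : ReachAvoiding G e u u
  step : ∀ {w x} (e' : Fin (m G)) → ReachAvoiding G e u w → e' ≢ e → Joins G e' w x →
         ReachAvoiding G e u x

IsBridge : (G : Multigraph) → Fin (m G) → Set
IsBridge G e = ¬ ReachAvoiding G e (proj₁ (ends G e)) (proj₂ (ends G e))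

Bridgeless : Multigraph → Set
Bridgeless G = ∀ e → ¬ IsBridge G e

Coloring6 : Multigraph → Set
Coloring6 G = Fin (m G) → Fin 6

Proper : (G : Multigraph) → Coloring6 G → Set
Proper G c = ∀ e e' v → e ≢ e' → Incident G e v → Incident G e' v → c e ≢ c e'

colorSet : (G : Multigraph) → Coloring6 G → Fin (n G) → Subset 6
colorSet G c v = tabulate λ k → does (any? (λ e → incident? G v e ×-dec (c e ≟ k)) (allFin (m G)))

unionSize : (G : Multigraph) → Coloring6 G → Fin (m G) → ℕ
unionSize G c e = ∣ colorSet G c (proj₁ (ends G e)) ∪ colorSet G c (proj₂ (ends G e)) ∣

Poor Rich Normal : (G : Multigraph) → Coloring6 G → Fin (m G) → Set
Poor G c e = unionSize G c e ≡ 3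
Rich G c e = unionSize G c e ≡ 5
Normal G c e = Poor G c e ⊎ Rich G c e

normal? : (G : Multigraph) → (c : Coloring6 G) → (e : Fin (m G)) → Relation.Nullary.Dec (Normal G c e)
normal? G c e = (unionSize G c e ≟ℕ 3) ⊎-dec (unionSize G c e ≟ℕ 5)

numNormal : (G : Multigraph) → Coloring6 G → ℕ
numNormal G c = length (filter (normal? G c) (allFin (m G)))

{-# OPTIONS --safe #-}
-- Let M be a perfect matching of G, let the edges outside M form the 2-factor C, and suppose that G has a Z₂²-flow (α, β) that
-- vanishes nowhere on M.  Colour C by the four values of (α, β) and M by the three others of Z₂³.  All edges are normal in this
-- 7-colouring: the two other edges at an end of an edge of value c have values x and x + c.  Identify two of the three colours on
-- M.  The edges of M stay normal, and an edge of C becomes abnormal only if exactly these two colours occur at its ends.  Hence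
-- each edge of C spoils at most one of the three identifications, and one of them spoils at most |C| / 3 = 2 |E| / 9 edges.
--
-- The flow exists once M contains no 3-edge-cut: G / C then has no cuts of size 1 or 3 and, after suppression of its vertices of
-- degree 2, minimum degree 4.  Split the edges into two classes and keep moving redundant edges (those on a cycle of their class)
-- into the other class.  For a split spanning as much as possible, the edges that ever become redundant span the same in both
-- classes.  Contract them, take a flow of the smaller graph, and complete each coordinate inside one class, with value 1 on the
-- contracted edges of the other class.
--
-- A matching M through a prescribed edge that meets each 3-edge-cut once is obtained by contracting either side of a 3-edge-cut;
-- uncrossing shows that gluing preserves the property.  If all 3-edge-cuts are trivial, any perfect matching through the edge
-- will do; it is found by Frink's reduction: delete an edge xy and reconnect the neighbours of x and y in that
-- one of the two possible ways that leaves no bridge.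
--
-- Existence is proved up to double negation, which is harmless because colourings can be searched exhaustively.
module Submission where

open import Defs
open import Data.Nat using (ℕ; _*_; _≤_)
open import Data.Product using (Σ; _×_)

open import Algebra.Bundles using (CommutativeRing)
import Algebra.Properties.Semiring.Sum as SemiringSum
open import Data.Bool using (Bool; true; false; not; _∧_; _∨_; _xor_; if_then_else_)
open import Data.Bool.Properties using (xor-∧-commutativeRing; xor-comm; xor-same; xor-identityʳ; ∧-assoc; ∧-comm; ∧-identityʳ; ∧-zeroʳ; ∧-distribˡ-xor; ∧-distribʳ-xor; not-involutive; ¬-not) renaming (_≟_ to _≟ᵇ_)
open import Data.Empty using (⊥; ⊥-elim)
open import Data.Fin using (Fin; zero; suc; _≟_)
open import Data.Fin.Patterns
open import Data.Fin.Properties using (all?; any?)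
open import Data.Fin.Subset using (Subset; _∪_; ∣_∣)
open import Data.List using (List; []; _∷_; length; filter; allFin) renaming (tabulate to tabulateᴸ)
open import Data.List.Membership.Propositional using (_∈_; lose)
open import Data.List.Membership.Propositional.Properties using (∈-allFin; ∈-filter⁺)
open import Data.List.Relation.Unary.Any as Any using (here; there)
open import Data.Nat using (zero; suc; _+_; _<_; z≤n; s≤s)
open import Data.Nat.Properties hiding (_≟_)
import Data.Nat.Properties as ℕₚ
open import Data.Product using (∃; ∃₂; _,_; proj₁; proj₂)
open import Data.Sum using (_⊎_; inj₁; inj₂; [_,_]′)
open import Data.Vec using (Vec; []; _∷_; tabulate; lookup)
open import Data.Vec.Properties using (tabulate-cong; lookup∘tabulate)
open import Function using (_∘_; id; const)
open import Relation.Binary.PropositionalEquality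
open import Relation.Nullary using (¬_; Dec; yes; no; does)
open import Relation.Nullary.Decidable using (decidable-stable; map′; ¬?; _→-dec_; _×-dec_; _⊎-dec_; dec-true; dec-false)
open import Relation.Unary using (Decidable)

-- Finite sums and Boolean identities

module ℕΣ = SemiringSum +-*-semiring
module 𝔽Σ = SemiringSum (CommutativeRing.semiring xor-∧-commutativeRing)

-- Boolean identities are checked by evaluating them at all assignments.
valid : ∀ k → (Vec Bool k → Bool) → Bool
valid zero    f = f []
valid (suc k) f = valid k (f ∘ (true ∷_)) ∧ valid k (f ∘ (false ∷_))

∧-true : ∀ {a b} → a ∧ b ≡ true → a ≡ true × b ≡ true
∧-true {true} {true} _ = refl , refl

valid-sound : ∀ k f → valid k f ≡ true → ∀ v → f v ≡ true
valid-sound zero    f p []          = p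
valid-sound (suc k) f p (true ∷ v)  = valid-sound k _ (proj₁ (∧-true p)) v
valid-sound (suc k) f p (false ∷ v) = valid-sound k _ (proj₂ (∧-true p)) v

infix 4 _==_
_==_ : Bool → Bool → Bool
a == b = not (a xor b)

infixr 3 _⇒_
_⇒_ : Bool → Bool → Bool
a ⇒ b = not a ∨ b

==-sound : ∀ {a b} → (a == b) ≡ true → a ≡ b
==-sound {true}  {true}  _ = refl
==-sound {false} {false} _ = refl

⇒-elim : ∀ {a b} → (a ⇒ b) ≡ true → a ≡ true → b ≡ true
⇒-elim p refl = p

by-valid : ∀ k (f g : Vec Bool k → Bool) → valid k (λ v → f v == g v) ≡ true → ∀ v → f v ≡ g v
by-valid k f g p v = ==-sound (valid-sound k _ p v)

true≢false : ∀ {b} → b ≡ true → b ≡ false → ⊥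
true≢false refl ()

≢true : ∀ {b} → b ≢ true → b ≡ false
≢true = ¬-not

bool-cases : ∀ {b} {A : Set} → (b ≡ true → A) → (b ≡ false → A) → A
bool-cases {true}  f g = f refl
bool-cases {false} f g = g refl

xor-≢ : ∀ {a b} → a xor b ≡ true → a ≢ b
xor-≢ {true}  {true}  ()
xor-≢ {false} {false} ()
xor-≢ {true}  {false} _ ()
xor-≢ {false} {true}  _ ()


-- Excluded middle for an undecided `P`, available because the goal is absurdity.
by-cases : ∀ {P : Set} → (P → ⊥) → (¬ P → ⊥) → ⊥
by-cases f g = g f

-- The index set is finite, so the double negations can be collected one index at a time.
¬¬-∀ : ∀ {k} {P : Fin k → Set} → (∀ i → ¬ ¬ P i) → ¬ ¬ (∀ i → P i)
¬¬-∀ {zero}  h c = c λ ()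
¬¬-∀ {suc k} h c = h zero λ p → ¬¬-∀ (h ∘ suc) λ q → c λ { zero → p ; (suc i) → q i }


-- Counting with Boolean predicates

bit : Bool → ℕ
bit b = if b then 1 else 0

count : ∀ {k} → (Fin k → Bool) → ℕ
count P = ℕΣ.sum (bit ∘ P)

opaque
  δ : ∀ {k} → Fin k → Fin k → Bool
  δ i j = does (i ≟ j)

  δ-≡ : ∀ {k} {i j : Fin k} → i ≡ j → δ i j ≡ true
  δ-≡ {i = i} {j} = dec-true (i ≟ j)

  δ-≢ : ∀ {k} {i j : Fin k} → i ≢ j → δ i j ≡ false
  δ-≢ {i = i} {j} = dec-false (i ≟ j)

  δ-suc : ∀ {k} (i j : Fin k) → δ (suc i) (suc j) ≡ δ i j
  δ-suc i j with i ≟ j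
  ... | yes _ = refl
  ... | no  _ = refl

δ-refl : ∀ {k} (i : Fin k) → δ i i ≡ true
δ-refl i = δ-≡ refl

δ-true : ∀ {k} {i j : Fin k} → δ i j ≡ true → i ≡ j
δ-true {i = i} {j} p with i ≟ j
... | yes i≡j = i≡j
... | no  i≢j = ⊥-elim (true≢false p (δ-≢ i≢j))

δ-false : ∀ {k} {i j : Fin k} → δ i j ≡ false → i ≢ j
δ-false {i = i} p refl = true≢false (δ-refl i) p

infixl 7 _∖_
_∖_ : ∀ {k} → (Fin k → Bool) → Fin k → Fin k → Bool
(P ∖ e) i = P i ∧ not (δ e i)

∖-true : ∀ {k} {P : Fin k → Bool} {e i} → (P ∖ e) i ≡ true → P i ≡ true × e ≢ i
∖-true {P = P} {e} {i} p = proj₁ (∧-true p) , λ e≡i → true≢false (proj₂ (∧-true {P i} p)) (cong not (δ-≡ e≡i))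

∖-intro : ∀ {k} {P : Fin k → Bool} {e i} → P i ≡ true → e ≢ i → (P ∖ e) i ≡ true
∖-intro p e≢i rewrite p | δ-≢ e≢i = refl

count-cong : ∀ {k} {P Q : Fin k → Bool} → P ≗ Q → count P ≡ count Q
count-cong h = ℕΣ.sum-cong-≗ (cong bit ∘ h)

sum-mono : ∀ {k} {f g : Fin k → ℕ} → (∀ i → f i ≤ g i) → ℕΣ.sum f ≤ ℕΣ.sum g
sum-mono {zero}  h = z≤n
sum-mono {suc k} h = +-mono-≤ (h zero) (sum-mono (h ∘ suc))

sum-mono-< : ∀ {k} {f g : Fin k → ℕ} → (∀ i → f i ≤ g i) → ∀ i → f i < g i → ℕΣ.sum f < ℕΣ.sum g
sum-mono-< {suc k} h zero    p = +-mono-<-≤ p (sum-mono (h ∘ suc))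
sum-mono-< {suc k} h (suc i) p = +-mono-≤-< (h zero) (sum-mono-< (h ∘ suc) i p)

bit-mono : ∀ {a b} → (a ≡ true → b ≡ true) → bit a ≤ bit b
bit-mono {true}  {b} h rewrite h refl = ≤-refl
bit-mono {false}     h = z≤n

module _ {k : ℕ} {P Q : Fin k → Bool} where

  count-mono : (∀ i → P i ≡ true → Q i ≡ true) → count P ≤ count Q
  count-mono h = sum-mono (bit-mono ∘ h)

  count-mono-< : (∀ i → P i ≡ true → Q i ≡ true) → ∀ i → P i ≡ false → Q i ≡ true → count P < count Q
  count-mono-< h i p q = sum-mono-< (bit-mono ∘ h) i (subst₂ _<_ (cong bit (sym p)) (cong bit (sym q)) (s≤s z≤n))

count-false : ∀ {k} {P : Fin k → Bool} → (∀ i → P i ≡ false) → count P ≡ 0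
count-false {k} h = trans (count-cong h) (ℕΣ.sum-replicate-zero k)

count-≤ : ∀ {k} (P : Fin k → Bool) → count P ≤ k
count-≤ {zero}  P = z≤n
count-≤ {suc k} P with P zero
... | true  = s≤s (count-≤ (P ∘ suc))
... | false = m≤n⇒m≤1+n (count-≤ (P ∘ suc))

count-some : ∀ {k} (P : Fin k → Bool) → 0 < count P → ∃ λ i → P i ≡ true
count-some {suc k} P p with P zero in eq
... | true  = zero , eq
... | false with count-some (P ∘ suc) p
...   | i , q = suc i , q

count-zero : ∀ {k} (P : Fin k → Bool) → count P ≡ 0 → ∀ i → P i ≡ false
count-zero {suc k} P p i with P zero in eq
count-zero {suc k} P p zero    | false = eq
count-zero {suc k} P p (suc i) | false = count-zero (P ∘ suc) p i

count-pull : ∀ {k} (P : Fin k → Bool) e → count P ≡ bit (P e) + count (P ∖ e)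
count-pull {suc k} P zero
  rewrite δ-refl {suc k} zero | ∧-zeroʳ (P zero)
  = cong (bit (P zero) +_) (count-cong λ i → sym (trans (cong (λ b → P (suc i) ∧ not b) (δ-≢ {i = zero} {suc i} λ ())) (∧-identityʳ (P (suc i)))))
count-pull {suc k} P (suc e) = begin
  a + count (P ∘ suc)                       ≡⟨ cong (a +_) (count-pull (P ∘ suc) e) ⟩
  a + (b + c)                               ≡⟨ +-assoc a b c ⟨
  a + b + c                                 ≡⟨ cong (_+ c) (+-comm a b) ⟩
  b + a + c                                 ≡⟨ +-assoc b a c ⟩
  b + (a + c)                               ≡⟨ cong₂ (λ x y → b + (x + y)) (cong bit (sym (trans (cong (λ b → P zero ∧ not b) (δ-≢ {i = suc e} {zero} λ ())) (∧-identityʳ (P zero))))) (count-cong λ i → cong (λ z → P (suc i) ∧ not z) (sym (δ-suc e i))) ⟩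
  b + (bit ((P ∖ suc e) zero) + count ((P ∖ suc e) ∘ suc)) ∎
  where
  open ≡-Reasoning
  a = bit (P zero)
  b = bit (P (suc e))
  c = count ((P ∘ suc) ∖ e)

count-split : ∀ {k} (M P : Fin k → Bool) → count P ≡ count (λ i → M i ∧ P i) + count (λ i → not (M i) ∧ P i)
count-split M P = trans (ℕΣ.sum-cong-≗ λ i → eq (M i) (P i)) (ℕΣ.∑-distrib-+ (λ i → bit (M i ∧ P i)) (λ i → bit (not (M i) ∧ P i)))
  where
  eq : ∀ a b → bit b ≡ bit (a ∧ b) + bit (not a ∧ b)
  eq true  b = sym (+-identityʳ _)
  eq false b = refl

-- Explicit enumerations of sets with one, two or three elements. `get₁`, `get₂′` and `get₃″` obtain
-- them from a cardinality; `count₁`, `count₂` and `count₃` turn the size of an intersection with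
-- such a set into a sum of bits.
record One {k} (P : Fin k → Bool) (e : Fin k) : Set where
  field
    at₁  : P e ≡ true
    only : ∀ i → P i ≡ true → i ≡ e

record Two {k} (P : Fin k → Bool) (e f : Fin k) : Set where
  field
    at₁  : P e ≡ true
    at₂  : P f ≡ true
    ≢₁₂  : e ≢ f
    only : ∀ i → P i ≡ true → i ≡ e ⊎ i ≡ f

record Three {k} (P : Fin k → Bool) (e f g : Fin k) : Set where
  field
    at₁  : P e ≡ true
    at₂  : P f ≡ true
    at₃  : P g ≡ true
    ≢₁₂  : e ≢ f
    ≢₁₃  : e ≢ g
    ≢₂₃  : f ≢ g
    only : ∀ i → P i ≡ true → i ≡ e ⊎ i ≡ f ⊎ i ≡ g

  off : ∀ i → i ≢ e → i ≢ f → i ≢ g → P i ≡ false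
  off i a b c = ≢true λ p → case (only i p)
    where
    case : i ≡ e ⊎ i ≡ f ⊎ i ≡ g → ⊥
    case (inj₁ x)        = a x
    case (inj₂ (inj₁ x)) = b x
    case (inj₂ (inj₂ x)) = c x

module _ {k : ℕ} {P : Fin k → Bool} where

  count-minus : ∀ {e j} → count P ≡ suc j → P e ≡ true → count (P ∖ e) ≡ j
  count-minus {e} c p = suc-injective (trans (sym (trans (count-pull P e) (cong (λ b → bit b + count (P ∖ e)) p))) c)

  get₁ : count P ≡ 1 → ∃ λ e → One P e
  get₁ c with count-some P (subst (0 <_) (sym c) (s≤s z≤n))
  ... | e , p = e , record { at₁ = p ; only = λ i q → only i q (e ≟ i) }
    where
    only : ∀ i → P i ≡ true → Dec (e ≡ i) → i ≡ e
    only i q (yes r) = sym r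
    only i q (no e≢i) = ⊥-elim (true≢false (∖-intro {P = P} {e} q e≢i) (count-zero (P ∖ e) (count-minus c p) i))

module _ {k : ℕ} {P : Fin k → Bool} where

  get₂′ : ∀ {e} → count P ≡ 2 → P e ≡ true → ∃ λ f → Two P e f
  get₂′ {e} c p with get₁ (count-minus {P = P} c p)
  ... | f , o = f , record { at₁ = p ; at₂ = proj₁ (∖-true {P = P} {e} (One.at₁ o)) ; ≢₁₂ = proj₂ (∖-true {P = P} {e} (One.at₁ o)) ; only = λ i q → only i q (e ≟ i) }
    where
    only : ∀ i → P i ≡ true → Dec (e ≡ i) → i ≡ e ⊎ i ≡ f
    only i q (yes r)  = inj₁ (sym r)
    only i q (no e≢i) = inj₂ (One.only o i (∖-intro {P = P} {e} q e≢i))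

module _ {k : ℕ} {P : Fin k → Bool} where

  get₃″ : ∀ {e f} → count P ≡ 3 → P e ≡ true → P f ≡ true → e ≢ f → ∃ λ g → Three P e f g
  get₃″ {e} {f} c p q e≢f with get₂′ {P = P ∖ e} (count-minus {P = P} c p) (∖-intro {P = P} {e} q e≢f)
  ... | g , o = g , record
    { at₁ = p ; at₂ = q ; at₃ = proj₁ (∖-true {P = P} {e} (Two.at₂ o))
    ; ≢₁₂ = e≢f ; ≢₁₃ = proj₂ (∖-true {P = P} {e} (Two.at₂ o)) ; ≢₂₃ = Two.≢₁₂ o
    ; only = λ i r → only i r (e ≟ i) }
    where
    only : ∀ i → P i ≡ true → Dec (e ≡ i) → i ≡ e ⊎ i ≡ f ⊎ i ≡ g
    only i r (yes s)  = inj₁ (sym s)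
    only i r (no e≢i) = inj₂ (Two.only o i (∖-intro {P = P} {e} r e≢i))

  get₃′ : ∀ {e} → count P ≡ 3 → P e ≡ true → ∃₂ λ f g → Three P e f g
  get₃′ {e} c p with count-some (P ∖ e) (subst (0 <_) (sym (count-minus {P = P} c p)) (s≤s z≤n))
  ... | f , q with ∖-true {P = P} {e} q
  ...   | q′ , e≢f = f , get₃″ c p q′ e≢f

module _ {k : ℕ} {P : Fin k → Bool} (M : Fin k → Bool) where

  private
    pull : ∀ e → P e ≡ true → count (λ i → M i ∧ P i) ≡ bit (M e) + count (λ i → M i ∧ (P ∖ e) i)
    pull e p = trans (count-pull _ e)
      (cong₂ _+_ (cong bit (trans (cong (M e ∧_) p) (∧-identityʳ (M e))))
        (count-cong λ i → ∧-assoc (M i) (P i) _))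

    none : ∀ {Q : Fin k → Bool} → (∀ i → Q i ≡ true → ⊥) → count (λ i → M i ∧ Q i) ≡ 0
    none h = count-false λ i → ≢true λ p → h i (proj₂ (∧-true p))

  count₁ : ∀ {e} → One P e → count (λ i → M i ∧ P i) ≡ bit (M e)
  count₁ {e} o = trans (pull e at₁) (trans (cong (bit (M e) +_) (none λ i p → let q , r = ∖-true {P = P} {e} p in r (sym (only i q)))) (+-identityʳ _))
    where open One o

module _ {k : ℕ} {P : Fin k → Bool} (M : Fin k → Bool) where

  count₂ : ∀ {e f} → Two P e f → count (λ i → M i ∧ P i) ≡ bit (M e) + bit (M f)
  count₂ {e} {f} o = trans (trans (count-pull _ e) (cong₂ _+_ (cong bit (eq at₁)) (count-cong λ i → ∧-assoc (M i) (P i) _)))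
      (cong (bit (M e) +_) (count₁ {P = P ∖ e} M record { at₁ = ∖-intro {P = P} {e} at₂ ≢₁₂ ; only = λ i p → rest i (∖-true {P = P} {e} p) }))
    where
    open Two o
    eq : ∀ {i} → P i ≡ true → M i ∧ P i ≡ M i
    eq {i} p = trans (cong (M i ∧_) p) (∧-identityʳ (M i))
    rest : ∀ i → P i ≡ true × e ≢ i → i ≡ f
    rest i (p , e≢i) with only i p
    ... | inj₁ r = ⊥-elim (e≢i (sym r))
    ... | inj₂ r = r

module _ {k : ℕ} {P : Fin k → Bool} (M : Fin k → Bool) where

  count₃ : ∀ {e f g} → Three P e f g → count (λ i → M i ∧ P i) ≡ bit (M e) + (bit (M f) + bit (M g))
  count₃ {e} {f} {g} o = trans (trans (count-pull _ e) (cong₂ _+_ (cong bit (eq at₁)) (count-cong λ i → ∧-assoc (M i) (P i) _)))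
      (cong (bit (M e) +_) (count₂ {P = P ∖ e} M record
        { at₁ = ∖-intro {P = P} {e} at₂ ≢₁₂ ; at₂ = ∖-intro {P = P} {e} at₃ ≢₁₃ ; ≢₁₂ = ≢₂₃ ; only = λ i p → rest i (∖-true {P = P} {e} p) }))
    where
    open Three o
    eq : ∀ {i} → P i ≡ true → M i ∧ P i ≡ M i
    eq {i} p = trans (cong (M i ∧_) p) (∧-identityʳ (M i))
    rest : ∀ i → P i ≡ true × e ≢ i → i ≡ f ⊎ i ≡ g
    rest i (p , e≢i) with only i p
    ... | inj₁ r = ⊥-elim (e≢i (sym r))
    ... | inj₂ r = r

size₁ : ∀ {k} {P : Fin k → Bool} {e} → One P e → count P ≡ 1
size₁ = count₁ (const true)

size₂ : ∀ {k} {P : Fin k → Bool} {e f} → Two P e f → count P ≡ 2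
size₂ = count₂ (const true)

size₃ : ∀ {k} {P : Fin k → Bool} {e f g} → Three P e f g → count P ≡ 3
size₃ = count₃ (const true)

module _ {n : ℕ} where

  at-two : ∀ (x y : Fin n) (A : Fin n → Set) → A x → A y → (∀ {z} → z ≢ x → z ≢ y → A z) → ∀ z → A z
  at-two x y A a b c z with x ≟ z | y ≟ z
  ... | yes refl | _        = a
  ... | no _     | yes refl = b
  ... | no x≢z   | no y≢z   = c (x≢z ∘ sym) (y≢z ∘ sym)

  -- The vertex set never shrinks: after the contraction `v` stays behind as an isolated vertex, and
  -- inductions run on the number of nonloop edges.
  merge : Fin n → Fin n → Fin n → Fin n
  merge v w z = if δ v z then w else z

  merge-at : ∀ v w → merge v w v ≡ w
  merge-at v w rewrite δ-refl v = refl

  merge-off : ∀ {v w z} → v ≢ z → merge v w z ≡ z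
  merge-off v≢z rewrite δ-≢ v≢z = refl

  δ-merge-other : ∀ {v w z} → z ≢ v → z ≢ w → ∀ u → δ z (merge v w u) ≡ δ z u
  δ-merge-other {v} {w} {z} z≢v z≢w u with v ≟ u
  ... | yes refl rewrite δ-refl v = trans (δ-≢ z≢w) (sym (δ-≢ z≢v))
  ... | no  v≢u  rewrite δ-≢ v≢u = refl

  δ-merge-from : ∀ {v w} → v ≢ w → ∀ u → δ v (merge v w u) ≡ false
  δ-merge-from {v} {w} v≢w u with v ≟ u
  ... | yes refl rewrite δ-refl v = δ-≢ v≢w
  ... | no  v≢u  rewrite δ-≢ v≢u = δ-≢ v≢u

  δ-merge-to : ∀ {v w} → v ≢ w → ∀ u → δ w (merge v w u) ≡ δ w u xor δ v u
  δ-merge-to {v} {w} v≢w u with v ≟ u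
  ... | yes refl rewrite δ-refl v | δ-refl w | δ-≢ (v≢w ∘ sym) = refl
  ... | no  v≢u  rewrite δ-≢ v≢u = xor-comm false (δ w u)

module _ {m : ℕ} where

  upd : (Fin m → Bool) → Fin m → Bool → Fin m → Bool
  upd M e b i = if δ e i then b else M i

  upd-at : ∀ M e b → upd M e b e ≡ b
  upd-at M e b rewrite δ-refl e = refl

  upd-off : ∀ M {e i} b → e ≢ i → upd M e b i ≡ M i
  upd-off M b e≢i rewrite δ-≢ e≢i = refl

-- Multigraphs with loops

-- Loops are allowed but cross no cut, so that a contraction is a mere relabelling of the ends and a deletion turns an edge into a loop.
record Net (n m : ℕ) : Set where
  field
    s t : Fin m → Fin n
open Net public

module _ {n m : ℕ} where

  relabel : (Fin m → Fin n → Fin n) → Net n m → Net n m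
  relabel σ G = record { s = λ e → σ e (s G e) ; t = λ e → σ e (t G e) }

  contract : (Fin n → Fin n) → Net n m → Net n m
  contract ρ = relabel (const ρ)

  cross : Net n m → (Fin n → Bool) → Fin m → Bool
  cross G X e = X (s G e) xor X (t G e)

  star : Net n m → Fin n → Fin m → Bool
  star G v = cross G (δ v)

  nonloop : Net n m → Fin m → Bool
  nonloop G e = not (δ (s G e) (t G e))

  size : Net n m → ℕ
  size G = count (nonloop G)

  cut : Net n m → (Fin n → Bool) → ℕ
  cut G X = count (cross G X)

  cutOn : (Fin m → Bool) → Net n m → (Fin n → Bool) → ℕ
  cutOn M G X = count (λ e → M e ∧ cross G X e)

  deg : Net n m → Fin n → ℕ
  deg G v = cut G (δ v)

  degOn : (Fin m → Bool) → Net n m → Fin n → ℕ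
  degOn M G v = cutOn M G (δ v)

  -- Stated by cuts rather than by paths: every cut of a contraction is a cut of the graph itself,
  -- so the property is inherited at once.
  NoBridge : Net n m → Set
  NoBridge G = ∀ X → cut G X ≢ 1

  Connects : Net n m → Fin m → Fin n → Fin n → Set
  Connects G e x y = (s G e ≡ x × t G e ≡ y) ⊎ (s G e ≡ y × t G e ≡ x)

  module _ (G : Net n m) where

    joins-sym : ∀ {e x y} → Connects G e x y → Connects G e y x
    joins-sym (inj₁ p) = inj₂ p
    joins-sym (inj₂ p) = inj₁ p

    joins-cross : ∀ {e x y} → Connects G e x y → ∀ X → cross G X e ≡ X x xor X y
    joins-cross (inj₁ (refl , refl)) X = refl
    joins-cross {e} (inj₂ (refl , refl)) X = xor-comm (X (s G e)) (X (t G e))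

    joins-star : ∀ {e x y} → Connects G e x y → x ≢ y → star G x e ≡ true
    joins-star {x = x} j x≢y = trans (joins-cross j (δ x)) (cong₂ _xor_ (δ-refl x) (δ-≢ x≢y))

    joins-off : ∀ {e x y z} → Connects G e x y → z ≢ x → z ≢ y → star G z e ≡ false
    joins-off {z = z} j z≢x z≢y = trans (joins-cross j (δ z)) (cong₂ _xor_ (δ-≢ z≢x) (δ-≢ z≢y))

    star-joins : ∀ {v e} → star G v e ≡ true → ∃ λ w → v ≢ w × Connects G e v w
    star-joins {v} {e} p with v ≟ s G e | v ≟ t G e
    ... | yes refl | yes q = ⊥-elim (true≢false p (trans (cong (δ v v xor_) (cong (δ v) (sym q))) (xor-same (δ v v))))
    ... | yes refl | no  q = t G e , q , inj₁ (refl , refl)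
    ... | no  q | yes refl = s G e , q , inj₂ (refl , refl)
    ... | no  q | no r = ⊥-elim (true≢false p (cong₂ _xor_ (δ-≢ q) (δ-≢ r)))

    joins-nonloop : ∀ {e x y} → Connects G e x y → x ≢ y → nonloop G e ≡ true
    joins-nonloop (inj₁ (refl , refl)) x≢y = cong not (δ-≢ x≢y)
    joins-nonloop (inj₂ (refl , refl)) x≢y = cong not (δ-≢ (x≢y ∘ sym))

    nonloop-star : ∀ {e} → nonloop G e ≡ true → star G (s G e) e ≡ true
    nonloop-star {e} p rewrite δ-refl (s G e) = p

    loop-star : ∀ {e} → nonloop G e ≡ false → ∀ X → cross G X e ≡ false
    loop-star {e} p X with s G e ≟ t G e
    ... | yes q rewrite q = xor-same (X (t G e))
    ... | no  q = ⊥-elim (true≢false (cong not (δ-≢ q)) p)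

    cross-nonloop : ∀ {e} X → cross G X e ≡ true → nonloop G e ≡ true
    cross-nonloop {e} X p = bool-cases id (λ q → ⊥-elim (true≢false p (loop-star q X)))

  cross-cong : ∀ (G : Net n m) {X Y} → X ≗ Y → ∀ e → cross G X e ≡ cross G Y e
  cross-cong G h e = cong₂ _xor_ (h _) (h _)

  cross-xor : ∀ (G : Net n m) X Y e → cross G (λ u → X u xor Y u) e ≡ cross G X e xor cross G Y e
  cross-xor G X Y e = by-valid 4 (λ { (a ∷ b ∷ c ∷ d ∷ []) → (a xor b) xor (c xor d) }) (λ { (a ∷ b ∷ c ∷ d ∷ []) → (a xor c) xor (b xor d) }) refl
    (X (s G e) ∷ Y (s G e) ∷ X (t G e) ∷ Y (t G e) ∷ [])

  cross-not : ∀ (G : Net n m) X e → cross G (not ∘ X) e ≡ cross G X e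
  cross-not G X e = by-valid 2 (λ { (a ∷ b ∷ []) → not a xor not b }) (λ { (a ∷ b ∷ []) → a xor b }) refl (X (s G e) ∷ X (t G e) ∷ [])

  module _ (G : Net n m) {v w : Fin n} (v≢w : v ≢ w) where

    star-merge-other : ∀ {z} → z ≢ v → z ≢ w → star (contract (merge v w) G) z ≗ star G z
    star-merge-other z≢v z≢w e = cong₂ _xor_ (δ-merge-other z≢v z≢w _) (δ-merge-other z≢v z≢w _)

    star-merge-from : ∀ e → star (contract (merge v w) G) v e ≡ false
    star-merge-from e = cong₂ _xor_ (δ-merge-from v≢w _) (δ-merge-from v≢w _)

    -- The stars are added modulo 2: an edge between `v` and `w` lies in both, cancels, and is
    -- indeed a loop after merging.
    star-merge-to : ∀ e → star (contract (merge v w) G) w e ≡ star G w e xor star G v e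
    star-merge-to e = trans (cong₂ _xor_ (δ-merge-to v≢w _) (δ-merge-to v≢w _)) (cross-xor G (δ w) (δ v) e)

  contract-nonloop : ∀ (G : Net n m) ρ e → nonloop (contract ρ G) e ≡ true → nonloop G e ≡ true
  contract-nonloop G ρ e p = cong not (δ-≢ λ q → δ-false (lemma p) (cong ρ q))
    where
    lemma : ∀ {b} → not b ≡ true → b ≡ false
    lemma {false} _ = refl

  contract-size : ∀ (G : Net n m) ρ e → nonloop G e ≡ true → ρ (s G e) ≡ ρ (t G e) → size (contract ρ G) < size G
  contract-size G ρ e p q = count-mono-< (contract-nonloop G ρ) e (cong not (δ-≡ q)) p

  merge-size : ∀ (G : Net n m) {v w e} → v ≢ w → Connects G e v w → size (contract (merge v w) G) < size G
  merge-size G {v} {w} {e} v≢w j = contract-size G (merge v w) e (joins-nonloop G j v≢w) (lemma j)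
    where
    lemma : Connects G e v w → merge v w (s G e) ≡ merge v w (t G e)
    lemma (inj₁ (refl , refl)) = trans (merge-at v w) (sym (merge-off v≢w))
    lemma (inj₂ (refl , refl)) = trans (merge-off v≢w) (sym (merge-at v w))

  contract-NoBridge : ∀ (G : Net n m) ρ → NoBridge G → NoBridge (contract ρ G)
  contract-NoBridge G ρ nb X = nb (X ∘ ρ)

-- Perfect matchings through a given edge

-- A vertex of degree 2 stands for a subdivision vertex: M contains both of its edges or neither.
data Matched : ℕ → ℕ → Set where
  m00 : Matched 0 0
  m20 : Matched 2 0
  m22 : Matched 2 2
  m31 : Matched 3 1

-- Degree 0 covers the vertices left behind by contractions, degree 2 the subdivision vertices;
-- degree 1 would mean a bridge.
data Sub3 : ℕ → Set where
  d0 : Sub3 0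
  d2 : Sub3 2
  d3 : Sub3 3

module _ {n m : ℕ} where

  Subcubic : Net n m → Set
  Subcubic G = ∀ v → Sub3 (deg G v)

  Perfect : Net n m → (Fin m → Bool) → Set
  Perfect G M = ∀ v → Matched (deg G v) (degOn M G v)

  MatchingThrough : Net n m → Fin m → Set
  MatchingThrough G e = ∃ λ M → M e ≡ true × Perfect G M

  -- The matching condition at a vertex sees only its star, so it can be transferred between graphs
  -- and matchings that agree there.
  matched-off : ∀ {G H : Net n m} {M N v} → star G v ≗ star H v → (∀ e → star G v e ≡ true → M e ≡ N e) →
                Matched (deg H v) (degOn N H v) → Matched (deg G v) (degOn M G v)
  matched-off {G} {H} {M} {N} {v} h k = subst₂ Matched (sym (count-cong h)) (sym (count-cong eq))
    where
    eq : ∀ e → M e ∧ star G v e ≡ N e ∧ star H v e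
    eq e = trans (bool-cases {star G v e} {M e ∧ star G v e ≡ N e ∧ star G v e}
                   (λ p → cong (_∧ star G v e) (k e p))
                   (λ p → trans (cong (M e ∧_) p) (trans (by-valid 2 (λ { (a ∷ b ∷ []) → a ∧ false }) (λ { (a ∷ b ∷ []) → b ∧ false }) refl (M e ∷ N e ∷ [])) (cong (N e ∧_) (sym p)))))
                 (cong (N e ∧_) (h e))

  isolated : ∀ {G : Net n m} {v} M → (∀ e → star G v e ≡ false) → Matched (deg G v) (degOn M G v)
  isolated {G} {v} M h = subst₂ Matched (sym (count-false h)) (sym (count-false λ e → trans (cong (M e ∧_) (h e)) (∧-zeroʳ (M e)))) m00

  matched-3 : ∀ {G : Net n m} {v e f g} M → Three (star G v) e f g → bit (M e) + (bit (M f) + bit (M g)) ≡ 1 → Matched (deg G v) (degOn M G v)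
  matched-3 M th p = subst₂ Matched (sym (size₃ th)) (sym (trans (count₃ M th) p)) m31

  matched-2-≡ : ∀ {G : Net n m} {v e f} M → Two (star G v) e f → Matched (deg G v) (degOn M G v) → M e ≡ M f
  matched-2-≡ {e = e} {f} M tw ok with M e | M f | subst₂ Matched (size₂ tw) (count₂ M tw) ok
  ... | true  | true  | _ = refl
  ... | false | false | _ = refl
  ... | true  | false | ()
  ... | false | true  | ()

  matched-3-other : ∀ {G : Net n m} {v e f} M → deg G v ≡ 3 → star G v e ≡ true → star G v f ≡ true → e ≢ f →
                    Matched (deg G v) (degOn M G v) → M e ≡ true → M f ≡ false
  matched-3-other {G} {v} {e} {f} M d p q e≢f ok r with get₃″ {P = star G v} d p q e≢f
  ... | g , th with M e | M f | M g | subst₂ Matched (size₃ th) (count₃ M th) ok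
  ...   | true | false | _ | _ = refl
  ...   | true | true | true  | ()
  ...   | true | true | false | ()

  Sub3-deg : ∀ {G : Net n m} {v e} → Sub3 (deg G v) → star G v e ≡ true → deg G v ≡ 2 ⊎ deg G v ≡ 3
  Sub3-deg {G} {v} {e} s p with deg G v in eq
  Sub3-deg {G} {v} {e} d0 p | _ = ⊥-elim (true≢false p (count-zero (star G v) eq e))
  Sub3-deg d2 p | _ = inj₁ refl
  Sub3-deg d3 p | _ = inj₂ refl

  -- Suppressing a vertex of degree 2

  module Suppress (G : Net n m) (sub : Subcubic G) (nb : NoBridge G) {v w : Fin n} {e f : Fin m}
                  (v≢w : v ≢ w) (j : Connects G e v w) (tw : Two (star G v) e f) where

    open Two tw

    H : Net n m
    H = contract (merge v w) G

    smaller : size H < size G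
    smaller = merge-size G v≢w j

    private
      star-w-e : star G w e ≡ true
      star-w-e = joins-star G (joins-sym G j) (v≢w ∘ sym)

      module Free (f∉w : star G w f ≡ false) (M : Fin m → Bool) (Mef : M e ≡ M f) where

        -- In the merged star `f` takes the place of `e`; once each is pulled out of its own star,
        -- the remainders coincide.
        degOn-w : degOn M G w ≡ degOn M H w
        degOn-w = begin
          count P                           ≡⟨ count-pull P e ⟩
          bit (P e) + count (P ∖ e)         ≡⟨ cong₂ _+_ (cong bit at) (count-cong off) ⟩
          bit (Q f) + count (Q ∖ f)         ≡⟨ count-pull Q f ⟨
          count Q                           ∎
          where
          open ≡-Reasoning
          P Q : Fin m → Bool
          P i = M i ∧ star G w i
          Q i = M i ∧ star H w i
          at : P e ≡ Q f
          at = cong₂ _∧_ Mef (trans star-w-e (sym (trans (star-merge-to G v≢w f) (cong₂ _xor_ f∉w at₂))))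
          off : ∀ i → (P ∖ e) i ≡ (Q ∖ f) i
          off i with e ≟ i | f ≟ i
          ... | yes refl | _ = trans (cong (λ b → P i ∧ not b) (δ-refl i)) (trans (∧-zeroʳ (P i))
                  (sym (trans (cong (λ b → (M i ∧ b) ∧ not (δ f i)) (trans (star-merge-to G v≢w i) (cong₂ _xor_ star-w-e at₁)))
                  (trans (cong (_∧ not (δ f i)) (∧-zeroʳ (M i))) refl))))
          ... | no e≢i | yes refl = trans (cong₂ (λ a b → (M i ∧ a) ∧ not b) f∉w (δ-≢ e≢i)) (trans (by-valid 2 (λ { (a ∷ b ∷ []) → (a ∧ false) ∧ true }) (λ { (a ∷ b ∷ []) → b ∧ false }) refl (M i ∷ Q i ∷ []))
                  (sym (cong (λ b → Q i ∧ not b) (δ-refl i))))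
          ... | no e≢i | no f≢i = cong₂ (λ a b → (M i ∧ a) ∧ not b)
                  (sym (trans (star-merge-to G v≢w i) (trans (cong (star G w i xor_) (≢true λ p → [ e≢i ∘ sym , f≢i ∘ sym ]′ (only i p))) (xor-comm (star G w i) false))))
                  (trans (δ-≢ e≢i) (sym (δ-≢ f≢i)))

      module Parallel (f∈w : star G w f ≡ true) (M : Fin m → Bool) where

        -- Both edges at `v` lead to `w` and become loops, so the star of `w` loses exactly these
        -- two.
        degOn-w : degOn M G w ≡ bit (M e) + (bit (M f) + degOn M H w)
        degOn-w = begin
          count P                                               ≡⟨ count-pull P e ⟩
          bit (P e) + count (P ∖ e)                             ≡⟨ cong (bit (P e) +_) (count-pull (P ∖ e) f) ⟩
          bit (P e) + (bit ((P ∖ e) f) + count (P ∖ e ∖ f))     ≡⟨ cong₂ (λ a b → bit a + (bit b + count (P ∖ e ∖ f))) atₑ at_f ⟩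
          bit (M e) + (bit (M f) + count (P ∖ e ∖ f))           ≡⟨ cong (λ c → bit (M e) + (bit (M f) + c)) (count-cong off) ⟩
          bit (M e) + (bit (M f) + count Q)                     ∎
          where
          open ≡-Reasoning
          P Q : Fin m → Bool
          P i = M i ∧ star G w i
          Q i = M i ∧ star H w i
          atₑ : P e ≡ M e
          atₑ = trans (cong (M e ∧_) star-w-e) (∧-identityʳ (M e))
          at_f : (P ∖ e) f ≡ M f
          at_f = trans (cong₂ (λ a b → (M f ∧ a) ∧ not b) f∈w (δ-≢ ≢₁₂)) (by-valid 1 (λ { (a ∷ []) → (a ∧ true) ∧ true }) (λ { (a ∷ []) → a }) refl (M f ∷ []))
          off : ∀ i → (P ∖ e ∖ f) i ≡ Q i
          off i with e ≟ i | f ≟ i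
          ... | yes refl | _ = trans (cong (λ b → (P i ∧ not b) ∧ not (δ f i)) (δ-refl i)) (trans (cong (_∧ not (δ f i)) (∧-zeroʳ (P i)))
                  (sym (trans (cong (M i ∧_) (trans (star-merge-to G v≢w i) (cong₂ _xor_ star-w-e at₁))) (∧-zeroʳ (M i)))))
          ... | no e≢i | yes refl = trans (cong (λ b → (P ∖ e) i ∧ not b) (δ-refl i)) (trans (∧-zeroʳ ((P ∖ e) i))
                  (sym (trans (cong (M i ∧_) (trans (star-merge-to G v≢w i) (cong₂ _xor_ f∈w at₂))) (∧-zeroʳ (M i)))))
          ... | no e≢i | no f≢i = trans (cong₂ (λ a b → (P i ∧ not a) ∧ not b) (δ-≢ e≢i) (δ-≢ f≢i))
                  (trans (by-valid 1 (λ { (a ∷ []) → (a ∧ true) ∧ true }) (λ { (a ∷ []) → a }) refl (P i ∷ []))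
                  (cong (M i ∧_) (sym (trans (star-merge-to G v≢w i) (trans (cong (star G w i xor_) (≢true λ p → [ e≢i ∘ sym , f≢i ∘ sym ]′ (only i p))) (xor-comm (star G w i) false))))))

      -- If `w` had degree 3, one edge would be left over at it, which would be a bridge.
      shrink : ∀ {d} → Sub3 (suc (suc d)) → d ≢ 1 → Sub3 d
      shrink d2 _ = d0
      shrink d3 h = ⊥-elim (h refl)

      grow : ∀ {d x} b → Sub3 (suc (suc d)) → Matched d x → Matched (suc (suc d)) (bit b + (bit b + x))
      grow true  d2 m00 = m22
      grow false d2 m00 = m20


    subcubic : Subcubic H
    subcubic = at-two v w (λ z → Sub3 (deg H z))
      (subst Sub3 (sym (count-false (star-merge-from G v≢w))) d0)
      (bool-cases {star G w f}
        (λ p → shrink (subst Sub3 (Parallel.degOn-w p (const true)) (sub w)) (contract-NoBridge G (merge v w) nb (δ w)))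
        (λ p → subst Sub3 (Free.degOn-w p (const true) refl) (sub w)))
      (λ {z} z≢v z≢w → subst Sub3 (sym (count-cong (star-merge-other G v≢w z≢v z≢w))) (sub z))

    noBridge : NoBridge H
    noBridge = contract-NoBridge G (merge v w) nb

    -- The contracted edge `e` copies the value of `f`, as the rule for degree 2 demands. It must
    -- differ from `e₀`, whose value is prescribed.
    lift : ∀ {e₀} → e ≢ e₀ → MatchingThrough H e₀ → MatchingThrough G e₀
    lift {e₀} e≢e₀ (M′ , through , perfect) = M , trans (upd-off M′ (M′ f) e≢e₀) through ,
      at-two v w (λ z → Matched (deg G z) (degOn M G z)) at-v at-w at-z
      where
      M = upd M′ e (M′ f)
      Me≡Mf : M e ≡ M f
      Me≡Mf = trans (upd-at M′ e (M′ f)) (sym (upd-off M′ (M′ f) ≢₁₂))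
      e∉H : ∀ X → cross H X e ≡ false
      e∉H = loop-star H (≢true λ p → true≢false p (cong not (δ-≡ (lemma j))))
        where
        lemma : Connects G e v w → merge v w (s G e) ≡ merge v w (t G e)
        lemma (inj₁ (refl , refl)) = trans (merge-at v w) (sym (merge-off v≢w))
        lemma (inj₂ (refl , refl)) = trans (merge-off v≢w) (sym (merge-at v w))
      same : ∀ {z} i → star H z i ≡ true → M i ≡ M′ i
      same {z} i p = upd-off M′ (M′ f) λ { refl → true≢false p (e∉H (δ z)) }
      perfect′ : Perfect H M
      perfect′ z = matched-off {H} {H} {M} {M′} (λ _ → refl) (same {z}) (perfect z)
      at-v : Matched (deg G v) (degOn M G v)
      at-v = subst₂ Matched (sym (size₂ tw)) (sym (trans (count₂ M tw) (cong (λ b → bit b + bit (M f)) Me≡Mf))) (twice (M f))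
        where
        twice : ∀ b → Matched 2 (bit b + bit b)
        twice true  = m22
        twice false = m20
      at-w : Matched (deg G w) (degOn M G w)
      at-w = bool-cases {star G w f}
        (λ p → subst₂ Matched (sym (Parallel.degOn-w p (const true))) (sym (trans (Parallel.degOn-w p M) (cong (λ b → bit b + (bit (M f) + degOn M H w)) Me≡Mf)))
          (grow (M f) (subst Sub3 (Parallel.degOn-w p (const true)) (sub w)) (perfect′ w)))
        (λ p → subst₂ Matched (sym (Free.degOn-w p (const true) refl)) (sym (Free.degOn-w p M Me≡Mf)) (perfect′ w))
      at-z : ∀ {z} → z ≢ v → z ≢ w → Matched (deg G z) (degOn M G z)
      at-z {z} z≢v z≢w = subst₂ Matched (count-cong eq) (count-cong λ i → cong (M i ∧_) (eq i)) (perfect′ z)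
        where
        eq = star-merge-other G v≢w z≢v z≢w

  -- Contracting a pair of parallel edges

  module Digon (G : Net n m) (sub : Subcubic G) (nb : NoBridge G) {x y : Fin n} {f q k l : Fin m}
               (x≢y : x ≢ y) (jf : Connects G f x y)
               (tx : Three (star G x) f q k) (ty : Three (star G y) f q l) where

    private
      module X = Three tx
      module Y = Three ty

    H : Net n m
    H = contract (merge y x) G

    y≢x : y ≢ x
    y≢x = x≢y ∘ sym

    smaller : size H < size G
    smaller = merge-size G y≢x (joins-sym G jf)

    noBridge : NoBridge H
    noBridge = contract-NoBridge G (merge y x) nb

    private
      star-x : ∀ i → star H x i ≡ star G x i xor star G y i
      star-x = star-merge-to G y≢x

      -- Here `x` and `y` are joined by three parallel edges, all of which become loops.
      empty : k ≡ l → ∀ i → star H x i ≡ false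
      empty refl i with i ≟ f | i ≟ q | i ≟ k
      ... | yes refl | _ | _ = trans (star-x i) (cong₂ _xor_ X.at₁ Y.at₁)
      ... | no _ | yes refl | _ = trans (star-x i) (cong₂ _xor_ X.at₂ Y.at₂)
      ... | no _ | no _ | yes refl = trans (star-x i) (cong₂ _xor_ X.at₃ Y.at₃)
      ... | no a | no b | no c = trans (star-x i) (cong₂ _xor_ (X.off i a b c) (Y.off i a b c))

      two : k ≢ l → Two (star H x) k l
      two k≢l = record
        { at₁ = trans (star-x k) (cong₂ _xor_ X.at₃ (Y.off k (X.≢₁₃ ∘ sym) (X.≢₂₃ ∘ sym) k≢l))
        ; at₂ = trans (star-x l) (cong₂ _xor_ (X.off l (Y.≢₁₃ ∘ sym) (Y.≢₂₃ ∘ sym) (k≢l ∘ sym)) Y.at₃)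
        ; ≢₁₂ = k≢l ; only = only }
        where
        only : ∀ i → star H x i ≡ true → i ≡ k ⊎ i ≡ l
        only i p with i ≟ f | i ≟ q | i ≟ k | i ≟ l
        ... | yes refl | _ | _ | _ = ⊥-elim (true≢false p (trans (star-x i) (cong₂ _xor_ X.at₁ Y.at₁)))
        ... | no _ | yes refl | _ | _ = ⊥-elim (true≢false p (trans (star-x i) (cong₂ _xor_ X.at₂ Y.at₂)))
        ... | no _ | no _ | yes r | _ = inj₁ r
        ... | no _ | no _ | no _ | yes r = inj₂ r
        ... | no a | no b | no c | no d = ⊥-elim (true≢false p (trans (star-x i) (cong₂ _xor_ (X.off i a b c) (Y.off i a b d))))


    subcubic : Subcubic H
    subcubic = at-two x y (λ z → Sub3 (deg H z))
      at-x
      (subst Sub3 (sym (count-false (star-merge-from G y≢x))) d0)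
      (λ {z} z≢x z≢y → subst Sub3 (sym (count-cong (star-merge-other G y≢x z≢y z≢x))) (sub z))
      where
      at-x : Sub3 (deg H x)
      at-x with k ≟ l
      ... | yes r = subst Sub3 (sym (count-false (empty r))) d0
      ... | no  r = subst Sub3 (sym (size₂ (two r))) d2

    lift : ∀ {e₀} → f ≢ e₀ → q ≢ e₀ → MatchingThrough H e₀ → MatchingThrough G e₀
    lift {e₀} f≢e₀ q≢e₀ (M′ , through , perfect) =
      M , trans (M-off q≢e₀ f≢e₀) through ,
      at-two x y (λ z → Matched (deg G z) (degOn M G z)) at-x at-y at-z
      where
      M₁ = upd M′ f (not (M′ k))
      M  = upd M₁ q false
      M-off : ∀ {i} → q ≢ i → f ≢ i → M i ≡ M′ i
      M-off a b = trans (upd-off M₁ false a) (upd-off M′ _ b)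
      Mf : M f ≡ not (M′ k)
      Mf = trans (upd-off M₁ false (X.≢₁₂ ∘ sym)) (upd-at M′ f _)
      Mk : M k ≡ M′ k
      Mk = M-off X.≢₂₃ X.≢₁₃
      Ml : M l ≡ M′ k
      Ml with k ≟ l
      ... | yes refl = Mk
      ... | no  r    = trans (M-off Y.≢₂₃ Y.≢₁₃) (sym (matched-2-≡ {H} {x} M′ (two r) (perfect x)))
      sum1 : ∀ b → bit (not b) + (0 + bit b) ≡ 1
      sum1 true  = refl
      sum1 false = refl
      at-x = matched-3 {G} M tx (trans (cong₂ (λ a b → a + b) (cong bit Mf) (cong₂ _+_ (cong bit (upd-at M₁ q false)) (cong bit Mk))) (sum1 (M′ k)))
      at-y = matched-3 {G} M ty (trans (cong₂ (λ a b → a + b) (cong bit Mf) (cong₂ _+_ (cong bit (upd-at M₁ q false)) (cong bit Ml))) (sum1 (M′ k)))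
      jq : Connects G q x y
      jq with star-joins G {x} {q} X.at₂
      ... | w , x≢w , j with w ≟ y
      ...   | yes refl = j
      ...   | no  w≢y  = ⊥-elim (true≢false Y.at₂ (joins-off G j y≢x (w≢y ∘ sym)))
      at-z : ∀ {z} → z ≢ x → z ≢ y → Matched (deg G z) (degOn M G z)
      at-z {z} z≢x z≢y = matched-off {G} {H} {M} {M′} (λ e → sym (star-merge-other G y≢x z≢y z≢x e))
        (λ e p → M-off (λ { refl → true≢false p (joins-off G jq z≢x z≢y) }) (λ { refl → true≢false p (joins-off G jf z≢x z≢y) }))
        (perfect z)

-- Removing an edge and reconnecting its neighbours

module _ {n m : ℕ} where

  -- The surroundings of an edge f = xy without parallel edges:  x = {f, p, q},  y = {f, r, u},  p = xa,  q = xb,  r = yc,  u = yd.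
  record Around (G : Net n m) (x y : Fin n) (f p q r u : Fin m) (a b c d : Fin n) : Set where
    field
      x≢y : x ≢ y
      tx  : Three (star G x) f p q
      ty  : Three (star G y) f r u
      jf  : Connects G f x y
      jp  : Connects G p x a
      jq  : Connects G q x b
      jr  : Connects G r y c
      ju  : Connects G u y d
      a≢x : a ≢ x
      a≢y : a ≢ y
      b≢x : b ≢ x
      b≢y : b ≢ y
      c≢x : c ≢ x
      c≢y : c ≢ y
      d≢x : d ≢ x
      d≢y : d ≢ y

    module X = Three tx
    module Y = Three ty

    y≢x : y ≢ x
    y≢x = x≢y ∘ sym

    p≢r : p ≢ r
    p≢r refl = true≢false Y.at₂ (joins-off G jp y≢x (a≢y ∘ sym))
    q≢r : q ≢ r
    q≢r refl = true≢false Y.at₂ (joins-off G jq y≢x (b≢y ∘ sym))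
    q≢u : q ≢ u
    q≢u refl = true≢false Y.at₃ (joins-off G jq y≢x (b≢y ∘ sym))

    Far : Fin m → Set
    Far e = star G x e ≡ false × star G y e ≡ false

    five : ∀ {A : Fin m → Set} → A f → A p → A q → A r → A u → (∀ e → e ≢ f → e ≢ p → e ≢ q → e ≢ r → e ≢ u → Far e → A e) → ∀ e → A e
    five af ap aq ar au rest e with e ≟ f | e ≟ p | e ≟ q | e ≟ r | e ≟ u
    ... | yes refl | _ | _ | _ | _ = af
    ... | no _ | yes refl | _ | _ | _ = ap
    ... | no _ | no _ | yes refl | _ | _ = aq
    ... | no _ | no _ | no _ | yes refl | _ = ar
    ... | no _ | no _ | no _ | no _ | yes refl = au
    ... | no e≢f | no e≢p | no e≢q | no e≢r | no e≢u = rest e e≢f e≢p e≢q e≢r e≢u (X.off e e≢f e≢p e≢q , Y.off e e≢f e≢r e≢u)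

  -- Exchanging `r` and `u` turns one of the two possible reconnections into the other.
  swap-ru : ∀ {G : Net n m} {x y f p q r u a b c d} → Around G x y f p q r u a b c d → Around G x y f p q u r a b d c
  swap-ru A = record
    { x≢y = x≢y ; tx = tx ; jf = jf ; jp = jp ; jq = jq ; jr = ju ; ju = jr
    ; ty = record { at₁ = Y.at₁ ; at₂ = Y.at₃ ; at₃ = Y.at₂ ; ≢₁₂ = Y.≢₁₃ ; ≢₁₃ = Y.≢₁₂ ; ≢₂₃ = Y.≢₂₃ ∘ sym ; only = λ i s → flip (Y.only i s) }
    ; a≢x = a≢x ; a≢y = a≢y ; b≢x = b≢x ; b≢y = b≢y ; c≢x = d≢x ; c≢y = d≢y ; d≢x = c≢x ; d≢y = c≢y }
    where
    open Around A
    flip : ∀ {P Q R : Set} → P ⊎ Q ⊎ R → P ⊎ R ⊎ Q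
    flip (inj₁ p)        = inj₁ p
    flip (inj₂ (inj₁ q)) = inj₂ (inj₂ q)
    flip (inj₂ (inj₂ r)) = inj₂ (inj₁ r)

  cross-merge-off : ∀ (G : Net n m) X v w e → star G v e ≡ false → cross G (X ∘ merge v w) e ≡ cross G X e
  cross-merge-off G X v w e h with v ≟ s G e | v ≟ t G e
  ... | yes p | yes q = trans (cong (λ i → X (merge v w (s G e)) xor X (merge v w i)) (trans (sym q) p))
        (trans (xor-same (X (merge v w (s G e)))) (sym (trans (cong (λ i → X (s G e) xor X i) (trans (sym q) p)) (xor-same (X (s G e))))))
  ... | yes p | no  q = ⊥-elim (true≢false (cong₂ _xor_ (δ-≡ p) (δ-≢ q)) h)
  ... | no  p | yes q = ⊥-elim (true≢false (cong₂ _xor_ (δ-≢ p) (δ-≡ q)) h)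
  ... | no  p | no  q = cong₂ (λ i j → X i xor X j) (merge-off p) (merge-off q)

  -- Delete f = xy and reconnect its ends to the two paths a-x-c and b-y-d; x and y then have degree 2.
  module Split (G : Net n m) {x y f p q r u a b c d} (A : Around G x y f p q r u a b c d) where

    open Around A

    -- Moving one edge at each end suffices: `p` and `u` stay in place, and `f` survives as a loop
    -- at `x`.
    σ : Fin m → Fin n → Fin n
    σ e z = if δ f e then x else if δ q e then merge x y z else if δ r e then merge y x z else z

    H : Net n m
    H = relabel σ G

    σf : ∀ z → σ f z ≡ x
    σf z rewrite δ-refl f = refl

    σq : ∀ z → σ q z ≡ merge x y z
    σq z rewrite δ-≢ X.≢₁₃ | δ-refl q = refl

    σr : ∀ z → σ r z ≡ merge y x z
    σr z rewrite δ-≢ Y.≢₁₂ | δ-≢ q≢r | δ-refl r = refl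

    σ-id : ∀ {e} → e ≢ f → e ≢ q → e ≢ r → ∀ z → σ e z ≡ z
    σ-id a b c z rewrite δ-≢ (a ∘ sym) | δ-≢ (b ∘ sym) | δ-≢ (c ∘ sym) = refl

    crossf : ∀ Z → cross H Z f ≡ false
    crossf Z = trans (cong₂ (λ i j → Z i xor Z j) (σf _) (σf _)) (xor-same (Z x))

    cross-id : ∀ Z {e} → e ≢ f → e ≢ q → e ≢ r → cross H Z e ≡ cross G Z e
    cross-id Z a b c = cong₂ (λ i j → Z i xor Z j) (σ-id a b c _) (σ-id a b c _)

    crossp : ∀ Z → cross H Z p ≡ Z x xor Z a
    crossp Z = trans (cross-id Z (X.≢₁₂ ∘ sym) X.≢₂₃ p≢r) (joins-cross G jp Z)

    crossu : ∀ Z → cross H Z u ≡ Z y xor Z d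
    crossu Z = trans (cross-id Z (Y.≢₁₃ ∘ sym) (q≢u ∘ sym) (Y.≢₂₃ ∘ sym)) (joins-cross G ju Z)

    crossq : ∀ Z → cross H Z q ≡ Z y xor Z b
    crossq Z = trans (cong₂ (λ i j → Z i xor Z j) (σq _) (σq _))
      (trans (joins-cross G jq (Z ∘ merge x y)) (cong₂ (λ i j → Z i xor Z j) (merge-at x y) (merge-off (b≢x ∘ sym))))

    crossr : ∀ Z → cross H Z r ≡ Z x xor Z c
    crossr Z = trans (cong₂ (λ i j → Z i xor Z j) (σr _) (σr _))
      (trans (joins-cross G jr (Z ∘ merge y x)) (cong₂ (λ i j → Z i xor Z j) (merge-at y x) (merge-off (c≢y ∘ sym))))

    smaller : size H < size G
    smaller = count-mono-< (λ e h → bool-cases id (λ g → ⊥-elim (true≢false h (loop e g)))) f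
      (cong not (δ-≡ (trans (σf _) (sym (σf _))))) (joins-nonloop G jf x≢y)
      where
      loop : ∀ e → nonloop G e ≡ false → nonloop H e ≡ false
      loop e g with s G e ≟ t G e
      ... | yes h = cong not (δ-≡ (cong (σ e) h))
      ... | no  h = ⊥-elim (true≢false (cong not (δ-≢ h)) g)

    private
      false-xor : ∀ {i j : Bool} → i ≡ false → j ≡ false → i xor j ≡ false
      false-xor refl refl = refl

    star-other : ∀ {z} → z ≢ x → z ≢ y → star H z ≗ star G z
    star-other {z} z≢x z≢y = five
      (trans (crossf (δ z)) (sym (joins-off G jf z≢x z≢y)))
      (cross-id (δ z) (X.≢₁₂ ∘ sym) X.≢₂₃ p≢r)
      (trans (crossq (δ z)) (sym (trans (joins-cross G jq (δ z)) (cong (_xor δ z b) (trans (δ-≢ z≢x) (sym (δ-≢ z≢y)))))))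
      (trans (crossr (δ z)) (sym (trans (joins-cross G jr (δ z)) (cong (_xor δ z c) (trans (δ-≢ z≢y) (sym (δ-≢ z≢x)))))))
      (cross-id (δ z) (Y.≢₁₃ ∘ sym) (q≢u ∘ sym) (Y.≢₂₃ ∘ sym))
      (λ e a b c d e _ → cross-id (δ z) a c d)

    two-x : Two (star H x) p r
    two-x = record
      { at₁ = trans (crossp (δ x)) (cong₂ _xor_ (δ-refl x) (δ-≢ (a≢x ∘ sym)))
      ; at₂ = trans (crossr (δ x)) (cong₂ _xor_ (δ-refl x) (δ-≢ (c≢x ∘ sym)))
      ; ≢₁₂ = p≢r
      ; only = five {λ e → star H x e ≡ true → e ≡ p ⊎ e ≡ r}
          (λ h → ⊥-elim (true≢false h (crossf (δ x))))
          (λ _ → inj₁ refl)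
          (λ h → ⊥-elim (true≢false h (trans (crossq (δ x)) (false-xor (δ-≢ x≢y) (δ-≢ (b≢x ∘ sym))))))
          (λ _ → inj₂ refl)
          (λ h → ⊥-elim (true≢false h (trans (crossu (δ x)) (false-xor (δ-≢ x≢y) (δ-≢ (d≢x ∘ sym))))))
          (λ e ≢f ≢p ≢q ≢r ≢u far h → ⊥-elim (true≢false h (trans (cross-id (δ x) ≢f ≢q ≢r) (proj₁ far)))) }

    two-y : Two (star H y) q u
    two-y = record
      { at₁ = trans (crossq (δ y)) (cong₂ _xor_ (δ-refl y) (δ-≢ (b≢y ∘ sym)))
      ; at₂ = trans (crossu (δ y)) (cong₂ _xor_ (δ-refl y) (δ-≢ (d≢y ∘ sym)))
      ; ≢₁₂ = q≢u
      ; only = five {λ e → star H y e ≡ true → e ≡ q ⊎ e ≡ u}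
          (λ h → ⊥-elim (true≢false h (crossf (δ y))))
          (λ h → ⊥-elim (true≢false h (trans (crossp (δ y)) (false-xor (δ-≢ y≢x) (δ-≢ (a≢y ∘ sym))))))
          (λ _ → inj₁ refl)
          (λ h → ⊥-elim (true≢false h (trans (crossr (δ y)) (false-xor (δ-≢ y≢x) (δ-≢ (c≢y ∘ sym))))))
          (λ _ → inj₂ refl)
          (λ e ≢f ≢p ≢q ≢r ≢u far h → ⊥-elim (true≢false h (trans (cross-id (δ y) ≢f ≢q ≢r) (proj₂ far)))) }

    subcubic : Subcubic G → Subcubic H
    subcubic sub = at-two x y (λ z → Sub3 (deg H z))
      (subst Sub3 (sym (size₂ two-x)) d2)
      (subst Sub3 (sym (size₂ two-y)) d2)
      (λ {z} z≢x z≢y → subst Sub3 (sym (count-cong (star-other z≢x z≢y))) (sub z))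

    -- Since `e₀` is the matching edge at `a`, the edge `p` is unmatched, and so is its partner `r`
    -- at `x`. The partners `q` and `u` at `y` agree, so `f` is added exactly when they are
    -- unmatched.
    lift : ∀ {e₀} → deg G a ≡ 3 → star G a e₀ ≡ true → p ≢ e₀ → MatchingThrough H e₀ → MatchingThrough G e₀
    lift {e₀} deg-a e₀∈a p≢e₀ (M′ , through , perfect) =
      M , trans (upd-off M′ _ f≢e₀) through ,
      at-two x y (λ z → Matched (deg G z) (degOn M G z)) at-x at-y at-z
      where
      M = upd M′ f (not (M′ q))
      f≢e₀ : f ≢ e₀
      f≢e₀ refl = true≢false e₀∈a (joins-off G jf a≢x a≢y)
      H≗G : star H a ≗ star G a
      H≗G = star-other a≢x a≢y
      M′p : M′ p ≡ false
      M′p = matched-3-other {G = H} {v = a} {e = e₀} M′ (trans (count-cong H≗G) deg-a) (trans (H≗G e₀) e₀∈a)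
        (trans (H≗G p) (joins-star G (joins-sym G jp) a≢x)) (p≢e₀ ∘ sym) (perfect a) through
      M′r : M′ r ≡ false
      M′r = trans (sym (matched-2-≡ {G = H} {v = x} M′ two-x (perfect x))) M′p
      M′u : M′ u ≡ M′ q
      M′u = sym (matched-2-≡ {G = H} {v = y} M′ two-y (perfect y))
      Mf : M f ≡ not (M′ q)
      Mf = upd-at M′ f _
      M-off : ∀ {i} → f ≢ i → M i ≡ M′ i
      M-off = upd-off M′ _
      sum1 : ∀ {i j k} b → i ≡ not b → j ≡ false → k ≡ b → bit i + (bit j + bit k) ≡ 1
      sum1 true  refl refl refl = refl
      sum1 false refl refl refl = refl
      at-x = matched-3 {G = G} M tx (sum1 (M′ q) Mf (trans (M-off X.≢₁₂) M′p) (M-off X.≢₁₃))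
      at-y = matched-3 {G = G} M ty (sum1 (M′ q) Mf (trans (M-off Y.≢₁₂) M′r) (trans (M-off Y.≢₁₃) M′u))
      at-z : ∀ {z} → z ≢ x → z ≢ y → Matched (deg G z) (degOn M G z)
      at-z {z} z≢x z≢y = matched-off {G = G} {H} {M} {M′} (sym ∘ star-other z≢x z≢y)
        (λ e h → M-off λ { refl → true≢false h (joins-off G jf z≢x z≢y) }) (perfect z)

    -- A bridge `ε` of `H` as seen in `G`: the cut separates `x`, `a`, `c` from `y`, `b`, `d`, and
    -- `ε` is the only edge away from `x` and `y` that crosses it.
    record BadCut (Z : Fin n → Bool) : Set where
      field
        ε   : Fin m
        far : Far ε
        Za  : Z a ≡ Z x
        Zb  : Z b ≡ Z y
        Zc  : Z c ≡ Z x
        Zd  : Z d ≡ Z y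
        Zxy : Z x ≡ not (Z y)
        at  : cross G Z ε ≡ true
        only : ∀ e → Far e → cross G Z e ≡ true → e ≡ ε

    -- If `Z` did not separate `x` from `y`, it would cut a single edge in `G` too. If the bridge
    -- were one of `p`, `q`, `r`, `u`, moving `x` or `y` to the other side would exchange it for its
    -- partner and again leave a one-edge cut of `G`.
    badCut : NoBridge G → ∀ Z → cut H Z ≡ 1 → BadCut Z
    badCut nb Z one with get₁ one
    ... | ε , o = record
      { ε = ε ; far = proj₂ ε-far
      ; Za = xor-false (trans (sym (crossp Z)) (miss ε≢p))
      ; Zb = xor-false (trans (sym (crossq Z)) (miss ε≢q))
      ; Zc = xor-false (trans (sym (crossr Z)) (miss ε≢r))
      ; Zd = xor-false (trans (sym (crossu Z)) (miss ε≢u))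
      ; Zxy = Zx≢Zy
      ; at = trans (sym (proj₁ ε-far Z)) at₁
      ; only = five {λ e → Far e → cross G Z e ≡ true → e ≡ ε}
          (λ h _ → ⊥-elim (true≢false X.at₁ (proj₁ h)))
          (λ h _ → ⊥-elim (true≢false X.at₂ (proj₁ h)))
          (λ h _ → ⊥-elim (true≢false X.at₃ (proj₁ h)))
          (λ h _ → ⊥-elim (true≢false Y.at₂ (proj₂ h)))
          (λ h _ → ⊥-elim (true≢false Y.at₃ (proj₂ h)))
          (λ e ≢f ≢p ≢q ≢r ≢u _ _ h → only e (trans (cross-id Z ≢f ≢q ≢r) h)) }
      where
      open One o
      xor-false : ∀ {i j} → i xor j ≡ false → j ≡ i
      xor-false {true}  {true}  _ = refl
      xor-false {false} {false} _ = refl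
      not-xor : ∀ {i j k} → i ≡ not k → i xor j ≡ not (k xor j)
      not-xor {k = true}  refl = sym (not-involutive _)
      not-xor {k = false} refl = refl
      miss : ∀ {e} → ε ≢ e → cross H Z e ≡ false
      miss ε≢e = ≢true λ h → ε≢e (sym (only _ h))

      Zx≢Zy : Z x ≡ not (Z y)
      Zx≢Zy = ¬-not λ h → nb Z (trans (count-cong (same h)) one)
        where
        same : Z x ≡ Z y → ∀ e → cross G Z e ≡ cross H Z e
        same h = five
          (trans (joins-cross G jf Z) (trans (cong (_xor Z y) h) (trans (xor-same (Z y)) (sym (crossf Z)))))
          (sym (cross-id Z (X.≢₁₂ ∘ sym) X.≢₂₃ p≢r))
          (trans (joins-cross G jq Z) (trans (cong (_xor Z b) h) (sym (crossq Z))))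
          (trans (joins-cross G jr Z) (trans (cong (_xor Z c) (sym h)) (sym (crossr Z))))
          (sym (cross-id Z (Y.≢₁₃ ∘ sym) (q≢u ∘ sym) (Y.≢₂₃ ∘ sym)))
          (λ e a b c d e _ → sym (cross-id Z a c d))

      Zy≢Zx : Z y ≡ not (Z x)
      Zy≢Zx = trans (sym (not-involutive (Z y))) (cong not (sym Zx≢Zy))

      -- Moving x (or y) to the other side toggles exactly two of the cut edges.
      toggle : ∀ W g h → g ≢ h → cross G W g ≡ not (cross H Z g) → cross G W h ≡ not (cross H Z h) →
               (∀ e → e ≢ g → e ≢ h → cross G W e ≡ cross H Z e) → ε ≢ g
      toggle W g h g≢h Wg Wh rest refl = nb W (size₁ {e = h} record
        { at₁ = trans Wh (cong not (miss g≢h))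
        ; only = λ e k → only′ e k (e ≟ g) (e ≟ h) })
        where
        only′ : ∀ e → cross G W e ≡ true → Dec (e ≡ g) → Dec (e ≡ h) → e ≡ h
        only′ e k (yes refl) _ = ⊥-elim (true≢false k (trans Wg (cong not at₁)))
        only′ e k (no _) (yes l) = l
        only′ e k (no i) (no j) = ⊥-elim (i (only e (trans (sym (rest e i j)) k)))

      X₁ X₂ : Fin n → Bool
      X₁ = Z ∘ merge x y
      X₂ = Z ∘ merge y x
      X₁x : X₁ x ≡ Z y
      X₁x = cong Z (merge-at x y)
      X₂y : X₂ y ≡ Z x
      X₂y = cong Z (merge-at y x)
      X₁≡ : ∀ {z} → z ≢ x → X₁ z ≡ Z z
      X₁≡ h = cong Z (merge-off (h ∘ sym))
      X₂≡ : ∀ {z} → z ≢ y → X₂ z ≡ Z z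
      X₂≡ h = cong Z (merge-off (h ∘ sym))

      X₁p : cross G X₁ p ≡ not (cross H Z p)
      X₁p = trans (joins-cross G jp X₁) (trans (cong₂ _xor_ X₁x (X₁≡ a≢x)) (trans (not-xor Zy≢Zx) (cong not (sym (crossp Z)))))
      X₁r : cross G X₁ r ≡ not (cross H Z r)
      X₁r = trans (joins-cross G jr X₁) (trans (cong₂ _xor_ (X₁≡ y≢x) (X₁≡ c≢x)) (trans (not-xor Zy≢Zx) (cong not (sym (crossr Z)))))
      X₁-rest : ∀ e → e ≢ p → e ≢ r → cross G X₁ e ≡ cross H Z e
      X₁-rest = five {λ e → e ≢ p → e ≢ r → cross G X₁ e ≡ cross H Z e}
        (λ _ _ → trans (joins-cross G jf X₁) (trans (cong₂ _xor_ X₁x (X₁≡ y≢x)) (trans (xor-same (Z y)) (sym (crossf Z)))))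
        (λ h _ → ⊥-elim (h refl))
        (λ _ _ → trans (joins-cross G jq X₁) (trans (cong₂ _xor_ X₁x (X₁≡ b≢x)) (sym (crossq Z))))
        (λ _ h → ⊥-elim (h refl))
        (λ _ _ → trans (joins-cross G ju X₁) (trans (cong₂ _xor_ (X₁≡ y≢x) (X₁≡ d≢x)) (sym (crossu Z))))
        (λ e ≢f ≢p ≢q ≢r ≢u far _ _ → trans (cross-merge-off G Z x y e (proj₁ far)) (sym (cross-id Z ≢f ≢q ≢r)))
      X₂q : cross G X₂ q ≡ not (cross H Z q)
      X₂q = trans (joins-cross G jq X₂) (trans (cong₂ _xor_ (X₂≡ x≢y) (X₂≡ b≢y)) (trans (not-xor Zx≢Zy) (cong not (sym (crossq Z)))))
      X₂u : cross G X₂ u ≡ not (cross H Z u)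
      X₂u = trans (joins-cross G ju X₂) (trans (cong₂ _xor_ X₂y (X₂≡ d≢y)) (trans (not-xor Zx≢Zy) (cong not (sym (crossu Z)))))
      X₂-rest : ∀ e → e ≢ q → e ≢ u → cross G X₂ e ≡ cross H Z e
      X₂-rest = five {λ e → e ≢ q → e ≢ u → cross G X₂ e ≡ cross H Z e}
        (λ _ _ → trans (joins-cross G jf X₂) (trans (cong₂ _xor_ (X₂≡ x≢y) X₂y) (trans (xor-same (Z x)) (sym (crossf Z)))))
        (λ _ _ → trans (joins-cross G jp X₂) (trans (cong₂ _xor_ (X₂≡ x≢y) (X₂≡ a≢y)) (sym (crossp Z))))
        (λ h _ → ⊥-elim (h refl))
        (λ _ _ → trans (joins-cross G jr X₂) (trans (cong₂ _xor_ X₂y (X₂≡ c≢y)) (sym (crossr Z))))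
        (λ _ h → ⊥-elim (h refl))
        (λ e ≢f ≢p ≢q ≢r ≢u far _ _ → trans (cross-merge-off G Z y x e (proj₂ far)) (sym (cross-id Z ≢f ≢q ≢r)))

      ε≢p = toggle X₁ p r p≢r X₁p X₁r X₁-rest
      ε≢r = toggle X₁ r p (p≢r ∘ sym) X₁r X₁p (λ e h k → X₁-rest e k h)
      ε≢q = toggle X₂ q u q≢u X₂q X₂u X₂-rest
      ε≢u = toggle X₂ u q (q≢u ∘ sym) X₂u X₂q (λ e h k → X₂-rest e k h)

      ε-far : (∀ Z → cross H Z ε ≡ cross G Z ε) × Far ε
      ε-far = five {λ e → ε ≡ e → (∀ Z → cross H Z e ≡ cross G Z e) × Far e}
        (λ { refl → ⊥-elim (true≢false at₁ (crossf Z)) })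
        (λ h → ⊥-elim (ε≢p h)) (λ h → ⊥-elim (ε≢q h)) (λ h → ⊥-elim (ε≢r h)) (λ h → ⊥-elim (ε≢u h))
        (λ e ≢f ≢p ≢q ≢r ≢u far _ → (λ Z → cross-id Z ≢f ≢q ≢r) , far) ε refl

module _ {n m : ℕ} where

  -- Each of the four corners around xy needs one of the only two edges that cross a bad cut away from xy, which is one too many ends.
  crossing-bad-cuts : ∀ (G : Net n m) {x y f p q r u a b c d} (A : Around G x y f p q r u a b c d) → NoBridge G →
                      ∀ {Z W} → Split.BadCut G A Z → Split.BadCut G (swap-ru A) W → ⊥
  crossing-bad-cuts G {x} {y} {f} {p} {q} {r} {u} {a} {b} {c} {d} A nb {Z} {W} z w =
    conclude (ε ≟ ε′)
    where
    open Around A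
    open Split.BadCut z
    open Split.BadCut w using () renaming (ε to ε′; far to far′; Za to Wa; Zb to Wb; Zc to Wd; Zd to Wc; Zxy to Wxy; at to at′; only to only′)

    -- The corners of the two cuts, with and without `x` and `y`. As `a`, `b`, `c`, `d` lie in four
    -- different corners, each `Q i j` is left by just one of `p`, `q`, `r`, `u`, apart from far
    -- edges.
    B Q : Bool → Bool → Fin n → Bool
    B i j v = (Z v == i) ∧ (W v == j)
    Q i j v = B i j v ∧ (not (δ x v) ∧ not (δ y v))

    Q-x : ∀ i j → Q i j x ≡ false
    Q-x i j rewrite δ-refl x = ∧-zeroʳ (B i j x)

    Q-y : ∀ i j → Q i j y ≡ false
    Q-y i j rewrite δ-refl y = trans (cong (B i j y ∧_) (∧-zeroʳ (not (δ x y)))) (∧-zeroʳ (B i j y))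

    Q≡B : ∀ i j {v} → v ≢ x → v ≢ y → Q i j v ≡ B i j v
    Q≡B i j {v} h k rewrite δ-≢ (h ∘ sym) | δ-≢ (k ∘ sym) = ∧-identityʳ (B i j v)

    far-cross : ∀ i j e → Far e → cross G (Q i j) e ≡ true → cross G (B i j) e ≡ true
    far-cross i j e (fx , fy) h = ⇒-elim {a = (cross G (Q i j) e)} (⇒-elim {a = (δ x (s G e) == δ x (t G e)) ∧ (δ y (s G e) == δ y (t G e))}
      (valid-sound 6 (λ { (k ∷ l ∷ k′ ∷ l′ ∷ v ∷ v′ ∷ []) →
          ((k == k′) ∧ (l == l′)) ⇒ ((v ∧ (not k ∧ not l)) xor (v′ ∧ (not k′ ∧ not l′))) ⇒ (v xor v′) }) refl
        (δ x (s G e) ∷ δ y (s G e) ∷ δ x (t G e) ∷ δ y (t G e) ∷ B i j (s G e) ∷ B i j (t G e) ∷ []))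
      (cong₂ _∧_ (cong not fx) (cong not fy))) h

    far-ZW : ∀ i j e → cross G (B i j) e ≡ true → cross G Z e ≡ true ⊎ cross G W e ≡ true
    far-ZW i j e h with cross G Z e in eq
    ... | true  = inj₁ refl
    ... | false = inj₂ (⇒-elim {a = (cross G (B i j) e) ∧ not (cross G Z e)}
      (valid-sound 6 (λ { (v ∷ w ∷ v′ ∷ w′ ∷ i ∷ j ∷ []) →
          ((((v == i) ∧ (w == j)) xor ((v′ == i) ∧ (w′ == j))) ∧ not (v xor v′)) ⇒ (w xor w′) }) refl
        (Z (s G e) ∷ W (s G e) ∷ Z (t G e) ∷ W (t G e) ∷ i ∷ j ∷ []))
      (cong₂ (λ k l → k ∧ not l) h eq))

    module Corner (i j : Bool) {g : Fin m} (g-in : cross G (Q i j) g ≡ true)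
                  (rest : ∀ e → cross G (Q i j) e ≡ true → e ≡ g ⊎ Far e) where

      -- If `ε` and `ε′` both missed the corner, `g` would be the only edge leaving `Q i j` and thus
      -- a bridge of `G`.
      covered : cross G (B i j) ε ∨ cross G (B i j) ε′ ≡ true
      covered = bool-cases id λ h → ⊥-elim (nb (Q i j) (size₁ {e = g} record { at₁ = g-in ; only = λ e k → only″ h e k (rest e k) }))
        where
        ∨-false : ∀ {k l} → k ∨ l ≡ false → k ≡ false × l ≡ false
        ∨-false {false} {false} _ = refl , refl
        only″ : cross G (B i j) ε ∨ cross G (B i j) ε′ ≡ false → ∀ e → cross G (Q i j) e ≡ true → e ≡ g ⊎ Far e → e ≡ g
        only″ h e k (inj₁ l) = l
        only″ h e k (inj₂ far-e) with far-ZW i j e (far-cross i j e far-e k)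
        ... | inj₁ l with only e far-e l
        ...   | refl = ⊥-elim (true≢false (far-cross i j e far-e k) (proj₁ (∨-false h)))
        only″ h e k (inj₂ far-e) | inj₂ l with only′ e (proj₁ far-e , proj₂ far-e) l
        ...   | refl = ⊥-elim (true≢false (far-cross i j e far-e k) (proj₂ (∨-false {cross G (B i j) ε} h)))

    i = Z x
    j = W x

    module _ (k l : Bool) where

      Qf : cross G (Q k l) f ≡ false
      Qf = trans (joins-cross G jf (Q k l)) (cong₂ _xor_ (Q-x k l) (Q-y k l))
      Qp : cross G (Q k l) p ≡ B k l a
      Qp = trans (joins-cross G jp (Q k l)) (cong₂ _xor_ (Q-x k l) (Q≡B k l a≢x a≢y))
      Qq : cross G (Q k l) q ≡ B k l b
      Qq = trans (joins-cross G jq (Q k l)) (cong₂ _xor_ (Q-x k l) (Q≡B k l b≢x b≢y))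
      Qr : cross G (Q k l) r ≡ B k l c
      Qr = trans (joins-cross G jr (Q k l)) (cong₂ _xor_ (Q-y k l) (Q≡B k l c≢x c≢y))
      Qu : cross G (Q k l) u ≡ B k l d
      Qu = trans (joins-cross G ju (Q k l)) (cong₂ _xor_ (Q-y k l) (Q≡B k l d≢x d≢y))

    Zy : Z y ≡ not i
    Zy = trans (sym (not-involutive (Z y))) (cong not (sym Zxy))
    Wy : W y ≡ not j
    Wy = trans (sym (not-involutive (W y))) (cong not (sym Wxy))

    Ba : ∀ k l → B k l a ≡ (i == k) ∧ (j == l)
    Ba k l = cong₂ (λ z w → (z == k) ∧ (w == l)) Za Wa
    Bb : ∀ k l → B k l b ≡ (not i == k) ∧ (not j == l)
    Bb k l = cong₂ (λ z w → (z == k) ∧ (w == l)) (trans Zb Zy) (trans Wb Wy)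
    Bc : ∀ k l → B k l c ≡ (i == k) ∧ (not j == l)
    Bc k l = cong₂ (λ z w → (z == k) ∧ (w == l)) Zc (trans Wc Wy)
    Bd : ∀ k l → B k l d ≡ (not i == k) ∧ (j == l)
    Bd k l = cong₂ (λ z w → (z == k) ∧ (w == l)) (trans Zd Zy) Wd

    T₂ : ∀ (g : Bool → Bool → Bool) → valid 2 (λ { (k ∷ l ∷ []) → g k l }) ≡ true → g i j ≡ true
    T₂ g h = valid-sound 2 (λ { (k ∷ l ∷ []) → g k l }) h (i ∷ j ∷ [])

    F₂ : ∀ (g : Bool → Bool → Bool) → valid 2 (λ { (k ∷ l ∷ []) → not (g k l) }) ≡ true → g i j ≡ false
    F₂ g h with g i j | valid-sound 2 (λ { (k ∷ l ∷ []) → not (g k l) }) h (i ∷ j ∷ [])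
    ... | false | _ = refl

    out : ∀ {e k l} {A : Set} {v} → cross G (Q k l) e ≡ v → v ≡ false → cross G (Q k l) e ≡ true → A
    out g h k = ⊥-elim (true≢false k (trans g h))

    corner-a = Corner.covered i j {p} (trans (Qp i j) (trans (Ba i j) (T₂ (λ i j → (i == i) ∧ (j == j)) refl)))
      (five {λ e → cross G (Q i j) e ≡ true → e ≡ p ⊎ Far e} (out (Qf i j) refl) (λ _ → inj₁ refl)
        (out (trans (Qq i j) (Bb i j)) (F₂ (λ i j → (not i == i) ∧ (not j == j)) refl))
        (out (trans (Qr i j) (Bc i j)) (F₂ (λ i j → (i == i) ∧ (not j == j)) refl))
        (out (trans (Qu i j) (Bd i j)) (F₂ (λ i j → (not i == i) ∧ (j == j)) refl))
        (λ _ _ _ _ _ _ far _ → inj₂ far))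

    corner-b = Corner.covered (not i) (not j) {q} (trans (Qq _ _) (trans (Bb _ _) (T₂ (λ i j → (not i == not i) ∧ (not j == not j)) refl)))
      (five {λ e → cross G (Q (not i) (not j)) e ≡ true → e ≡ q ⊎ Far e} (out (Qf _ _) refl)
        (out (trans (Qp _ _) (Ba _ _)) (F₂ (λ i j → (i == not i) ∧ (j == not j)) refl))
        (λ _ → inj₁ refl)
        (out (trans (Qr _ _) (Bc _ _)) (F₂ (λ i j → (i == not i) ∧ (not j == not j)) refl))
        (out (trans (Qu _ _) (Bd _ _)) (F₂ (λ i j → (not i == not i) ∧ (j == not j)) refl))
        (λ _ _ _ _ _ _ far _ → inj₂ far))

    corner-c = Corner.covered i (not j) {r} (trans (Qr _ _) (trans (Bc _ _) (T₂ (λ i j → (i == i) ∧ (not j == not j)) refl)))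
      (five {λ e → cross G (Q i (not j)) e ≡ true → e ≡ r ⊎ Far e} (out (Qf _ _) refl)
        (out (trans (Qp _ _) (Ba _ _)) (F₂ (λ i j → (i == i) ∧ (j == not j)) refl))
        (out (trans (Qq _ _) (Bb _ _)) (F₂ (λ i j → (not i == i) ∧ (not j == not j)) refl))
        (λ _ → inj₁ refl)
        (out (trans (Qu _ _) (Bd _ _)) (F₂ (λ i j → (not i == i) ∧ (j == not j)) refl))
        (λ _ _ _ _ _ _ far _ → inj₂ far))

    corner-d = Corner.covered (not i) j {u} (trans (Qu _ _) (trans (Bd _ _) (T₂ (λ i j → (not i == not i) ∧ (j == j)) refl)))
      (five {λ e → cross G (Q (not i) j) e ≡ true → e ≡ u ⊎ Far e} (out (Qf _ _) refl)
        (out (trans (Qp _ _) (Ba _ _)) (F₂ (λ i j → (i == not i) ∧ (j == j)) refl))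
        (out (trans (Qq _ _) (Bb _ _)) (F₂ (λ i j → (not i == not i) ∧ (not j == j)) refl))
        (out (trans (Qr _ _) (Bc _ _)) (F₂ (λ i j → (i == not i) ∧ (not j == j)) refl))
        (λ _ → inj₁ refl)
        (λ _ _ _ _ _ _ far _ → inj₂ far))

    T⁴ : (Bool → Bool → Bool) → Bool → Bool → Bool
    T⁴ g k l = (g k l ∧ g (not k) (not l)) ∧ (g k (not l) ∧ g (not k) l)

    inside : Bool → Bool → Bool → Bool → Bool → Bool → Bool
    inside z w z′ w′ k l = ((z == k) ∧ (w == l)) xor ((z′ == k) ∧ (w′ == l))

    all-corners : T⁴ (λ k l → cross G (B k l) ε ∨ cross G (B k l) ε′) i j ≡ true
    all-corners = cong₂ _∧_ (cong₂ _∧_ corner-a corner-b) (cong₂ _∧_ corner-c corner-d)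

    conclude : Dec (ε ≡ ε′) → ⊥
    -- A single edge has two ends and cannot meet four corners.
    conclude (yes refl) = true≢false all-corners (==-sound (valid-sound 6
      (λ { (z ∷ w ∷ z′ ∷ w′ ∷ i ∷ j ∷ []) → T⁴ (λ k l → inside z w z′ w′ k l ∨ inside z w z′ w′ k l) i j == false }) refl
      (Z (s G ε) ∷ W (s G ε) ∷ Z (t G ε) ∷ W (t G ε) ∷ i ∷ j ∷ [])))
    -- Now `ε` crosses only `Z` and `ε′` only `W`. So `ε` meets the two corners on one side of `W`,
    -- and `ε′` the two on one side of `Z`; these pairs share a corner, hence a fourth corner is
    -- missed.
    conclude (no ε≢ε′) = true≢false all-corners (==-sound (⇒-elim {a = ((cross G Z ε) ∧ not (cross G W ε)) ∧ (not (cross G Z ε′) ∧ cross G W ε′)}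
      (valid-sound 10
        (λ { (z ∷ w ∷ z′ ∷ w′ ∷ y ∷ v ∷ y′ ∷ v′ ∷ i ∷ j ∷ []) →
             (((z xor z′) ∧ not (w xor w′)) ∧ (not (y xor y′) ∧ (v xor v′))) ⇒ (T⁴ (λ k l → inside z w z′ w′ k l ∨ inside y v y′ v′ k l) i j == false) }) refl
        (Z (s G ε) ∷ W (s G ε) ∷ Z (t G ε) ∷ W (t G ε) ∷ Z (s G ε′) ∷ W (s G ε′) ∷ Z (t G ε′) ∷ W (t G ε′) ∷ i ∷ j ∷ []))
      (cong₂ _∧_ (cong₂ (λ k l → k ∧ not l) at (≢true λ h → ε≢ε′ (only′ ε far h)))
                 (cong₂ (λ k l → not k ∧ l) (≢true λ h → ε≢ε′ (sym (only ε′ far′ h))) at′))))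

-- The induction for matchings through an edge

module _ {n m : ℕ} where

  module Step (G : Net n m) (sub : Subcubic G) (nb : NoBridge G)
              (ih : ∀ (H : Net n m) → size H < size G → Subcubic H → NoBridge H → ∀ (e : Fin m) → ¬ ¬ MatchingThrough H e)
              {e₀ : Fin m} (e₀-nonloop : nonloop G e₀ ≡ true) (fail : ¬ MatchingThrough G e₀) where

    suppress : ∀ {v e f} → Two (star G v) e f → e ≢ e₀ → ⊥
    suppress {v} {e} tw e≢e₀ with star-joins G {v} {e} (Two.at₁ tw)
    ... | w , v≢w , j = ih H smaller subcubic noBridge e₀ (fail ∘ lift e≢e₀)
      where open Suppress G sub nb v≢w j tw

    -- One of the two edges at `v` differs from `e₀` and can be contracted.
    no-degree-2 : ∀ v → deg G v ≢ 2
    no-degree-2 v d with count-some (star G v) (subst (0 <_) (sym d) (s≤s z≤n))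
    ... | e , p with get₂′ {P = star G v} d p | e ≟ e₀
    ...   | f , tw | no e≢e₀ = suppress tw e≢e₀
    ...   | f , tw | yes refl = suppress (record { at₁ = at₂ ; at₂ = at₁ ; ≢₁₂ = ≢₁₂ ∘ sym ; only = λ i q → [ inj₂ , inj₁ ]′ (only i q) }) (≢₁₂ ∘ sym)
      where open Two tw

    cubic : ∀ {v e} → star G v e ≡ true → deg G v ≡ 3
    cubic {v} {e} p = [ ⊥-elim ∘ no-degree-2 v , id ]′ (Sub3-deg {G = G} {v} {e} (sub v) p)

    no-digon : ∀ {x y f q} → x ≢ y → Connects G f x y → Connects G q x y → f ≢ q → f ≢ e₀ → q ≢ e₀ → ⊥
    no-digon {x} {y} {f} {q} x≢y jf jq f≢q f≢e₀ q≢e₀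
      with fx ← joins-star G jf x≢y | fy ← joins-star G (joins-sym G jf) (x≢y ∘ sym)
      with get₃″ {P = star G x} (cubic fx) fx (joins-star G jq x≢y) f≢q | get₃″ {P = star G y} (cubic fy) fy (joins-star G (joins-sym G jq) (x≢y ∘ sym)) f≢q
    ... | k , tx | l , ty = ih H smaller subcubic noBridge e₀ (fail ∘ lift f≢e₀ q≢e₀)
      where open Digon G sub nb x≢y jf tx ty

    -- A reconnection without bridges would have a matching through `e₀`, which lifts to `G`. So
    -- both reconnections have bridges, and `crossing-bad-cuts` applies.
    split : ∀ {x y f p q r u a b c d} → Around G x y f p q r u a b c d → star G a e₀ ≡ true → p ≢ e₀ → ⊥
    split {x} {y} {f} {p} {q} {a = a} {b} A at p≢e₀ =
      ¬nb A (λ Z cZ → ¬nb (swap-ru A) (λ W cW → crossing-bad-cuts G A nb (Split.badCut G A nb Z cZ) (Split.badCut G (swap-ru A) nb W cW)))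
      where
      ¬nb : ∀ {r u c d} → (A : Around G x y f p q r u a b c d) → ¬ NoBridge (Split.H G A)
      ¬nb A h = ih _ (Split.smaller G A) (Split.subcubic G A sub) h e₀ (fail ∘ Split.lift G A (cubic at) at p≢e₀)

    third-side : ∀ {a x y f p q b} → a ≢ x → x ≢ y → a ≢ y → x ≢ b → b ≢ y → Connects G p a x → Connects G q x b → Three (star G x) f p q →
                 ∀ e → star G x e ≡ true → star G y e ≡ true → e ≢ f → ⊥
    third-side a≢x x≢y a≢y x≢b b≢y jp jq tx e h k e≢f = pick (Three.only tx e h)
      where
      pick : _ → ⊥
      pick (inj₁ refl)        = e≢f refl
      pick (inj₂ (inj₁ refl)) = true≢false k (joins-off G jp (a≢y ∘ sym) (x≢y ∘ sym))
      pick (inj₂ (inj₂ refl)) = true≢false k (joins-off G jq (x≢y ∘ sym) (b≢y ∘ sym))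

    around₂ : ∀ {a x y f p q b} → star G a e₀ ≡ true → p ≢ e₀ → a ≢ x → x ≢ y → a ≢ y → x ≢ b → b ≢ y →
              Connects G p a x → Connects G f x y → Connects G q x b → Three (star G x) f p q → ⊥
    around₂ {a} {x} {y} {f} {p} {q} {b} at p≢e₀ a≢x x≢y a≢y x≢b b≢y jp jf jq tx =
      go (get₃′ {P = star G y} (cubic fy) fy)
      where
      fy : star G y f ≡ true
      fy = joins-star G (joins-sym G jf) (x≢y ∘ sym)
      at-x : ∀ e → star G x e ≡ true → star G y e ≡ true → e ≢ f → ⊥
      at-x = third-side a≢x x≢y a≢y x≢b b≢y jp jq tx
      go₂ : ∀ {r u c d} → Three (star G y) f r u → y ≢ c → y ≢ d → Connects G r y c → Connects G u y d → ⊥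
      go₂ {r} {u} {c} {d} ty y≢c y≢d jr ju = split A at p≢e₀
        where
        c≢x : c ≢ x
        c≢x refl = at-x r (joins-star G (joins-sym G jr) x≢y) (Three.at₂ ty) (Three.≢₁₂ ty ∘ sym)
        d≢x : d ≢ x
        d≢x refl = at-x u (joins-star G (joins-sym G ju) x≢y) (Three.at₃ ty) (Three.≢₁₃ ty ∘ sym)
        A : Around G x y f p q r u a b c d
        A = record
          { x≢y = x≢y ; tx = tx ; ty = ty ; jf = jf ; jp = joins-sym G jp ; jq = jq ; jr = jr ; ju = ju
          ; a≢x = a≢x ; a≢y = a≢y ; b≢x = x≢b ∘ sym ; b≢y = b≢y ; c≢x = c≢x ; c≢y = y≢c ∘ sym ; d≢x = d≢x ; d≢y = y≢d ∘ sym }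
      go : ∃₂ (Three (star G y) f) → ⊥
      go (r , u , ty) =
        let (c , y≢c , jr) = star-joins G {y} {r} (Three.at₂ ty)
            (d , y≢d , ju) = star-joins G {y} {u} (Three.at₃ ty)
        in go₂ ty y≢c y≢d jr ju

    around : ∀ {a x f p q} → star G a e₀ ≡ true → p ≢ e₀ → a ≢ x → Connects G p a x → Three (star G x) f p q → f ≢ e₀ → ⊥
    around {a} {x} {f} {p} {q} at p≢e₀ a≢x jp tx f≢e₀ =
      let (y , x≢y , jf) = star-joins G {x} {f} (Three.at₁ tx)
          (b , x≢b , jq) = star-joins G {x} {q} (Three.at₃ tx)
      in go x≢y jf x≢b jq
      where
      module X = Three tx
      go : ∀ {y b} → x ≢ y → Connects G f x y → x ≢ b → Connects G q x b → ⊥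
      go {y} {b} x≢y jf x≢b jq = around₂ at p≢e₀ a≢x x≢y a≢y x≢b b≢y jp jf jq tx
        where
        a≢y : a ≢ y
        a≢y refl = no-digon x≢y jf (joins-sym G jp) X.≢₁₂ f≢e₀ p≢e₀
        b≢y : b ≢ y
        b≢y refl = absurd (q ≟ e₀) (a ≟ b)
          where
          -- If `e₀` were `q`, its end `a` would have to be `b`, that is, `y`.
          absurd : Dec (q ≡ e₀) → Dec (a ≡ b) → ⊥
          absurd (no q≢e₀) _ = no-digon x≢y jf jq X.≢₁₃ f≢e₀ q≢e₀
          absurd (yes refl) (yes a≡b) = a≢y a≡b
          absurd (yes refl) (no  a≢b) = true≢false at (joins-off G jq a≢x a≢b)

    -- From an end `a` of `e₀` follow a second edge `p` to `x`. At most one of the two further edges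
    -- at `x` is `e₀`; the other one serves as the edge `f` to be removed.
    absurd : ⊥
    absurd = go₁ (get₃′ {P = star G a} (cubic at) at)
      where
      a : Fin n
      a = s G e₀
      at : star G a e₀ ≡ true
      at = nonloop-star G {e₀} e₀-nonloop
      go₃ : ∀ {p x} → e₀ ≢ p → a ≢ x → Connects G p a x → ∃₂ (Three (star G x) p) → ⊥
      go₃ {p} {x} e₀≢p a≢x jp (k , l , tx) = decide (k ≟ e₀)
        where
        open Three tx
        tx₁ : Three (star G x) k p l
        tx₁ = record { at₁ = at₂ ; at₂ = at₁ ; at₃ = at₃ ; ≢₁₂ = ≢₁₂ ∘ sym ; ≢₁₃ = ≢₂₃ ; ≢₂₃ = ≢₁₃
                     ; only = λ i h → [ inj₂ ∘ inj₁ , [ inj₁ , inj₂ ∘ inj₂ ]′ ]′ (only i h) }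
        tx₂ : Three (star G x) l p k
        tx₂ = record { at₁ = at₃ ; at₂ = at₁ ; at₃ = at₂ ; ≢₁₂ = ≢₁₃ ∘ sym ; ≢₁₃ = ≢₂₃ ∘ sym ; ≢₂₃ = ≢₁₂
                     ; only = λ i h → [ inj₂ ∘ inj₁ , [ inj₂ ∘ inj₂ , inj₁ ]′ ]′ (only i h) }
        decide : Dec (k ≡ e₀) → ⊥
        decide (no  k≢e₀) = around at (e₀≢p ∘ sym) a≢x jp tx₁ k≢e₀
        decide (yes k≡e₀) = around at (e₀≢p ∘ sym) a≢x jp tx₂ λ l≡e₀ → ≢₂₃ (trans k≡e₀ (sym l≡e₀))
      go₂ : ∀ {p} → e₀ ≢ p → (∃ λ x → a ≢ x × Connects G p a x) → ⊥
      go₂ {p} e₀≢p (x , a≢x , jp) = go₃ e₀≢p a≢x jp (get₃′ {P = star G x} (cubic px) px)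
        where
        px : star G x p ≡ true
        px = joins-star G (joins-sym G jp) (a≢x ∘ sym)
      go₁ : ∃₂ (Three (star G a) e₀) → ⊥
      go₁ (p , _ , ta) = go₂ (Three.≢₁₂ ta) (star-joins G {a} {p} (Three.at₂ ta))

  matching-through : ∀ k (G : Net n m) → size G < k → Subcubic G → NoBridge G → ∀ e → ¬ ¬ MatchingThrough G e
  matching-through (suc k) G (s≤s G≤k) sub nb e fail = bool-cases {nonloop G e} (λ h → inner e h fail)
    -- A loop lies in no star, so it can be added to a matching found through any nonloop edge; if
    -- there is none, all vertices are isolated.
    λ loop → by-cases {∃ λ e′ → nonloop G e′ ≡ true}
      (λ { (e′ , h) → inner e′ h λ { (M , _ , perfect) → fail (upd M e true , upd-at M e true , λ v →
             matched-off {G = G} {G} {upd M e true} {M} {v} (λ _ → refl) (λ i p → upd-off M true λ { refl → true≢false p (loop-star G {e} loop (δ v)) }) (perfect v)) } })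
      (λ all → fail (const true , refl , λ v → isolated {G = G} {v} (const true) λ i → ≢true λ p → all (i , cross-nonloop G {i} (δ v) p)))
    where
    inner : ∀ e → nonloop G e ≡ true → ¬ ¬ MatchingThrough G e
    inner e h fail = Step.absurd G sub nb (λ H H<G → matching-through k H (≤-trans H<G G≤k)) h fail

-- Three-edge-cuts

par : ℕ → Bool
par zero    = false
par (suc k) = not (par k)

par-+ : ∀ k l → par (k + l) ≡ par k xor par l
par-+ zero    l = refl
par-+ (suc k) l = trans (cong not (par-+ k l)) (by-valid 2 (λ { (a ∷ b ∷ []) → not (a xor b) }) (λ { (a ∷ b ∷ []) → not a xor b }) refl (par k ∷ par l ∷ []))

par-count : ∀ {k} (P : Fin k → Bool) → par (count P) ≡ 𝔽Σ.sum P
par-count {zero}  P = refl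
par-count {suc k} P = trans (par-+ (bit (P zero)) (count (P ∘ suc))) (cong₂ _xor_ (par-bit (P zero)) (par-count (P ∘ suc)))
  where
  par-bit : ∀ b → par (bit b) ≡ b
  par-bit true  = refl
  par-bit false = refl

odd≢1⇒≥3 : ∀ k → par k ≡ true → k ≢ 1 → 3 ≤ k
odd≢1⇒≥3 1 _ h = ⊥-elim (h refl)
odd≢1⇒≥3 (suc (suc (suc k))) _ _ = s≤s (s≤s (s≤s z≤n))

≥3+≥3≤6 : ∀ {k l} → 3 ≤ k → 3 ≤ l → k + l ≤ 6 → k ≡ 3 × l ≡ 3
≥3+≥3≤6 {k} {l} p q r =
  ≤-antisym (+-cancelʳ-≤ 3 k 3 (≤-trans (+-monoʳ-≤ k q) r)) p ,
  ≤-antisym (+-cancelˡ-≤ 3 l 3 (≤-trans (+-monoˡ-≤ l p) r)) q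

-- Conjunction and disjunction determine the sum of two bits, so the inequality becomes a formula
-- that can be checked by evaluation.
bits-≤ : ∀ a b c d → ((((a ∧ b) ⇒ (c ∧ d)) ∧ ((a ∨ b) ⇒ (c ∨ d))) ≡ true) → bit a + bit b ≤ bit c + bit d
bits-≤ true  true  true  true  _ = ≤-refl
bits-≤ true  false true  true  _ = s≤s z≤n
bits-≤ true  false true  false _ = ≤-refl
bits-≤ true  false false true  _ = ≤-refl
bits-≤ false true  true  true  _ = s≤s z≤n
bits-≤ false true  true  false _ = ≤-refl
bits-≤ false true  false true  _ = ≤-refl
bits-≤ false false _     _     _ = z≤n

module _ {n m : ℕ} where

  _∩_ : (Fin n → Bool) → (Fin n → Bool) → Fin n → Bool
  (X ∩ Y) v = X v ∧ Y v

  cutOn-mono : ∀ {G : Net n m} {N X Y} → (∀ e → cross G X e ≡ true → cross G Y e ≡ true) → cutOn N G X ≤ cutOn N G Y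
  cutOn-mono {G} {N} {X} h = count-mono λ e p → let (q , r) = ∧-true {N e} p in cong₂ _∧_ q (h e r)

  cutOn-not : ∀ (G : Net n m) N X → cutOn N G (not ∘ X) ≡ cutOn N G X
  cutOn-not G N X = count-cong λ e → cong (N e ∧_) (cross-not G X e)

  cut-not : ∀ (G : Net n m) X → cut G (not ∘ X) ≡ cut G X
  cut-not G X = count-cong (cross-not G X)

  -- Holds edge by edge. The intersection of the complements stands in for the union, whose cut is
  -- the same.
  submodular : ∀ (G : Net n m) N X Y → cutOn N G (X ∩ Y) + cutOn N G ((not ∘ X) ∩ (not ∘ Y)) ≤ cutOn N G X + cutOn N G Y
  submodular G N X Y = subst₂ _≤_ (ℕΣ.∑-distrib-+ (bit ∘ on (X ∩ Y)) (bit ∘ on ((not ∘ X) ∩ (not ∘ Y)))) (ℕΣ.∑-distrib-+ (bit ∘ on X) (bit ∘ on Y))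
    (sum-mono λ e → bits-≤ (on (X ∩ Y) e) (on ((not ∘ X) ∩ (not ∘ Y)) e) (on X e) (on Y e) (valid-sound 5
      (λ { (k ∷ x ∷ y ∷ x′ ∷ y′ ∷ []) →
        let a = k ∧ ((x ∧ y) xor (x′ ∧ y′)); b = k ∧ ((not x ∧ not y) xor (not x′ ∧ not y′)); c = k ∧ (x xor x′); d = k ∧ (y xor y′)
        in ((a ∧ b) ⇒ (c ∧ d)) ∧ ((a ∨ b) ⇒ (c ∨ d)) }) refl
      (N e ∷ X (s G e) ∷ Y (s G e) ∷ X (t G e) ∷ Y (t G e) ∷ [])))
    where
    on : (Fin n → Bool) → Fin m → Bool
    on Z e = N e ∧ cross G Z e

  par-cut : ∀ (G : Net n m) X Y Z → (∀ e → cross G X e ≡ cross G Y e xor cross G Z e) → par (cut G X) ≡ par (cut G Y) xor par (cut G Z)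
  par-cut G X Y Z h = begin
    par (cut G X)                                ≡⟨ par-count (cross G X) ⟩
    𝔽Σ.sum (cross G X)                           ≡⟨ 𝔽Σ.sum-cong-≗ h ⟩
    𝔽Σ.sum (λ e → cross G Y e xor cross G Z e)   ≡⟨ 𝔽Σ.∑-distrib-+ (cross G Y) (cross G Z) ⟩
    𝔽Σ.sum (cross G Y) xor 𝔽Σ.sum (cross G Z)    ≡⟨ cong₂ _xor_ (par-count (cross G Y)) (par-count (cross G Z)) ⟨
    par (cut G Y) xor par (cut G Z)              ∎
    where open ≡-Reasoning

  Cubic₀ : Net n m → Set
  Cubic₀ G = ∀ v → deg G v ≡ 0 ⊎ deg G v ≡ 3

  -- At most one of the three cut edges lies in `M`; the bound 2 on the others is the form that adds
  -- up when cuts are uncrossed.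
  ThreeCuts : Net n m → (Fin m → Bool) → Set
  ThreeCuts G M = ∀ X → cut G X ≡ 3 → 2 ≤ cutOn (not ∘ M) G X

  GoodMatching : Net n m → Fin m → Set
  GoodMatching G e = ∃ λ M → M e ≡ true × Perfect G M × ThreeCuts G M

  cubic₀-deg : ∀ {G : Net n m} → Cubic₀ G → ∀ {v e} → star G v e ≡ true → deg G v ≡ 3
  cubic₀-deg {G} cubic {v} {e} p = [ (λ z → ⊥-elim (true≢false p (count-zero (star G v) z e))) , id ]′ (cubic v)

  matched-3-count : ∀ {G : Net n m} {M v} → deg G v ≡ 3 → Matched (deg G v) (degOn M G v) → degOn M G v ≡ 1
  matched-3-count {G} {M} {v} d ok with deg G v | degOn M G v
  matched-3-count refl m31 | _ | _ = refl

  -- Contracting one side of a 3-edge-cut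

  collapse : (Fin n → Bool) → Fin n → Fin n → Fin n
  collapse X w v = if X v then v else w

  touches : Net n m → (Fin n → Bool) → Fin m → Bool
  touches G X e = X (s G e) ∨ X (t G e)

  cross-touches : ∀ (G : Net n m) X Z → (∀ v → Z v ≡ true → X v ≡ true) → ∀ e → cross G Z e ≡ true → touches G X e ≡ true
  cross-touches G X Z h e p with Z (s G e) in p₁ | Z (t G e) in p₂
  ... | true  | _ rewrite h _ p₁ = refl
  ... | false | true rewrite h _ p₂ = ∨-true (X (s G e))
    where
    ∨-true : ∀ a → a ∨ true ≡ true
    ∨-true true  = refl
    ∨-true false = refl

  module Side (G : Net n m) (cubic : Cubic₀ G) (nb : NoBridge G) (X : Fin n → Bool) (X3 : cut G X ≡ 3) (w : Fin n) (w∉X : X w ≡ false) where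

    H : Net n m
    H = contract (collapse X w) G

    inside : ∀ {Z : Fin n → Bool} → (∀ v → Z v ≡ true → X v ≡ true) → ∀ v → Z (collapse X w v) ≡ Z v
    inside {Z} Z⊆X v with X v in Xv
    ... | true  = refl
    ... | false = trans (≢true λ p → true≢false (Z⊆X w p) w∉X) (sym (≢true λ p → true≢false (Z⊆X v p) Xv))

    δ⊆ : ∀ {z} → X z ≡ true → ∀ v → δ z v ≡ true → X v ≡ true
    δ⊆ p v q = subst (λ v → X v ≡ true) (δ-true q) p

    star-in : ∀ {z} → X z ≡ true → star H z ≗ star G z
    star-in {z} p = cross-cong G (inside {δ z} (δ⊆ p))

    -- The vertex `w` stands for the whole side outside `X`, so the edges at it are those of the
    -- cut; in particular it has degree 3.
    star-w : star H w ≗ cross G X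
    star-w e = trans (cross-cong G {δ w ∘ collapse X w} {not ∘ X} eq e) (cross-not G X e)
      where
      eq : ∀ v → δ w (collapse X w v) ≡ not (X v)
      eq v with X v in Xv
      ... | true  = δ-≢ λ { refl → true≢false Xv w∉X }
      ... | false = δ-refl w

    star-out : ∀ {z} → X z ≡ false → w ≢ z → ∀ e → star H z e ≡ false
    star-out {z} z∉X w≢z e = cross-cong G {δ z ∘ collapse X w} {const false} eq e
      where
      eq : ∀ v → δ z (collapse X w v) ≡ false
      eq v with X v in Xv
      ... | true  = δ-≢ λ { refl → true≢false Xv z∉X }
      ... | false = δ-≢ (w≢z ∘ sym)

    cubicH : Cubic₀ H
    cubicH z with X z in Xz | w ≟ z
    ... | true  | _        = subst (λ d → d ≡ 0 ⊎ d ≡ 3) (sym (count-cong (star-in Xz))) (cubic z)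
    ... | false | yes refl = inj₂ (trans (count-cong star-w) X3)
    ... | false | no  w≢z  = inj₁ (count-false (star-out Xz w≢z))

    noBridge : NoBridge H
    noBridge = contract-NoBridge G (collapse X w) nb

    smaller : ∀ {e} → nonloop G e ≡ true → X (s G e) ≡ false → X (t G e) ≡ false → size H < size G
    smaller {e} p a b = contract-size G (collapse X w) e p (trans (eq a) (sym (eq b)))
      where
      eq : ∀ {v} → X v ≡ false → collapse X w v ≡ w
      eq h rewrite h = refl

    module Restrict {M M′ : Fin m → Bool} (perfect : Perfect H M′) (agree : ∀ e → touches G X e ≡ true → M e ≡ M′ e) where

      matched : ∀ z → X z ≡ true → Matched (deg G z) (degOn M G z)
      matched z p = matched-off {G = G} {H} {M} {M′} {z} (sym ∘ star-in p) (λ e q → agree e (cross-touches G X (δ z) (δ⊆ p) e q)) (perfect z)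

      one : cutOn M G X ≡ 1
      one = trans (count-cong eq) (matched-3-count {G = H} {M′} {w} (trans (count-cong star-w) X3) (perfect w))
        where
        eq : ∀ e → M e ∧ cross G X e ≡ M′ e ∧ star H w e
        eq e with cross G X e in q
        ... | true  = cong₂ _∧_ (agree e (cross-touches G X X (λ _ → id) e q)) (sym (trans (star-w e) q))
        ... | false = trans (∧-zeroʳ (M e)) (sym (trans (cong (M′ e ∧_) (trans (star-w e) q)) (∧-zeroʳ (M′ e))))

      -- A set inside `X` is untouched by the collapse and has the same cut in `H`.
      three : ThreeCuts H M′ → ∀ Z → (∀ v → Z v ≡ true → X v ≡ true) → cut G Z ≡ 3 → 2 ≤ cutOn (not ∘ M) G Z
      three h Z Z⊆X Z3 = subst (2 ≤_) (count-cong eq) (h Z (trans (count-cong same) Z3))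
        where
        same : cross H Z ≗ cross G Z
        same = cross-cong G (inside {Z} Z⊆X)
        eq : ∀ e → not (M′ e) ∧ cross H Z e ≡ not (M e) ∧ cross G Z e
        eq e with cross G Z e in q
        ... | true  = cong₂ _∧_ (cong not (sym (agree e (cross-touches G X Z Z⊆X e q)))) (trans (same e) q)
        ... | false = trans (cong (not (M′ e) ∧_) (trans (same e) q)) (trans (∧-zeroʳ (not (M′ e))) (sym (∧-zeroʳ (not (M e)))))

  cutOn-complement : ∀ (G : Net n m) M X {k l} → cut G X ≡ k + l → cutOn M G X ≡ k → cutOn (not ∘ M) G X ≡ l
  cutOn-complement G M X {k} {l} p q = +-cancelˡ-≡ k _ _ (trans (cong (_+ cutOn (not ∘ M) G X) (sym q)) (trans (sym (count-split M (cross G X))) p))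

  -- The cut of `X` is odd, so after possibly complementing `Y` the cut of `X ∩ Y` is odd, and then
  -- so is that of the opposite corner. Both have at least 3 edges and by submodularity at most 6
  -- together, hence 3 each. One corner lies inside `X` and one outside, so together they have at
  -- least 4 edges of `N`, while `X` has only 2; submodularity on `N` leaves 2 for `Y`.
  uncross : ∀ (G : Net n m) → NoBridge G → ∀ N X Y → cut G X ≡ 3 → cut G Y ≡ 3 → cutOn N G X ≡ 2 →
            (∀ Z → (∀ v → Z v ≡ true → X v ≡ true) → cut G Z ≡ 3 → 2 ≤ cutOn N G Z) →
            (∀ Z → (∀ v → Z v ≡ true → not (X v) ≡ true) → cut G Z ≡ 3 → 2 ≤ cutOn N G Z) →
            2 ≤ cutOn N G Y
  uncross G nb N X Y X3 Y3 NX in₁ in₂ = bool-cases {par (cut G (X ∩ Y))} (odd Y Y3)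
    λ even → subst (2 ≤_) (cutOn-not G N Y) (odd (not ∘ Y) (trans (cut-not G Y) Y3) (flip even))
    where
    split-at : ∀ e → cross G X e ≡ cross G (X ∩ Y) e xor cross G (X ∩ (not ∘ Y)) e
    split-at e = by-valid 4 (λ { (x ∷ y ∷ x′ ∷ y′ ∷ []) → x xor x′ }) (λ { (x ∷ y ∷ x′ ∷ y′ ∷ []) → ((x ∧ y) xor (x′ ∧ y′)) xor ((x ∧ not y) xor (x′ ∧ not y′)) }) refl
      (X (s G e) ∷ Y (s G e) ∷ X (t G e) ∷ Y (t G e) ∷ [])
    corners : ∀ Y e → cross G ((not ∘ X) ∩ (not ∘ Y)) e ≡ cross G (X ∩ Y) e xor (cross G X e xor cross G Y e)
    corners Y e = by-valid 4 (λ { (x ∷ y ∷ x′ ∷ y′ ∷ []) → (not x ∧ not y) xor (not x′ ∧ not y′) })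
      (λ { (x ∷ y ∷ x′ ∷ y′ ∷ []) → ((x ∧ y) xor (x′ ∧ y′)) xor ((x xor x′) xor (y xor y′)) }) refl
      (X (s G e) ∷ Y (s G e) ∷ X (t G e) ∷ Y (t G e) ∷ [])
    flip : par (cut G (X ∩ Y)) ≡ false → par (cut G (X ∩ (not ∘ Y))) ≡ true
    flip h = trans (sym (cong (_xor par (cut G (X ∩ (not ∘ Y)))) h)) (trans (sym (par-cut G X (X ∩ Y) (X ∩ (not ∘ Y)) split-at)) (cong par X3))
    odd : ∀ Y → cut G Y ≡ 3 → par (cut G (X ∩ Y)) ≡ true → 2 ≤ cutOn N G Y
    odd Y Y3 h = +-cancelˡ-≤ 2 2 _ (begin
      4                                    ≤⟨ +-mono-≤ (in₁ A A⊆ (proj₁ both)) (in₂ B B⊆ (proj₂ both)) ⟩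
      cutOn N G A + cutOn N G B            ≤⟨ submodular G N X Y ⟩
      cutOn N G X + cutOn N G Y            ≡⟨ cong (_+ cutOn N G Y) NX ⟩
      2 + cutOn N G Y                      ∎)
      where
      open ≤-Reasoning
      A B : Fin n → Bool
      A = X ∩ Y
      B = (not ∘ X) ∩ (not ∘ Y)
      A⊆ : ∀ v → A v ≡ true → X v ≡ true
      A⊆ v p = proj₁ (∧-true p)
      B⊆ : ∀ v → B v ≡ true → not (X v) ≡ true
      B⊆ v p = proj₁ (∧-true p)
      parB : par (cut G B) ≡ true
      parB = trans (par-cut G B A (λ v → X v xor Y v) (λ e → trans (corners Y e) (cong (cross G A e xor_) (sym (cross-xor G X Y e)))))
        (cong₂ _xor_ h (trans (par-cut G (λ v → X v xor Y v) X Y (cross-xor G X Y)) (cong₂ (λ k l → par k xor par l) X3 Y3)))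
      both : cut G A ≡ 3 × cut G B ≡ 3
      both = ≥3+≥3≤6 (odd≢1⇒≥3 _ h (nb A)) (odd≢1⇒≥3 _ parB (nb B))
        (subst (cut G A + cut G B ≤_) (cong₂ _+_ X3 Y3) (submodular G (const true) X Y))

  -- The second matching is taken through the edge in which the first one meets the cut.
  glue : ∀ (G : Net n m) → Cubic₀ G → NoBridge G → ∀ X → cut G X ≡ 3 → ∀ w₁ w₂ (w₁∉X : X w₁ ≡ false) (w₂∈X : not (X w₂) ≡ false) →
         (∀ e → ¬ ¬ GoodMatching (contract (collapse X w₁) G) e) → (∀ e → ¬ ¬ GoodMatching (contract (collapse (not ∘ X) w₂) G) e) →
         ∀ e₀ → touches G X e₀ ≡ true → ¬ ¬ GoodMatching G e₀
  glue G cubic nb X X3 w₁ w₂ w₁∉X w₂∈X ih₁ ih₂ e₀ e₀∈X fail =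
    ih₁ e₀ λ { (M₁ , through , perfect₁ , three₁) →
    let (g , one₁) = get₁ {P = λ e → M₁ e ∧ cross G X e} (L.Restrict.one {M₁} {M₁} perfect₁ (λ _ _ → refl))
    in ih₂ g λ { (M₂ , g∈M₂ , perfect₂ , three₂) →
    let (g′ , one₂) = get₁ {P = λ e → M₂ e ∧ cross G X e} (trans (sym (cutOn-not G M₂ X)) (R.Restrict.one {M₂} {M₂} perfect₂ (λ _ _ → refl)))
    in fail (combine M₁ M₂ through perfect₁ three₁ perfect₂ three₂ one₁ one₂ g∈M₂) } }
    where
    module L = Side G cubic nb X X3 w₁ w₁∉X
    module R = Side G cubic nb (not ∘ X) (trans (cut-not G X) X3) w₂ w₂∈X
    combine : ∀ M₁ M₂ → M₁ e₀ ≡ true → Perfect L.H M₁ → ThreeCuts L.H M₁ → Perfect R.H M₂ → ThreeCuts R.H M₂ →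
              ∀ {g g′} → One (λ e → M₁ e ∧ cross G X e) g → One (λ e → M₂ e ∧ cross G X e) g′ → M₂ g ≡ true → GoodMatching G e₀
    combine M₁ M₂ through perfect₁ three₁ perfect₂ three₂ {g} {g′} one₁ one₂ g∈M₂ =
      M , trans (agree₁ e₀ e₀∈X) through , perfect , λ Y Y3 →
        uncross G nb (not ∘ M) X Y X3 Y3 (cutOn-complement G M X {1} {2} X3 P₁.one) (P₁.three three₁) (P₂.three three₂)
      where
      M : Fin m → Bool
      M e = if touches G X e then M₁ e else M₂ e
      agree₁ : ∀ e → touches G X e ≡ true → M e ≡ M₁ e
      agree₁ e p rewrite p = refl
      g≡g′ : g ≡ g′
      g≡g′ = One.only one₂ g (cong₂ _∧_ g∈M₂ (proj₂ (∧-true {M₁ g} (One.at₁ one₁))))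
      -- Each matching meets the cut in a single edge, and `M₂` was taken through that of `M₁`.
      on-cut : ∀ e → cross G X e ≡ true → M₁ e ≡ M₂ e
      on-cut e p with M₁ e in p₁ | M₂ e in p₂
      ... | true  | true  = refl
      ... | false | false = refl
      ... | true  | false = ⊥-elim (true≢false (subst (λ i → M₂ i ≡ true) (sym (One.only one₁ e (cong₂ _∧_ p₁ p))) g∈M₂) p₂)
      ... | false | true  = ⊥-elim (true≢false (subst (λ i → M₁ i ≡ true) (trans g≡g′ (sym (One.only one₂ e (cong₂ _∧_ p₂ p)))) (proj₁ (∧-true {M₁ g} (One.at₁ one₁)))) p₁)
      agree₂ : ∀ e → touches G (not ∘ X) e ≡ true → M e ≡ M₂ e
      agree₂ e p with X (s G e) in p₁ | X (t G e) in p₂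
      ... | false | false = refl
      ... | true  | false = on-cut e (cong₂ _xor_ p₁ p₂)
      ... | false | true  = on-cut e (cong₂ _xor_ p₁ p₂)
      module P₁ = L.Restrict {M} {M₁} perfect₁ agree₁
      module P₂ = R.Restrict {M} {M₂} perfect₂ agree₂
      perfect : Perfect G M
      perfect z = bool-cases {X z} (P₁.matched z) (λ h → P₂.matched z (cong not h))

  -- A cut is nontrivial when both of its sides have such an edge; collapsing either side then makes
  -- the graph smaller.
  Inner : Net n m → (Fin n → Bool) → Set
  Inner G X = ∃ λ e → nonloop G e ≡ true × X (s G e) ≡ true × X (t G e) ≡ true

  -- An end in `X` of a cut edge sends all its edges across the cut, for lack of inner edges. So the
  -- cut contains a star, and two edges of a star are outside `M`.
  trivial-cut : ∀ (G : Net n m) → Cubic₀ G → ∀ M → Perfect G M → ∀ X → cut G X ≡ 3 → ¬ Inner G X → 2 ≤ cutOn (not ∘ M) G X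
  trivial-cut G cubic M perfect X X3 no-inner = go (count-some (cross G X) (subst (0 <_) (sym X3) (s≤s z≤n)))
    where
    from : ∀ {v e} → X v ≡ true → star G v e ≡ true → 2 ≤ cutOn (not ∘ M) G X
    from {v} {e} v∈X p = subst (_≤ cutOn (not ∘ M) G X)
      (cutOn-complement G M (δ v) {1} {2} d (matched-3-count {G = G} {M} {v} d (perfect v)))
      (cutOn-mono {G} {not ∘ M} {δ v} {X} crosses)
      where
      d : deg G v ≡ 3
      d = cubic₀-deg {G} cubic {v} {e} p
      crosses : ∀ e → star G v e ≡ true → cross G X e ≡ true
      crosses e q with star-joins G {v} {e} q
      ... | w , v≢w , j = trans (joins-cross G j X) (cong₂ _xor_ v∈X (≢true λ w∈X → no-inner (e , joins-nonloop G j v≢w , both-in j w∈X)))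
        where
        both-in : ∀ {w} → Connects G e v w → X w ≡ true → X (s G e) ≡ true × X (t G e) ≡ true
        both-in (inj₁ (refl , refl)) w∈X = v∈X , w∈X
        both-in (inj₂ (refl , refl)) w∈X = w∈X , v∈X
    go : (∃ λ e → cross G X e ≡ true) → 2 ≤ cutOn (not ∘ M) G X
    go (e , p) with X (s G e) in ps
    ... | true  = from {s G e} {e} ps (nonloop-star G {e} (cross-nonloop G {e} X (trans (cong (_xor X (t G e)) ps) p)))
    ... | false = from {t G e} {e} p (joins-star G {e} {t G e} {s G e} (inj₂ (refl , refl)) λ q → true≢false p (trans (cong X q) ps))

  Cubic₀⇒Subcubic : ∀ {G : Net n m} → Cubic₀ G → Subcubic G
  Cubic₀⇒Subcubic cubic v with cubic v
  ... | inj₁ p = subst Sub3 (sym p) d0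
  ... | inj₂ p = subst Sub3 (sym p) d3

  good-matching : ∀ k (G : Net n m) → size G < k → Cubic₀ G → NoBridge G → ∀ e → ¬ ¬ GoodMatching G e
  good-matching (suc k) G (s≤s G≤k) cubic nb e₀ fail = by-cases {∃ λ X → cut G X ≡ 3 × Inner G X × Inner G (not ∘ X)} reduce base
    where
    not-true : ∀ {b} → not b ≡ true → b ≡ false
    not-true {false} _ = refl
    reduce : (∃ λ X → cut G X ≡ 3 × Inner G X × Inner G (not ∘ X)) → ⊥
    reduce (X , X3 , (e₁ , nl₁ , s₁ , t₁) , (e₂ , nl₂ , s₂ , t₂)) = bool-cases {touches G X e₀}
      (λ h → glue G cubic nb X X3 (t G e₂) (t G e₁) (not-true t₂) (cong not t₁) L R e₀ h fail)
      -- Now `e₀` lies on the other side and the roles are exchanged. The double complement is not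
      -- definitionally `X`, hence the second version `L′` of `L`.
      (λ h → glue G cubic nb (not ∘ X) (trans (cut-not G X) X3) (t G e₁) (t G e₂) (cong not t₁) (cong not t₂) R L′ e₀ (other h) fail)
      where
      module SL = Side G cubic nb X X3 (t G e₂) (not-true t₂)
      module SR = Side G cubic nb (not ∘ X) (trans (cut-not G X) X3) (t G e₁) (cong not t₁)
      module SL′ = Side G cubic nb (not ∘ not ∘ X) (trans (cut-not G (not ∘ X)) (trans (cut-not G X) X3)) (t G e₂) (cong not t₂)
      L : ∀ e → ¬ ¬ GoodMatching SL.H e
      L = good-matching k SL.H (≤-trans (SL.smaller {e₂} nl₂ (not-true s₂) (not-true t₂)) G≤k) SL.cubicH SL.noBridge
      L′ : ∀ e → ¬ ¬ GoodMatching SL′.H e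
      L′ = good-matching k SL′.H (≤-trans (SL′.smaller {e₂} nl₂ (cong not s₂) (cong not t₂)) G≤k) SL′.cubicH SL′.noBridge
      R : ∀ e → ¬ ¬ GoodMatching SR.H e
      R = good-matching k SR.H (≤-trans (SR.smaller {e₁} nl₁ (cong not s₁) (cong not t₁)) G≤k) SR.cubicH SR.noBridge
      other : touches G X e₀ ≡ false → touches G (not ∘ X) e₀ ≡ true
      other h with X (s G e₀)
      ... | false = refl
    base : ¬ (∃ λ X → cut G X ≡ 3 × Inner G X × Inner G (not ∘ X)) → ⊥
    base none = matching-through (suc k) G (s≤s G≤k) (Cubic₀⇒Subcubic {G} cubic) nb e₀ λ { (M , through , perfect) →
      -- If the bound failed, `trivial-cut` would yield an inner edge on each side, and the cut
      -- would be nontrivial.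
      fail (M , through , perfect , λ X X3 → decidable-stable (2 ≤? cutOn (not ∘ M) G X) λ bad →
        bad (trivial-cut G cubic M perfect X X3 λ inner₁ →
          bad (subst (2 ≤_) (cutOn-not G (not ∘ M) X) (trivial-cut G cubic M perfect (not ∘ X) (trans (cut-not G X) X3) λ inner₂ →
            none (X , X3 , inner₁ , inner₂))))) }

-- Flows over Z₂²

⨁ : ∀ {k} → (Fin k → Bool) → Bool
⨁ = 𝔽Σ.sum

⨁-cong : ∀ {k} {f g : Fin k → Bool} → f ≗ g → ⨁ f ≡ ⨁ g
⨁-cong = 𝔽Σ.sum-cong-≗

⨁-zero : ∀ {k} {f : Fin k → Bool} → (∀ i → f i ≡ false) → ⨁ f ≡ false
⨁-zero {k} h = trans (⨁-cong h) (𝔽Σ.sum-replicate-zero k)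

⨁-xor : ∀ {k} (f g : Fin k → Bool) → ⨁ (λ i → f i xor g i) ≡ ⨁ f xor ⨁ g
⨁-xor = 𝔽Σ.∑-distrib-+

⨁-∧ : ∀ {k} a (f : Fin k → Bool) → ⨁ (λ i → a ∧ f i) ≡ a ∧ ⨁ f
⨁-∧ a f = sym (𝔽Σ.*-distribˡ-sum a f)

⨁-swap : ∀ {k l} (f : Fin k → Fin l → Bool) → ⨁ (λ i → ⨁ (f i)) ≡ ⨁ (λ j → ⨁ (λ i → f i j))
⨁-swap = 𝔽Σ.∑-comm

⨁-single : ∀ {k} (f : Fin k → Bool) e → (∀ i → e ≢ i → f i ≡ false) → ⨁ f ≡ f e
⨁-single f e h = trans (sym (par-count f)) (trans (cong par (count-pull f e))
  (trans (cong (λ c → par (bit (f e) + c)) (count-false off)) (par-bit (f e))))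
  where
  par-bit : ∀ b → par (bit b + 0) ≡ b
  par-bit true  = refl
  par-bit false = refl
  off : ∀ i → (f ∖ e) i ≡ false
  off i with e ≟ i
  ... | yes refl = trans (cong (λ b → f e ∧ not b) (δ-refl e)) (∧-zeroʳ (f e))
  ... | no  e≢i  = cong (_∧ not (δ e i)) (h i e≢i)

⨁-δ : ∀ {k} (r : Fin k → Bool) e → ⨁ (λ i → δ e i ∧ r i) ≡ r e
⨁-δ r e = trans (⨁-single (λ i → δ e i ∧ r i) e (λ i e≢i → cong (_∧ r i) (δ-≢ e≢i))) (cong (_∧ r e) (δ-refl e))

-- Linear algebra over the field with two elements

dot : ∀ {k} → (Fin k → Bool) → (Fin k → Bool) → Bool
dot z r = ⨁ (λ i → z i ∧ r i)

dot-xor : ∀ {k} (z w r : Fin k → Bool) → dot (λ i → z i xor w i) r ≡ dot z r xor dot w r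
dot-xor z w r = trans (⨁-cong λ i → ∧-distribʳ-xor (r i) (z i) (w i)) (⨁-xor (λ i → z i ∧ r i) (λ i → w i ∧ r i))

dot-xorʳ : ∀ {k} (z r r′ : Fin k → Bool) → dot z (λ i → r i xor r′ i) ≡ dot z r xor dot z r′
dot-xorʳ z r r′ = trans (⨁-cong λ i → ∧-distribˡ-xor (z i) (r i) (r′ i)) (⨁-xor (λ i → z i ∧ r i) (λ i → z i ∧ r′ i))

dot-∧ : ∀ {k} a (z r : Fin k → Bool) → dot (λ i → a ∧ z i) r ≡ a ∧ dot z r
dot-∧ a z r = trans (⨁-cong λ i → ∧-assoc a (z i) (r i)) (⨁-∧ a (λ i → z i ∧ r i))

dot-∧ʳ : ∀ {k} a (z r : Fin k → Bool) → dot z (λ i → a ∧ r i) ≡ a ∧ dot z r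
dot-∧ʳ a z r = trans (⨁-cong λ i → by-valid 3 (λ { (a ∷ b ∷ c ∷ []) → b ∧ (a ∧ c) }) (λ { (a ∷ b ∷ c ∷ []) → a ∧ (b ∧ c) }) refl (a ∷ z i ∷ r i ∷ [])) (⨁-∧ a (λ i → z i ∧ r i))

dot-two : ∀ {k} {r : Fin k → Bool} {e f} z → Two r e f → dot z r ≡ z e xor z f
dot-two {r = r} {e} {f} z tw = trans (sym (par-count (λ i → z i ∧ r i))) (trans (cong par (count₂ z tw)) (par-bits (z e) (z f)))
  where
  par-bits : ∀ a b → par (bit a + bit b) ≡ a xor b
  par-bits true  true  = refl
  par-bits true  false = refl
  par-bits false true  = refl
  par-bits false false = refl

-- Gaussian elimination: fewer equations than unknowns in `F` leave a nonzero solution supported in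
-- `F`. An equation that vanishes on `F` is skipped; otherwise a pivot `e` is eliminated from the
-- remaining ones.
kernel : ∀ {n m} (L : List (Fin n)) (row : Fin n → Fin m → Bool) (F : Fin m → Bool) → length L < count F →
         ∃ λ z → (∃ λ e → z e ≡ true) × (∀ i → z i ≡ true → F i ≡ true) × (∀ v → v ∈ L → dot z (row v) ≡ false)
kernel [] row F p = let (e , Fe) = count-some F p in δ e , (e , δ-refl e) , (λ i q → subst (λ j → F j ≡ true) (δ-true q) Fe) , λ v ()
kernel {m = m} (v₀ ∷ L) row F p = go (≡0⊎>0 (count (λ i → row v₀ i ∧ F i)))
  where
  ≡0⊎>0 : ∀ k → k ≡ 0 ⊎ 0 < k
  ≡0⊎>0 zero    = inj₁ refl
  ≡0⊎>0 (suc k) = inj₂ (s≤s z≤n)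

  Solution : Set
  Solution = ∃ λ z → (∃ λ e → z e ≡ true) × (∀ i → z i ≡ true → F i ≡ true) × (∀ v → v ∈ (v₀ ∷ L) → dot z (row v) ≡ false)

  skip : (∀ i → row v₀ i ∧ F i ≡ false) → Solution
  skip none with kernel L row F (<-trans (n<1+n _) p)
  ... | z , nz , z⊆F , ker = z , nz , z⊆F , λ { v (here refl) → ⨁-zero off ; v (there v∈L) → ker v v∈L }
    where
    off : ∀ i → z i ∧ row v₀ i ≡ false
    off i with z i in zi
    ... | false = refl
    ... | true  = trans (sym (∧-identityʳ (row v₀ i))) (trans (cong (row v₀ i ∧_) (sym (z⊆F i zi))) (none i))

  pivot : ∀ e → row v₀ e ≡ true → F e ≡ true → Solution
  pivot e re Fe = solve (kernel L row′ (F ∖ e) (≤-pred (subst (suc (suc (length L)) ≤_) (trans (count-pull F e) (cong (λ b → bit b + count (F ∖ e)) Fe)) p)))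
    where
    row′ : _ → Fin m → Bool
    row′ v i = row v i xor (row v e ∧ row v₀ i)
    solve : (∃ λ z → (∃ λ e → z e ≡ true) × (∀ i → z i ≡ true → (F ∖ e) i ≡ true) × (∀ v → v ∈ L → dot z (row′ v) ≡ false)) → Solution
    solve (z , (i , zi) , z⊆F , ker) = w , (i , trans (w-off (e≢ i zi)) zi) , w⊆F , λ { v (here refl) → at-v₀ ; v (there v∈L) → at-v v v∈L }
      where
      c : Bool
      c = dot z (row v₀)
      -- The value at the pivot is fixed by the equation of `v₀`.
      w : Fin m → Bool
      w j = z j xor (c ∧ δ e j)
      e≢ : ∀ j → z j ≡ true → e ≢ j
      e≢ j q = proj₂ (∖-true {P = F} {e} (z⊆F j q))
      w-off : ∀ {j} → e ≢ j → w j ≡ z j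
      w-off {j} e≢j = trans (cong (λ b → z j xor (c ∧ b)) (δ-≢ e≢j)) (trans (cong (z j xor_) (∧-zeroʳ c)) (xor-identityʳ (z j)))
      w⊆F : ∀ j → w j ≡ true → F j ≡ true
      w⊆F j q with e ≟ j
      ... | yes refl = Fe
      ... | no  e≢j  = proj₁ (∧-true (z⊆F j (trans (sym (w-off e≢j)) q)))
      dot-w : ∀ v → dot w (row v) ≡ dot z (row v) xor (c ∧ row v e)
      dot-w v = trans (dot-xor z (λ j → c ∧ δ e j) (row v)) (cong (dot z (row v) xor_) (trans (dot-∧ c (δ e) (row v)) (cong (c ∧_) (⨁-δ (row v) e))))
      at-v₀ : dot w (row v₀) ≡ false
      at-v₀ = trans (dot-w v₀) (trans (cong (λ b → c xor (c ∧ b)) re) (trans (cong (c xor_) (∧-identityʳ c)) (xor-same c)))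
      at-v : ∀ v → v ∈ L → dot w (row v) ≡ false
      at-v v v∈L = trans (dot-w v) (trans (cong (dot z (row v) xor_) (∧-comm c (row v e)))
        (trans (sym (trans (dot-xorʳ z (row v) (λ i → row v e ∧ row v₀ i)) (cong (dot z (row v) xor_) (dot-∧ʳ (row v e) z (row v₀))))) (ker v v∈L)))

  go : count (λ i → row v₀ i ∧ F i) ≡ 0 ⊎ 0 < count (λ i → row v₀ i ∧ F i) → Solution
  go (inj₁ q) = skip (count-zero (λ i → row v₀ i ∧ F i) q)
  go (inj₂ q) = let (e , r) = count-some (λ i → row v₀ i ∧ F i) q
                    (re , Fe) = ∧-true {row v₀ e} r in pivot e re Fe

length-filter : ∀ {A : Set} {P : A → Set} (P? : Decidable P) {k} (f : Fin k → A) → length (filter P? (tabulateᴸ f)) ≡ count (λ i → does (P? (f i)))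
length-filter P? {zero}  f = refl
length-filter P? {suc k} f with P? (f zero)
... | yes _ = cong suc (length-filter P? (f ∘ suc))
... | no  _ = length-filter P? (f ∘ suc)

∑-bits : ∀ {k} (P : Fin k → Bool) → ℕΣ.sum (λ i → bit (P i) + bit (P i)) ≡ count P + count P
∑-bits P = ℕΣ.∑-distrib-+ (bit ∘ P) (bit ∘ P)

-- Even edge sets and their behaviour under contraction

module _ {n m : ℕ} where

  ∂ : Net n m → (Fin m → Bool) → Fin n → Bool
  ∂ G z v = dot z (star G v)

  Even : Net n m → (Fin m → Bool) → Set
  Even G z = ∀ v → ∂ G z v ≡ false

  ∂-edge : ∀ (G : Net n m) e v → ∂ G (δ e) v ≡ star G v e
  ∂-edge G e v = ⨁-δ (star G v) e

  ⨁-star : ∀ (G : Net n m) e → ⨁ (λ v → star G v e) ≡ false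
  ⨁-star G e = trans (⨁-xor (λ v → δ v (s G e)) (λ v → δ v (t G e))) (cong₂ _xor_ (one (s G e)) (one (t G e)))
    where
    one : ∀ u → ⨁ (λ v → δ v u) ≡ true
    one u = trans (⨁-single (λ v → δ v u) u (λ i u≢i → δ-≢ (u≢i ∘ sym))) (δ-refl u)

  -- Every edge contributes at both of its ends, or nowhere if it is a loop. Hence evenness at one
  -- vertex follows from evenness at the others.
  ⨁-∂ : ∀ (G : Net n m) z → ⨁ (∂ G z) ≡ false
  ⨁-∂ G z = trans (⨁-swap λ v e → z e ∧ star G v e) (⨁-zero λ e → trans (⨁-∧ (z e) (λ v → star G v e)) (trans (cong (z e ∧_) (⨁-star G e)) (∧-zeroʳ (z e))))

  -- A path from `v` to `w` inside `K`, up to even sets. Such sets compose by symmetric difference,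
  -- without any care for repeated vertices.
  Link : Net n m → (Fin m → Set) → Fin n → Fin n → Set
  Link G K v w = ∃ λ P → (∀ i → P i ≡ true → K i) × (∀ u → ∂ G P u ≡ δ u v xor δ u w)

  module _ (G : Net n m) {K : Fin m → Set} where

    link-refl : ∀ {v} → Link G K v v
    link-refl {v} = const false , (λ _ ()) , λ u → trans (⨁-zero {m} λ _ → refl) (sym (xor-same (δ u v)))

    link-sym : ∀ {v w} → Link G K v w → Link G K w v
    link-sym {v} {w} (P , P⊆K , h) = P , P⊆K , λ u → trans (h u) (xor-comm (δ u v) (δ u w))

    link-trans : ∀ {u v w} → Link G K u v → Link G K v w → Link G K u w
    link-trans {u} {v} {w} (P , P⊆K , h) (Q , Q⊆K , k) = (λ i → P i xor Q i) , ⊆K , λ x →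
        trans (dot-xor P Q (star G x)) (trans (cong₂ _xor_ (h x) (k x))
          (by-valid 3 (λ { (a ∷ b ∷ c ∷ []) → (a xor b) xor (b xor c) }) (λ { (a ∷ b ∷ c ∷ []) → a xor c }) refl (δ x u ∷ δ x v ∷ δ x w ∷ [])))
      where
      ⊆K : ∀ i → P i xor Q i ≡ true → K i
      ⊆K i p with P i in Pi
      ... | true  = P⊆K i Pi
      ... | false = Q⊆K i p

    link-edge : ∀ {e} → K e → Link G K (s G e) (t G e)
    link-edge {e} k = δ e , (λ i p → subst K (δ-true p) k) , ∂-edge G e

  -- The edges of `A` are contracted one at a time; `ρ` sends each vertex to the current
  -- representative of its class. With `Q` an arbitrary equivalence, one `ρ` can come with links of
  -- several kinds at once.
  contraction : ∀ (G : Net n m) (A : Fin m → Bool) {Q : Fin n → Fin n → Set} →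
                (∀ {v} → Q v v) → (∀ {v w} → Q v w → Q w v) → (∀ {u v w} → Q u v → Q v w → Q u w) → (∀ e → A e ≡ true → Q (s G e) (t G e)) →
                ∃ λ ρ → (∀ e → A e ≡ true → ρ (s G e) ≡ ρ (t G e)) × (∀ v → Q v (ρ v))
  contraction G A {Q} Q-refl Q-sym Q-trans Q-edge = let (ρ , h , k) = go (allFin m) in ρ , (λ e → h e (∈-allFin e)) , k
    where
    Partial : List (Fin m) → Set
    Partial L = ∃ λ ρ → (∀ e → e ∈ L → A e ≡ true → ρ (s G e) ≡ ρ (t G e)) × (∀ v → Q v (ρ v))
    go : ∀ L → Partial L
    go [] = id , (λ _ ()) , λ _ → Q-refl
    go (e ∷ L) = let (ρ , h , k) = go L in bool-cases {A e}
      (λ Ae → merge (ρ (t G e)) (ρ (s G e)) ∘ ρ ,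
        (λ { i (here refl) _ → trans (keep (ρ (t G e)) (ρ (s G e))) (sym (merge-at (ρ (t G e)) (ρ (s G e))))
           ; i (there i∈L) Ai → cong (merge (ρ (t G e)) (ρ (s G e))) (h i i∈L Ai) }) ,
        λ v → Q-trans (k v) (related ρ k Ae (ρ v)))
      (λ ¬Ae → ρ , (λ { i (here refl) Ai → ⊥-elim (true≢false Ai ¬Ae) ; i (there i∈L) Ai → h i i∈L Ai }) , k)
      where
      keep : ∀ (a b : Fin n) → merge a b b ≡ b
      keep a b with a ≟ b
      ... | yes refl = merge-at a a
      ... | no  a≢b  = merge-off a≢b
      related : ∀ (ρ : Fin n → Fin n) → (∀ v → Q v (ρ v)) → A e ≡ true → ∀ v → Q v (merge (ρ (t G e)) (ρ (s G e)) v)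
      related ρ k Ae v with ρ (t G e) ≟ v
      ... | yes refl = subst (Q v) (sym (merge-at v (ρ (s G e)))) (Q-trans (Q-sym (k (t G e))) (Q-trans (Q-sym (Q-edge e Ae)) (k (s G e))))
      ... | no  h    = subst (Q v) (sym (merge-off h)) Q-refl

  -- For each edge `g` of `α`, the links from its two ends to their representatives are added. This
  -- moves the boundary of `g` to the ends it has in the contraction, and only edges of `K` are
  -- altered.
  lift-even : ∀ (G : Net n m) ρ {K : Fin m → Set} → (∀ v → Link G K v (ρ v)) → ∀ α → Even (contract ρ G) α →
              ∃ λ β → Even G β × (∀ e → ¬ K e → β e ≡ α e)
  lift-even G ρ {K} link α even = β , β-even , off
    where
    P : Fin n → Fin m → Bool
    P v = proj₁ (link v)
    R : Fin m → Fin m → Bool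
    R g e = P (s G g) e xor P (t G g) e
    β : Fin m → Bool
    β e = α e xor ⨁ (λ g → α g ∧ R g e)
    off : ∀ e → ¬ K e → β e ≡ α e
    off e e∉K = trans (cong (α e xor_) (⨁-zero λ g → trans (cong (α g ∧_) (cong₂ _xor_ (none (s G g)) (none (t G g)))) (∧-zeroʳ (α g)))) (xor-identityʳ (α e))
      where
      none : ∀ v → P v e ≡ false
      none v = ≢true λ p → e∉K (proj₁ (proj₂ (link v)) e p)
    β-even : Even G β
    β-even v = begin
      dot β (star G v)                                                    ≡⟨ dot-xor α (λ e → ⨁ (λ g → α g ∧ R g e)) (star G v) ⟩
      ∂ G α v xor dot (λ e → ⨁ (λ g → α g ∧ R g e)) (star G v)             ≡⟨ cong (∂ G α v xor_) swap ⟩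
      ∂ G α v xor ⨁ (λ g → α g ∧ ∂ G (R g) v)                             ≡⟨ ⨁-xor (λ g → α g ∧ star G v g) (λ g → α g ∧ ∂ G (R g) v) ⟨
      ⨁ (λ g → (α g ∧ star G v g) xor (α g ∧ ∂ G (R g) v))                ≡⟨ ⨁-cong (λ g → combine g) ⟩
      ∂ (contract ρ G) α v                                                ≡⟨ even v ⟩
      false                                                               ∎
      where
      open ≡-Reasoning
      swap : dot (λ e → ⨁ (λ g → α g ∧ R g e)) (star G v) ≡ ⨁ (λ g → α g ∧ ∂ G (R g) v)
      swap = begin
        ⨁ (λ e → ⨁ (λ g → α g ∧ R g e) ∧ star G v e)        ≡⟨ ⨁-cong (λ e → trans (∧-comm (⨁ (λ g → α g ∧ R g e)) (star G v e)) (sym (⨁-∧ (star G v e) (λ g → α g ∧ R g e)))) ⟩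
        ⨁ (λ e → ⨁ (λ g → star G v e ∧ (α g ∧ R g e)))      ≡⟨ ⨁-swap (λ e g → star G v e ∧ (α g ∧ R g e)) ⟩
        ⨁ (λ g → ⨁ (λ e → star G v e ∧ (α g ∧ R g e)))      ≡⟨ ⨁-cong (λ g → trans (⨁-cong λ e → by-valid 3 (λ { (a ∷ b ∷ c ∷ []) → a ∧ (b ∧ c) }) (λ { (a ∷ b ∷ c ∷ []) → b ∧ (c ∧ a) }) refl (star G v e ∷ α g ∷ R g e ∷ [])) (⨁-∧ (α g) (λ e → R g e ∧ star G v e))) ⟩
        ⨁ (λ g → α g ∧ ∂ G (R g) v)                         ∎
      combine : ∀ g → (α g ∧ star G v g) xor (α g ∧ ∂ G (R g) v) ≡ α g ∧ star (contract ρ G) v g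
      combine g = trans (cong (λ b → (α g ∧ star G v g) xor (α g ∧ b))
          (trans (dot-xor (P (s G g)) (P (t G g)) (star G v)) (cong₂ _xor_ (proj₂ (proj₂ (link (s G g))) v) (proj₂ (proj₂ (link (t G g))) v))))
        (by-valid 5 (λ { (a ∷ x ∷ y ∷ x′ ∷ y′ ∷ []) → (a ∧ (x xor y)) xor (a ∧ ((x xor x′) xor (y xor y′))) }) (λ { (a ∷ x ∷ y ∷ x′ ∷ y′ ∷ []) → a ∧ (x′ xor y′) }) refl
          (α g ∷ δ v (s G g) ∷ δ v (t G g) ∷ δ v (ρ (s G g)) ∷ δ v (ρ (t G g)) ∷ []))

  ∑-star : ∀ (G : Net n m) e → count (λ v → star G v e) ≡ bit (nonloop G e) + bit (nonloop G e)
  ∑-star G e with s G e ≟ t G e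
  ... | yes p = trans (count-false λ v → trans (cong (λ u → δ v u xor δ v (t G e)) p) (xor-same (δ v (t G e)))) (cong₂ _+_ (cong bit (sym (cong not (δ-≡ p)))) (cong bit (sym (cong not (δ-≡ p)))))
  ... | no  p = trans (size₂ {P = λ v → star G v e} {s G e} {t G e} record
        { at₁ = cong₂ _xor_ (δ-refl (s G e)) (δ-≢ p) ; at₂ = cong₂ _xor_ (δ-≢ (p ∘ sym)) (δ-refl (t G e)) ; ≢₁₂ = p ; only = only })
      (cong₂ _+_ (cong bit (sym (cong not (δ-≢ p)))) (cong bit (sym (cong not (δ-≢ p)))))
    where
    only : ∀ v → star G v e ≡ true → v ≡ s G e ⊎ v ≡ t G e
    only v q with v ≟ s G e | v ≟ t G e
    ... | yes r | _ = inj₁ r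
    ... | no _ | yes r = inj₂ r
    ... | no a | no b = ⊥-elim (true≢false q (cong₂ _xor_ (δ-≢ a) (δ-≢ b)))

  handshake : ∀ (G : Net n m) → ℕΣ.sum (deg G) ≡ size G + size G
  handshake G = trans (ℕΣ.∑-comm (λ v e → bit (star G v e))) (trans (ℕΣ.sum-cong-≗ (∑-star G)) (∑-bits (nonloop G)))

∨-trueˡ : ∀ {a b} → a ≡ true → a ∨ b ≡ true
∨-trueˡ refl = refl

∨-trueʳ : ∀ a {b} → b ≡ true → a ∨ b ≡ true
∨-trueʳ true  _ = refl
∨-trueʳ false p = p

module _ {n m : ℕ} where

  Redundant : Net n m → (Fin m → Bool) → Fin m → Set
  Redundant G χ e = ∃ λ D → D e ≡ true × (∀ i → D i ≡ true → χ i ≡ χ e) × Even G D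

  private
    4* : ∀ b d → (b ≡ true → 4 ≤ d) → bit b + bit b + (bit b + bit b) ≤ d
    4* true  d h = h refl
    4* false d h = z≤n

    halve : ∀ k l → k + k ≤ l + l → k ≤ l
    halve k l h = ≮⇒≥ λ l<k → <⇒≱ (+-mono-< l<k l<k) h

    split-≤ : ∀ k a b → k + k ≤ a + b → k ≤ a ⊎ k ≤ b
    split-≤ k a b h with k ≤? a
    ... | yes p = inj₁ p
    ... | no  p = inj₂ (+-cancelˡ-≤ k k b (≤-trans h (+-monoˡ-≤ b (<⇒≤ (≰⇒> p)))))

  -- Two colour classes of more than 2(k - 1) edges on k vertices cannot both be forests.
  redundant-edge : ∀ (G : Net n m) → (∀ v → deg G v ≡ 0 ⊎ 4 ≤ deg G v) → ∀ e → nonloop G e ≡ true → ∀ χ →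
                   ∃ λ i → nonloop G i ≡ true × Redundant G χ i
  redundant-edge G deg≥4 e₀ nl χ = [ find true , find false ∘ subst (count active ≤_) (count-cong λ e → cong (_∧ nonloop G e) (not-== (χ e))) ]′ (split-≤ (count active) (count (F true)) _ enough)
    where
    active : Fin n → Bool
    active v = does (0 <? deg G v)
    active-true : ∀ {v} → active v ≡ true → 4 ≤ deg G v
    active-true {v} p with 0 <? deg G v
    ... | yes q = [ (λ z → ⊥-elim (<⇒≢ q (sym z))) , id ]′ (deg≥4 v)
    ... | no q = ⊥-elim (true≢false p (dec-false (0 <? deg G v) q))
    active-false : ∀ {v} → active v ≡ false → deg G v ≡ 0
    active-false {v} p with 0 <? deg G v
    ... | no q = n≤0⇒n≡0 (≮⇒≥ q)
    ... | yes q = ⊥-elim (true≢false (dec-true (0 <? deg G v) q) p)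
    F : Bool → Fin m → Bool
    F b e = (χ e == b) ∧ nonloop G e
    not-== : ∀ b → not (b == true) ≡ (b == false)
    not-== true  = refl
    not-== false = refl
    -- Four times the number of active vertices is at most the degree sum, that is, twice the number
    -- of edges. So one class has at least as many edges as there are active vertices.
    enough : count active + count active ≤ count (F true) + count (λ e → not (χ e == true) ∧ nonloop G e)
    enough = subst (count active + count active ≤_) (count-split (λ e → χ e == true) (nonloop G)) (halve (count active + count active) (size G)
      (subst₂ _≤_ quadruple (handshake G) (sum-mono λ v → 4* (active v) (deg G v) (active-true {v}))))
      where
      quadruple : ℕΣ.sum (λ v → bit (active v) + bit (active v) + (bit (active v) + bit (active v))) ≡ count active + count active + (count active + count active)
      quadruple = trans (ℕΣ.∑-distrib-+ (λ v → bit (active v) + bit (active v)) (λ v → bit (active v) + bit (active v))) (cong₂ _+_ (∑-bits active) (∑-bits active))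
    v₀ : Fin n
    v₀ = s G e₀
    v₀-active : active v₀ ≡ true
    v₀-active = bool-cases id λ h → ⊥-elim (true≢false (nonloop-star G {e₀} nl) (count-zero (star G v₀) (active-false {v₀} h) e₀))
    on? : Decidable (λ v → (active ∖ v₀) v ≡ true)
    on? v = (active ∖ v₀) v ≟ᵇ true
    -- The equation at `v₀` follows from the others by `⨁-∂`; omitting it makes the equations fewer
    -- than the edges.
    L : List (Fin n)
    L = filter on? (allFin n)
    length-L : suc (length L) ≡ count active
    length-L = trans (cong suc (trans (length-filter on? id) (count-cong λ v → does-≟ ((active ∖ v₀) v))))
      (sym (trans (count-pull active v₀) (cong (λ b → bit b + count (active ∖ v₀)) v₀-active)))
      where
      does-≟ : ∀ b → does (b ≟ᵇ true) ≡ b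
      does-≟ true  = refl
      does-≟ false = refl
    find : ∀ b → count active ≤ count (F b) → ∃ λ i → nonloop G i ≡ true × Redundant G χ i
    find b h = go (kernel L (star G) (F b) (≤-trans (≤-reflexive length-L) h))
      where
      go : (∃ λ z → (∃ λ e → z e ≡ true) × (∀ i → z i ≡ true → F b i ≡ true) × (∀ v → v ∈ L → dot z (star G v) ≡ false)) → _
      go (z , (e , ze) , z⊆F , ker) = e , proj₂ (∧-true (z⊆F e ze)) , z , ze , (λ i zi → trans (colour i zi) (sym (colour e ze))) , even
        where
        colour : ∀ i → z i ≡ true → χ i ≡ b
        colour i zi = ==-sound (proj₁ (∧-true (z⊆F i zi)))
        off : ∀ v → v₀ ≢ v → ∂ G z v ≡ false
        off v v₀≢v = bool-cases {active v}
          (λ a → ker v (∈-filter⁺ on? (∈-allFin v) (∖-intro {P = active} {v₀} a v₀≢v)))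
          (λ a → ⨁-zero λ i → trans (cong (z i ∧_) (count-zero (star G v) (active-false {v} a) i)) (∧-zeroʳ (z i)))
        even : Even G z
        even v with v₀ ≟ v
        ... | yes refl = trans (sym (⨁-single (∂ G z) v₀ off)) (⨁-∂ G z)
        ... | no  v₀≢v = off v v₀≢v

  -- In either colour, the span of the movable edges (those that become redundant at some point) is the same for all reachable colourings.
  module Recolour (G : Net n m) where

    -- The ends of `e` are connected in the class `b`; in matroid terms, `e` lies in the closure of
    -- that class.
    Span : (Fin m → Bool) → Bool → Fin m → Set
    Span χ b e = ∃ λ P → (∀ i → P i ≡ true → χ i ≡ b) × (∀ v → ∂ G P v ≡ star G v e)

    flip : (Fin m → Bool) → Fin m → Fin m → Bool
    flip χ e = upd χ e (not (χ e))

    flip-at : ∀ χ e → flip χ e e ≡ not (χ e)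
    flip-at χ e = upd-at χ e (not (χ e))

    flip-off : ∀ χ {e i} → e ≢ i → flip χ e i ≡ χ i
    flip-off χ {e} e≢i = upd-off χ (not (χ e)) e≢i

    not≢ : ∀ {b} → b ≢ not b
    not≢ {true}  ()
    not≢ {false} ()

    dichotomy : ∀ a b → b ≡ a ⊎ b ≡ not a
    dichotomy true  true  = inj₁ refl
    dichotomy true  false = inj₂ refl
    dichotomy false true  = inj₂ refl
    dichotomy false false = inj₁ refl

    _⊕_ : (Fin m → Bool) → Fin m → Fin m → Bool
    (P ⊕ e) i = P i xor δ e i

    ∂-⊕ : ∀ P e v → ∂ G (P ⊕ e) v ≡ ∂ G P v xor star G v e
    ∂-⊕ P e v = trans (dot-xor P (δ e) (star G v)) (cong (∂ G P v xor_) (∂-edge G e v))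

    ⊕-at : ∀ P {e} → P e ≡ true → (P ⊕ e) e ≡ false
    ⊕-at P {e} p = cong₂ _xor_ p (δ-refl e)

    ⊕-off : ∀ P {e i} → e ≢ i → (P ⊕ e) i ≡ P i
    ⊕-off P {e} {i} e≢i = trans (cong (P i xor_) (δ-≢ e≢i)) (xor-identityʳ (P i))

    -- In its new class, `e` closes a cycle with the set that spanned it there.
    flip-cycle : ∀ {χ e} → (sp : Span χ (not (χ e)) e) → (proj₁ sp ⊕ e) e ≡ true × (∀ i → (proj₁ sp ⊕ e) i ≡ true → flip χ e i ≡ flip χ e e) × Even G (proj₁ sp ⊕ e)
    flip-cycle {χ} {e} (P , P⊆ , h) = cong₂ _xor_ e∉P (δ-refl e) , ⊆ , λ v → trans (∂-⊕ P e v) (trans (cong (_xor star G v e) (h v)) (xor-same (star G v e)))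
      where
      e∉P : P e ≡ false
      e∉P = ≢true λ p → not≢ (P⊆ e p)
      ⊆ : ∀ i → (P ⊕ e) i ≡ true → flip χ e i ≡ flip χ e e
      ⊆ i p with e ≟ i
      ... | yes refl = refl
      ... | no  e≢i  = trans (flip-off χ e≢i) (trans (P⊆ i (trans (sym (⊕-off P e≢i)) p)) (sym (flip-at χ e)))

    -- A redundant edge leaves its class without loss: wherever `P` used it, the rest of the cycle
    -- `D` takes its place.
    span-flip : ∀ {χ e} → Redundant G χ e → ∀ {b i} → Span χ b i → Span (flip χ e) b i
    span-flip {χ} {e} (D , De , D⊆ , even) {b} {i} (P , P⊆ , h) = bool-cases {P e} with-e without-e
      where
      without-e : P e ≡ false → Span (flip χ e) b i
      without-e e∉P = P , (λ j p → trans (flip-off χ λ { refl → true≢false p e∉P }) (P⊆ j p)) , h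
      with-e : P e ≡ true → Span (flip χ e) b i
      with-e e∈P = Q , ⊆ , λ v → trans (dot-xor P D (star G v)) (trans (cong₂ _xor_ (h v) (even v)) (xor-identityʳ (star G v i)))
        where
        Q : Fin m → Bool
        Q j = P j xor D j
        ⊆ : ∀ j → Q j ≡ true → flip χ e j ≡ b
        ⊆ j q with e ≟ j
        ... | yes refl = ⊥-elim (true≢false q (cong₂ _xor_ e∈P De))
        ... | no  e≢j  = trans (flip-off χ e≢j) (inside (P j) refl)
          where
          inside : ∀ x → P j ≡ x → χ j ≡ b
          inside true  p = P⊆ j p
          inside false p = trans (D⊆ j (trans (cong (_xor D j) (sym p)) q)) (P⊆ e e∈P)

    -- Only redundant edges move, and only into a class that already spans them, so a move costs
    -- nothing in one class and gains nothing in the other.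
    data Reach (χ : Fin m → Bool) : (Fin m → Bool) → Set where
      start : Reach χ χ
      move  : ∀ {χ′ e} → Reach χ χ′ → Redundant G χ′ e → Span χ′ (not (χ′ e)) e → Reach χ (flip χ′ e)

    span-reach : ∀ {χ χ′} → Reach χ χ′ → ∀ {b i} → Span χ b i → Span χ′ b i
    span-reach start sp = sp
    span-reach (move r red _) sp = span-flip red (span-reach r sp)

    module _ (χ₀ : Fin m → Bool) where

      Movable : Fin m → Set
      Movable e = ∃ λ χ → Reach χ₀ χ × Redundant G χ e

      SpanA : (Fin m → Bool) → Bool → Fin m → Set
      SpanA χ b e = ∃ λ P → (∀ i → P i ≡ true → χ i ≡ b × Movable i) × (∀ v → ∂ G P v ≡ star G v e)

      span-own : ∀ {χ e} → Reach χ₀ χ → Redundant G χ e → SpanA χ (χ e) e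
      span-own {χ} {e} r red = δ e , (λ i p → subst (λ j → χ j ≡ χ e × Movable j) (δ-true p) (refl , χ , r , red)) , ∂-edge G e

      -- After `e` has moved, every edge of `P` lies on the cycle that it closes with `e`, and is
      -- therefore movable itself.
      span-other : ∀ {χ e} → Reach χ₀ χ → Redundant G χ e → Span χ (not (χ e)) e → SpanA χ (not (χ e)) e
      span-other {χ} {e} r red sp@(P , P⊆ , h) = P , (λ i p → P⊆ i p , flip χ e , move r red sp , redundant i p) , h
        where
        cycle = flip-cycle {χ} {e} sp
        redundant : ∀ i → P i ≡ true → Redundant G (flip χ e) i
        redundant i p = P ⊕ e , i∈ , (λ j q → trans (proj₁ (proj₂ cycle) j q) (sym (proj₁ (proj₂ cycle) i i∈))) , proj₂ (proj₂ cycle)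
          where
          i∈ : (P ⊕ e) i ≡ true
          i∈ = trans (⊕-off P λ { refl → not≢ (P⊆ i p) }) p

      -- Undoing a move: if `P` uses `e` in its new colour, `e` is replaced by the movable edges
      -- that spanned it in this colour before the move.
      spanA-back : ∀ {χ} → Reach χ₀ χ → ∀ {b i} → SpanA χ b i → SpanA χ₀ b i
      spanA-back start sp = sp
      spanA-back (move {χ} {e} r red sp) {b} {i} (P , P⊆ , h) = spanA-back r (bool-cases {P e} with-e without-e)
        where
        keep : ∀ j → e ≢ j → P j ≡ true → χ j ≡ b × Movable j
        keep j e≢j p = trans (sym (flip-off χ e≢j)) (proj₁ (P⊆ j p)) , proj₂ (P⊆ j p)
        without-e : P e ≡ false → SpanA χ b i
        without-e e∉P = P , (λ j p → keep j (λ { refl → true≢false p e∉P }) p) , h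
        with-e : P e ≡ true → SpanA χ b i
        with-e e∈P with span-other r red sp
        ... | (R , R⊆ , k) = Q , ⊆ , λ v → trans (dot-xor (P ⊕ e) R (star G v)) (trans (cong₂ _xor_ (trans (∂-⊕ P e v) (cong (_xor star G v e) (h v))) (k v))
            (by-valid 2 (λ { (a ∷ b ∷ []) → (a xor b) xor b }) (λ { (a ∷ b ∷ []) → a }) refl (star G v i ∷ star G v e ∷ [])))
          where
          Q : Fin m → Bool
          Q j = (P ⊕ e) j xor R j
          b≡ : not (χ e) ≡ b
          b≡ = trans (sym (flip-at χ e)) (proj₁ (P⊆ e e∈P))
          ⊆ : ∀ j → Q j ≡ true → χ j ≡ b × Movable j
          ⊆ j q with (P ⊕ e) j in p
          ... | true  = keep j (λ { refl → true≢false p (⊕-at P e∈P) }) (trans (sym (⊕-off P λ { refl → true≢false p (⊕-at P e∈P) })) p)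
          ... | false = trans (proj₁ (R⊆ j q)) b≡ , proj₂ (R⊆ j q)

    -- `A` will be the set of movable edges. It can be contracted, and the contraction undone inside
    -- either colour.
    record Spread : Set where
      field
        χ A    : Fin m → Bool
        edge   : Fin m
        edge∈A : A edge ≡ true
        edge-nonloop : nonloop G edge ≡ true
        spans  : ∀ e → A e ≡ true → ∀ b → ∃ λ P → (∀ i → P i ≡ true → χ i ≡ b × A i ≡ true) × (∀ v → ∂ G P v ≡ star G v e)

    module _ (deg≥4 : ∀ (v : Fin n) → deg G v ≡ 0 ⊎ 4 ≤ deg G v) (e₀ : Fin m) (e₀-nonloop : nonloop G e₀ ≡ true) where

      missing : (Bool → Fin m → Bool) → ℕ
      missing S = count (not ∘ S true) + count (not ∘ S false)

      add : (Bool → Fin m → Bool) → Bool → Fin m → Bool → Fin m → Bool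
      add S b e b′ i = if b == b′ then upd (S b′) e true i else S b′ i

      upd-misses-less : ∀ (M : Fin m → Bool) e → M e ≡ false → count (not ∘ upd M e true) < count (not ∘ M)
      upd-misses-less M e h = count-mono-< {P = not ∘ upd M e true} {Q = not ∘ M} sub e (cong not (upd-at M e true)) (cong not h)
        where
        sub : ∀ i → not (upd M e true i) ≡ true → not (M i) ≡ true
        sub i p with e ≟ i
        ... | yes refl = ⊥-elim (true≢false p (cong not (upd-at M e true)))
        ... | no  e≢i  = trans (cong not (sym (upd-off M true e≢i))) p

      add-missing : ∀ S b e → S b e ≡ false → missing (add S b e) < missing S
      add-missing S true  e h = +-monoˡ-< (count (not ∘ S false)) (upd-misses-less (S true) e h)
      add-missing S false e h = +-monoʳ-< (count (not ∘ S true)) (upd-misses-less (S false) e h)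

      add-true : ∀ S b e b′ i → add S b e b′ i ≡ true → (b′ ≡ b × i ≡ e) ⊎ S b′ i ≡ true
      add-true S b e b′ i p with b == b′ in q
      ... | false = inj₂ p
      ... | true with e ≟ i
      ...   | yes e≡i = inj₁ (sym (==-sound q) , sym e≡i)
      ...   | no  e≢i = inj₂ (trans (sym (upd-off (S b′) true e≢i)) p)

      -- S records edges known to be spanned; a redundant edge outside the span of the other colour can be moved there to enlarge S.
      spread : ∀ k χ S → missing S < k → (∀ b i → S b i ≡ true → Span χ b i) → ¬ ¬ Spread
      spread (suc k) χ S (s≤s S≤k) sound fail =
        ¬¬-∀ {P = Status} status λ st → fail (build st)
        where
        Status : Fin m → Set
        Status e = ¬ Movable χ e ⊎ (∀ b → SpanA χ χ b e)
        span-all : ∀ {χ′ e} → Reach χ χ′ → Redundant G χ′ e → Span χ′ (not (χ′ e)) e → ∀ b → SpanA χ χ b e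
        span-all {χ′} {e} r red sp b with dichotomy (χ′ e) b
        ... | inj₁ refl = spanA-back χ r (span-own χ r red)
        ... | inj₂ refl = spanA-back χ r (span-other χ r red sp)
        improve : ∀ {χ′ e} → Reach χ χ′ → Redundant G χ′ e → ¬ Span χ′ (not (χ′ e)) e → ⊥
        improve {χ′} {e} r red ¬sp = spread k (flip χ′ e) (add S (not (χ′ e)) e)
          (≤-trans (add-missing S (not (χ′ e)) e (≢true λ p → ¬sp (span-reach r (sound _ e p)))) S≤k) sound′ fail
          where
          sound′ : ∀ b i → add S (not (χ′ e)) e b i ≡ true → Span (flip χ′ e) b i
          sound′ b i p with add-true S (not (χ′ e)) e b i p
          ... | inj₁ (refl , refl) = δ e , (λ j q → trans (cong (flip χ′ e) (sym (δ-true q))) (flip-at χ′ e)) , ∂-edge G e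
          ... | inj₂ q = span-flip red (span-reach r (sound b i q))
        -- Whether an edge is movable is undecided; if it is and lacks a span, `improve` applies.
        status : ∀ e → ¬ ¬ Status e
        status e neither = neither (inj₁ λ { (χ′ , r , red) → improve r red λ sp → neither (inj₂ (span-all r red sp)) })
        build : (∀ e → Status e) → Spread
        build st = record
          { χ = χ ; A = A′ ; edge = i ; edge∈A = A⇒A′ (χ , start , red) ; edge-nonloop = nl
          ; spans = λ e Ae b → let (P , P⊆ , h) = spans e Ae b in P , (λ j p → proj₁ (P⊆ j p) , A⇒A′ (proj₂ (P⊆ j p))) , h }
          where
          -- An edge redundant at the start is movable, so `A` contains a nonloop edge and
          -- contracting it makes the graph smaller.
          found = redundant-edge G deg≥4 e₀ e₀-nonloop χ
          i = proj₁ found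
          nl = proj₁ (proj₂ found)
          red = proj₂ (proj₂ found)
          in? : ∀ {e} → Status e → Bool
          in? (inj₁ _) = false
          in? (inj₂ _) = true
          A′ : Fin m → Bool
          A′ e = in? (st e)
          A⇒A′ : ∀ {e} → Movable χ e → A′ e ≡ true
          A⇒A′ {e} a with st e
          ... | inj₁ ¬a = ⊥-elim (¬a a)
          ... | inj₂ _  = refl
          spans : ∀ e → A′ e ≡ true → ∀ b → SpanA χ χ b e
          spans e p with st e
          ... | inj₂ sp = sp

      spread-exists : ¬ ¬ Spread
      spread-exists = spread (suc (missing (λ _ _ → false))) (const true) (λ _ _ → false) ≤-refl λ _ _ ()

  -- Existence of flows without zeros

  Flow : Net n m → Set
  Flow G = ∃₂ λ α β → Even G α × Even G β × (∀ e → α e ∨ β e ≡ true)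

  NoThreeCut : Net n m → Set
  NoThreeCut G = ∀ X → cut G X ≢ 3

  -- An even set has equal values on the two edges at `v`, so `e` is covered because `f` is.
  flow-degree-2 : ∀ (G : Net n m) {v w e f} → v ≢ w → Connects G e v w → Two (star G v) e f → Flow (contract (merge v w) G) → Flow G
  flow-degree-2 G {v} {w} {e} {f} v≢w j tw (α′ , β′ , even-α , even-β , cover) =
    let (α , Eα , off-α) = lift-even G (merge v w) link α′ even-α
        (β , Eβ , off-β) = lift-even G (merge v w) link β′ even-β
    in α , β , Eα , Eβ , cover′ Eα Eβ off-α off-β
    where
    link : ∀ z → Link G (_≡ e) z (merge v w z)
    link z with v ≟ z
    ... | yes refl = subst (Link G (_≡ e) v) (sym (merge-at v w)) (along j)
      where
      along : Connects G e v w → Link G (_≡ e) v w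
      along (inj₁ (refl , refl)) = link-edge G {K = _≡ e} {e} refl
      along (inj₂ (refl , refl)) = link-sym G (link-edge G {K = _≡ e} {e} refl)
    ... | no v≢z = subst (Link G (_≡ e) z) (sym (merge-off v≢z)) (link-refl G)
    cover′ : ∀ {α β} → Even G α → Even G β → (∀ i → i ≢ e → α i ≡ α′ i) → (∀ i → i ≢ e → β i ≡ β′ i) → ∀ i → α i ∨ β i ≡ true
    cover′ {α} {β} Eα Eβ off-α off-β i with i ≟ e
    ... | no  i≢e  = trans (cong₂ _∨_ (off-α i i≢e) (off-β i i≢e)) (cover i)
    ... | yes refl = trans (cong₂ _∨_ (trans (same α Eα) (off-α f (Two.≢₁₂ tw ∘ sym))) (trans (same β Eβ) (off-β f (Two.≢₁₂ tw ∘ sym)))) (cover f)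
      where
      same : ∀ z → Even G z → z e ≡ z f
      same z E = ==-sound (cong not (trans (sym (dot-two z tw)) (E v)))

  -- Loops of the contraction do not affect evenness, so on them `α` is set to 1 in colour `false`
  -- and `β` to 1 in colour `true`. Lifting `α` changes only edges of colour `true`, lifting `β`
  -- only those of colour `false`, so these ones survive.
  flow-spread : ∀ (G : Net n m) (sp : Recolour.Spread G) → (∀ ρ → ρ (s G (Recolour.Spread.edge sp)) ≡ ρ (t G (Recolour.Spread.edge sp)) → ¬ ¬ Flow (contract ρ G)) → ¬ ¬ Flow G
  flow-spread G sp ih fail = finish (contraction G A {Q} (λ b → link-refl G) (λ l b → link-sym G (l b)) (λ l k b → link-trans G (l b) (k b)) spans)
    where
    open Recolour.Spread sp
    K : Bool → Fin m → Set
    K b i = χ i ≡ b × A i ≡ true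
    Q : Fin n → Fin n → Set
    Q v w = ∀ b → Link G (K b) v w
    finish : (∃ λ ρ → (∀ e → A e ≡ true → ρ (s G e) ≡ ρ (t G e)) × (∀ v → Q v (ρ v))) → ⊥
    finish (ρ , contracts , link) = ih ρ (contracts edge edge∈A) λ { (α , β , Eα , Eβ , cover) →
      let (α″ , Eα″ , off-α) = lift-even G ρ (λ v → link v true) (fill (not ∘ χ) α) (fill-even (not ∘ χ) α Eα)
          (β″ , Eβ″ , off-β) = lift-even G ρ (λ v → link v false) (fill χ β) (fill-even χ β Eβ)
      in fail (α″ , β″ , Eα″ , Eβ″ , covers α β cover α″ β″ off-α off-β) }
      where
      H : Net n m
      H = contract ρ G
      fill : (Fin m → Bool) → (Fin m → Bool) → Fin m → Bool
      fill c z e = if nonloop H e then z e else c e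
      fill-even : ∀ c z → Even H z → Even H (fill c z)
      fill-even c z E v = trans (⨁-cong eq) (E v)
        where
        eq : ∀ e → fill c z e ∧ star H v e ≡ z e ∧ star H v e
        eq e = bool-cases {nonloop H e}
          (λ p → cong (λ b → (if b then z e else c e) ∧ star H v e) p)
          (λ p → trans (cong (fill c z e ∧_) (loop-star H {e} p (δ v))) (trans (∧-zeroʳ (fill c z e)) (sym (trans (cong (z e ∧_) (loop-star H {e} p (δ v))) (∧-zeroʳ (z e))))))
      A-loop : ∀ e → A e ≡ true → nonloop H e ≡ false
      A-loop e a = cong not (δ-≡ (contracts e a))
      covers : ∀ (α β : Fin m → Bool) → (∀ e → α e ∨ β e ≡ true) → ∀ (α″ β″ : Fin m → Bool) → (∀ e → ¬ K true e → α″ e ≡ fill (not ∘ χ) α e) → (∀ e → ¬ K false e → β″ e ≡ fill χ β e) → ∀ e → α″ e ∨ β″ e ≡ true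
      covers α β cover α″ β″ off-α off-β e = bool-cases {nonloop H e}
        (λ p → trans (cong₂ _∨_ (trans (off-α e λ k → true≢false p (A-loop e (proj₂ k))) (cong (λ b → if b then α e else not (χ e)) p))
                                (trans (off-β e λ k → true≢false p (A-loop e (proj₂ k))) (cong (λ b → if b then β e else χ e) p))) (cover e))
        (λ p → bool-cases {χ e}
          (λ c → ∨-trueʳ (α″ e) (trans (off-β e λ k → true≢false c (proj₁ k)) (trans (cong (λ b → if b then β e else χ e) p) c)))
          (λ c → ∨-trueˡ (trans (off-α e λ k → true≢false (proj₁ k) c) (trans (cong (λ b → if b then α e else not (χ e)) p) (cong not c)))))

  flow : ∀ k (G : Net n m) → size G < k → NoBridge G → NoThreeCut G → ¬ ¬ Flow G
  flow (suc k) G (s≤s G≤k) no1 no3 fail = by-cases {∃ λ v → deg G v ≡ 2} two rest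
    where
    two : (∃ λ v → deg G v ≡ 2) → ⊥
    two (v , d) =
      let (e , p) = count-some (star G v) (subst (0 <_) (sym d) (s≤s z≤n))
          (f , tw) = get₂′ {P = star G v} d p
          (w , v≢w , j) = star-joins G {v} {e} p
      in flow k (contract (merge v w) G) (≤-trans (merge-size G v≢w j) G≤k) (no1 ∘ (_∘ merge v w)) (no3 ∘ (_∘ merge v w))
           (fail ∘ flow-degree-2 G v≢w j tw)
    rest : ¬ (∃ λ v → deg G v ≡ 2) → ⊥
    rest no2 = by-cases {∃ λ e → nonloop G e ≡ true}
      (λ { (e , nl) → Recolour.spread-exists G deg≥4 e nl λ sp → flow-spread G sp (λ ρ h →
             flow k (contract ρ G) (≤-trans (contract-size G ρ _ (Recolour.Spread.edge-nonloop sp) h) G≤k) (no1 ∘ (_∘ ρ)) (no3 ∘ (_∘ ρ))) fail })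
      (λ none → fail (const true , const true , all-even none , all-even none , λ _ → refl))
      where
      deg≥4 : ∀ v → deg G v ≡ 0 ⊎ 4 ≤ deg G v
      deg≥4 v with deg G v | no1 (δ v) | no3 (δ v) | (λ p → no2 (v , p))
      ... | 0 | _ | _ | _ = inj₁ refl
      ... | 1 | h | _ | _ = ⊥-elim (h refl)
      ... | 2 | _ | _ | h = ⊥-elim (h refl)
      ... | 3 | _ | h | _ = ⊥-elim (h refl)
      ... | suc (suc (suc (suc _))) | _ | _ | _ = inj₂ (s≤s (s≤s (s≤s (s≤s z≤n))))
      all-even : ¬ (∃ λ e → nonloop G e ≡ true) → Even G (const true)
      all-even none v = ⨁-zero λ e → ≢true λ p → none (e , cross-nonloop G {e} (δ v) p)

-- The colouring

-- Edges outside M get the four colours (α, β); of the three values of (α, β) on M, one is coloured 4 and the two others 5.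
colour : Bool → Bool → Bool → Bool → Bool → Fin 6
colour τ τ′ false false false = 0F
colour τ τ′ false false true  = 1F
colour τ τ′ false true  false = 2F
colour τ τ′ false true  true  = 3F
colour τ τ′ true  a     b     = if (a == τ) ∧ (b == τ′) then 4F else 5F

palette : Fin 6 → Fin 6 → Fin 6 → Subset 6
palette c d e = tabulate λ k → does (c ≟ k) ∨ (does (d ≟ k) ∨ does (e ≟ k))

-- The colours at a vertex with the values (a, b) on M and (x, y) on one of the other edges.
colours : Bool → Bool → Bool → Bool → Bool → Bool → Subset 6
colours τ τ′ a b x y = palette (colour τ τ′ true a b) (colour τ τ′ false x y) (colour τ τ′ false (a xor x) (b xor y))

normalᵇ : ℕ → Bool
normalᵇ k = does ((k ℕₚ.≟ 3) ⊎-dec (k ℕₚ.≟ 5))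

-- The colours beside the matching edge form a coset of the group generated by `(a , b)` at either
-- end. Two such cosets are equal or disjoint, which makes the edge poor or rich.
matching-normal : ∀ τ τ′ a b x y x′ y′ → a ∨ b ≡ true → normalᵇ ∣ colours τ τ′ a b x y ∪ colours τ τ′ a b x′ y′ ∣ ≡ true
matching-normal τ τ′ a b x y x′ y′ = ⇒-elim {a = a ∨ b} (valid-sound 8
  (λ { (τ ∷ τ′ ∷ a ∷ b ∷ x ∷ y ∷ x′ ∷ y′ ∷ []) → (a ∨ b) ⇒ normalᵇ ∣ colours τ τ′ a b x y ∪ colours τ τ′ a b x′ y′ ∣ }) refl
  (τ ∷ τ′ ∷ a ∷ b ∷ x ∷ y ∷ x′ ∷ y′ ∷ []))

bad : Bool → Bool → (a b a′ b′ x y : Bool) → Bool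
bad τ τ′ a b a′ b′ x y = not (normalᵇ ∣ colours τ τ′ a b x y ∪ colours τ τ′ a′ b′ x y ∣)

-- The parameters name the value on M whose colour is kept apart, so the three choices identify the
-- three pairs. An edge outside M is bad only when the identified pair is the pair of values on the
-- matching edges at its ends.
bad-once : ∀ a b a′ b′ x y → a ∨ b ≡ true → a′ ∨ b′ ≡ true →
           bit (bad false true a b a′ b′ x y) + (bit (bad true false a b a′ b′ x y) + bit (bad true true a b a′ b′ x y)) ≤ 1
bad-once a b a′ b′ x y p q = at-most-one (bad false true a b a′ b′ x y) (bad true false a b a′ b′ x y) (bad true true a b a′ b′ x y) (⇒-elim {a = (a ∨ b) ∧ (a′ ∨ b′)} (valid-sound 6
  (λ { (a ∷ b ∷ a′ ∷ b′ ∷ x ∷ y ∷ []) → ((a ∨ b) ∧ (a′ ∨ b′)) ⇒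
       amo (bad false true a b a′ b′ x y) (bad true false a b a′ b′ x y) (bad true true a b a′ b′ x y) }) refl
  (a ∷ b ∷ a′ ∷ b′ ∷ x ∷ y ∷ [])) (cong₂ _∧_ p q))
  where
  amo : Bool → Bool → Bool → Bool
  amo i j k = not (i ∧ j) ∧ (not (i ∧ k) ∧ not (j ∧ k))
  at-most-one : ∀ i j k → amo i j k ≡ true → bit i + (bit j + bit k) ≤ 1
  at-most-one false false k     _ = bit-≤ k
    where
    bit-≤ : ∀ k → bit k ≤ 1
    bit-≤ true  = ≤-refl
    bit-≤ false = z≤n
  at-most-one false true  false _ = ≤-refl
  at-most-one true  false false _ = ≤-refl

colour-clash : ∀ τ τ′ μ a b ν x y → colour τ τ′ μ a b ≡ colour τ τ′ ν x y → (μ ∧ ν ≡ true) ⊎ (μ ≡ false × ν ≡ false × a ≡ x × b ≡ y)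
colour-clash τ τ′ μ a b ν x y h = go μ ν refl refl
  where
  check : (μ ∧ ν) ∨ (not μ ∧ (not ν ∧ ((a == x) ∧ (b == y)))) ≡ true
  check = ⇒-elim {a = does (colour τ τ′ μ a b ≟ colour τ τ′ ν x y)} (valid-sound 8
    (λ { (τ ∷ τ′ ∷ μ ∷ a ∷ b ∷ ν ∷ x ∷ y ∷ []) → does (colour τ τ′ μ a b ≟ colour τ τ′ ν x y) ⇒
         (μ ∧ ν) ∨ (not μ ∧ (not ν ∧ ((a == x) ∧ (b == y)))) }) refl (τ ∷ τ′ ∷ μ ∷ a ∷ b ∷ ν ∷ x ∷ y ∷ [])) (dec-true (_ ≟ _) h)
  go : ∀ μ′ ν′ → μ ≡ μ′ → ν ≡ ν′ → (μ ∧ ν ≡ true) ⊎ (μ ≡ false × ν ≡ false × a ≡ x × b ≡ y)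
  go true  true  refl refl = inj₁ refl
  go true  false refl refl = inj₁ check
  go false true  refl refl = inj₁ check
  go false false refl refl = inj₂ (refl , refl , ==-sound (proj₁ (∧-true check)) , ==-sound (proj₂ (∧-true check)))

dot-three : ∀ {k} {r : Fin k → Bool} {e f g} z → Three r e f g → dot z r ≡ z e xor (z f xor z g)
dot-three {r = r} {e} {f} {g} z th = trans (sym (par-count (λ i → z i ∧ r i))) (trans (cong par (count₃ z th)) (par-bits (z e) (z f) (z g)))
  where
  par-bits : ∀ a b c → par (bit a + (bit b + bit c)) ≡ a xor (b xor c)
  par-bits a b c = trans (par-+ (bit a) _) (cong₂ _xor_ (par-bit a) (trans (par-+ (bit b) _) (cong₂ _xor_ (par-bit b) (par-bit c))))
    where
    par-bit : ∀ b → par (bit b) ≡ b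
    par-bit true  = refl
    par-bit false = refl

count-all : ∀ k → count {k} (const true) ≡ k
count-all zero    = refl
count-all (suc k) = cong suc (count-all k)

does-≡ : ∀ {A : Set} (d : Dec A) {b} → (A → b ≡ true) → (b ≡ true → A) → does d ≡ b
does-≡ d {true}  f g = dec-true d (g refl)
does-≡ d {false} f g = dec-false d λ a → true≢false (f a) refl

-- Colourings as vectors can be enumerated coordinate by coordinate; this decides whether a solution
-- exists.
search : ∀ {k} m {P : Vec (Fin k) m → Set} → (∀ v → Dec (P v)) → Dec (∃ P)
search zero    P? = map′ ([] ,_) (λ { ([] , p) → p }) (P? [])
search (suc m) P? = map′ (λ { (c , v , p) → c ∷ v , p }) (λ { (c ∷ v , p) → c , v , p }) (any? λ c → search m (P? ∘ (c ∷_)))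

-- Cubic multigraphs as nets

module _ (G : Multigraph) where

  net : Net (n G) (m G)
  net = record { s = proj₁ ∘ ends G ; t = proj₂ ∘ ends G }

  all-nonloop : ∀ e → nonloop net e ≡ true
  all-nonloop e = cong not (δ-≢ (noLoop G e))

  incident-star : ∀ {e v} → Incident G e v → star net v e ≡ true
  incident-star {e} (inj₁ refl) = cong₂ _xor_ (δ-refl (s net e)) (δ-≢ (noLoop G e))
  incident-star {e} (inj₂ refl) = cong₂ _xor_ (δ-≢ (noLoop G e ∘ sym)) (δ-refl (t net e))

  star-incident : ∀ {e v} → star net v e ≡ true → Incident G e v
  star-incident {e} {v} p = go (star-joins net {v} {e} p)
    where
    go : _ → Incident G e v
    go (w , _ , inj₁ (q , _)) = inj₁ q
    go (w , _ , inj₂ (_ , q)) = inj₂ q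

  degree-deg : ∀ v → degree G v ≡ deg net v
  degree-deg v = trans (length-filter (incident? G v) id) (count-cong λ e → does-≡ (incident? G v e) incident-star star-incident)

  -- A walk that avoids the only edge of a cut stays on one side, so it cannot join the ends of that
  -- edge.
  noBridge : Bridgeless G → NoBridge net
  noBridge bridgeless X c = let (e , o) = get₁ {P = cross net X} c in
    bridgeless e λ r → xor-≢ (One.at₁ o) (same-side o r)
    where
    same-side : ∀ {e u w} → One (cross net X) e → ReachAvoiding G e u w → X u ≡ X w
    same-side o here = refl
    same-side {e} o (step {w} {x} e′ r e′≢e j) = trans (same-side o r) (==-sound (cong not (trans (sym (joins-cross net (connects j) X)) (≢true (e′≢e ∘ One.only o e′)))))
      where
      connects : Joins G e′ w x → Connects net e′ w x
      connects (inj₁ p) = inj₁ (cong proj₁ p , cong proj₂ p)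
      connects (inj₂ p) = inj₂ (cong proj₁ p , cong proj₂ p)

  record Structure : Set where
    field
      M α β   : Fin (m G) → Bool
      cubic   : ∀ v → deg net v ≡ 3
      perfect : Perfect net M
      even-α  : Even net α
      even-β  : Even net β
      cover   : ∀ e → M e ≡ true → α e ∨ β e ≡ true

  -- Contract the components of the complement of `M`, take a flow there and lift it; lifting
  -- changes no value on `M`.
  structure : Cubic G → Bridgeless G → ¬ ¬ Structure
  structure cubicG bridgeless fail = good λ { (M , perfect , three) → with-matching M perfect three }
    where
    cubic : ∀ v → deg net v ≡ 3
    cubic v = trans (sym (degree-deg v)) (cubicG v)
    nb = noBridge bridgeless
    good : ¬ ¬ (∃ λ M → Perfect net M × ThreeCuts net M)
    good none = by-cases {Fin (m G)}
      (λ e → good-matching (suc (size net)) net ≤-refl (inj₂ ∘ cubic) nb e λ { (M , _ , perfect , three) → none (M , perfect , three) })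
      (λ empty → none (const true , (λ v → ⊥-elim (empty (proj₁ (count-some (star net v) (subst (0 <_) (sym (cubic v)) (s≤s z≤n)))))) ,
                       λ X X3 → ⊥-elim (empty (proj₁ (count-some (cross net X) (subst (0 <_) (sym X3) (s≤s z≤n)))))))
    with-matching : ∀ M → Perfect net M → ThreeCuts net M → ⊥
    with-matching M perfect three = contracted (contraction net (not ∘ M) {Link net K} (link-refl net) (link-sym net) (link-trans net) (λ e → link-edge net {K} {e}))
      where
      K : Fin (m G) → Set
      K e = not (M e) ≡ true
      contracted : (∃ λ ρ → (∀ e → K e → ρ (s net e) ≡ ρ (t net e)) × (∀ v → Link net K v (ρ v))) → ⊥
      contracted (ρ , contracts , link) = flow (suc (size (contract ρ net))) (contract ρ net) ≤-refl (nb ∘ (_∘ ρ)) no3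
        λ { (α , β , Eα , Eβ , cover) →
          let (α′ , Eα′ , off-α) = lift-even net ρ link α Eα
              (β′ , Eβ′ , off-β) = lift-even net ρ link β Eβ
          in fail record { M = M ; α = α′ ; β = β′ ; cubic = cubic ; perfect = perfect ; even-α = Eα′ ; even-β = Eβ′
                         ; cover = λ e p → trans (cong₂ _∨_ (off-α e λ k → true≢false k (cong not p)) (off-β e λ k → true≢false k (cong not p))) (cover e) } }
        where
        -- Edges outside `M` have become loops and cross no cut, yet every 3-edge-cut of `G` has
        -- one.
        no3 : NoThreeCut (contract ρ net)
        no3 X X3 = let (e , p) = count-some (λ e → not (M e) ∧ cross net (X ∘ ρ) e) (≤-trans (s≤s z≤n) (three (X ∘ ρ) X3))
                       (k , c) = ∧-true {not (M e)} p
                   in xor-≢ c (cong X (contracts e k))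

  -- The colouring obtained from a matching and a flow

  module Colouring (S : Structure) where

    open Structure S

    record Local (v : Fin (n G)) (e f g : Fin (m G)) : Set where
      field
        three : Three (star net v) e f g
        e∈M   : M e ≡ true
        f∉M   : M f ≡ false
        g∉M   : M g ≡ false
        αg    : α g ≡ α e xor α f
        βg    : β g ≡ β e xor β f

    mate : ∀ v → ∃ λ e → star net v e ≡ true × M e ≡ true
    mate v = let (e , p) = count-some (λ e → M e ∧ star net v e) (subst (0 <_) (sym (matched-3-count {G = net} {M} {v} (cubic v) (perfect v))) (s≤s z≤n))
                 (q , r) = ∧-true {M e} p in e , r , q

    unmatched : ∀ {v e f} → star net v e ≡ true → star net v f ≡ true → e ≢ f → M e ≡ true → M f ≡ false
    unmatched {v} {e} {f} p q e≢f = matched-3-other {G = net} {v} {e} {f} M (cubic v) p q e≢f (perfect v)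

    local : ∀ {v e f} → star net v e ≡ true → star net v f ≡ true → M e ≡ true → M f ≡ false → ∃ (Local v e f)
    local {v} {e} {f} p q e∈M f∉M = let (g , th) = get₃″ {P = star net v} (cubic v) p q (λ { refl → true≢false e∈M f∉M }) in g , record
      { three = th ; e∈M = e∈M ; f∉M = f∉M ; g∉M = unmatched p (Three.at₃ th) (Three.≢₁₃ th) e∈M
      ; αg = third α even-α th ; βg = third β even-β th }
      where
      third : ∀ z → Even net z → ∀ {g} → Three (star net v) e f g → z g ≡ z e xor z f
      third z E {g} th = ==-sound (trans (by-valid 3 (λ { (a ∷ b ∷ c ∷ []) → c == (a xor b) }) (λ { (a ∷ b ∷ c ∷ []) → not (a xor (b xor c)) }) refl (z e ∷ z f ∷ z g ∷ []))
        (cong not (trans (sym (dot-three z th)) (E v))))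

    local-M : ∀ {v e} → star net v e ≡ true → M e ≡ true → ∃₂ (Local v e)
    local-M {v} {e} p e∈M = let (f , g , th) = get₃′ {P = star net v} (cubic v) p in
      f , local p (Three.at₂ th) e∈M (unmatched p (Three.at₂ th) (Three.≢₁₂ th) e∈M)

    local-C : ∀ {v f} → star net v f ≡ true → M f ≡ false → ∃₂ λ e g → Local v e f g
    local-C {v} p f∉M = let (e , q , e∈M) = mate v in e , local q p e∈M f∉M

    module _ (τ τ′ : Bool) (c : Coloring6 G) (hc : ∀ e → c e ≡ colour τ τ′ (M e) (α e) (β e)) where

      -- Two equally coloured edges outside `M` at `v` would have equal values, so the matching edge
      -- at `v` would have value zero, contrary to `cover`.
      proper : Proper G c
      proper e e′ v e≢e′ ie ie′ same = go (colour-clash τ τ′ (M e) (α e) (β e) (M e′) (α e′) (β e′) (trans (sym (hc e)) (trans same (hc e′))))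
        where
        p : star net v e ≡ true
        p = incident-star ie
        p′ : star net v e′ ≡ true
        p′ = incident-star ie′
        cancel : ∀ x {a b} → b ≡ x xor a → a ≡ b → x ≡ false
        cancel false _ _ = refl
        cancel true {true}  {false} _ ()
        cancel true {false} {true}  _ ()
        outside : M e ≡ false → M e′ ≡ false → α e ≡ α e′ → β e ≡ β e′ → (∃₂ λ h g → Local v h e g) → ⊥
        outside e∉M e′∉M a b (h , g , l) with Three.only (Local.three l) e′ p′
        ... | inj₁ refl        = true≢false (Local.e∈M l) e′∉M
        ... | inj₂ (inj₁ refl) = e≢e′ refl
        ... | inj₂ (inj₂ refl) = true≢false (cover h (Local.e∈M l)) (cong₂ _∨_ (cancel (α h) (Local.αg l) a) (cancel (β h) (Local.βg l) b))
        go : (M e ∧ M e′ ≡ true) ⊎ (M e ≡ false × M e′ ≡ false × α e ≡ α e′ × β e ≡ β e′) → ⊥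
        go (inj₁ both) = let (q , q′) = ∧-true {M e} both in true≢false q′ (unmatched {v} p p′ e≢e′ q)
        go (inj₂ (e∉M , e′∉M , a , b)) = outside e∉M e′∉M a b (local-C p e∉M)

      colorSet-palette : ∀ {v e f g} → Three (star net v) e f g → colorSet G c v ≡ palette (c e) (c f) (c g)
      colorSet-palette {v} {e} {f} {g} th = tabulate-cong {f = λ k → does (present? k)} {g = λ k → does (c e ≟ k) ∨ (does (c f ≟ k) ∨ does (c g ≟ k))} λ k → does-≡ (present? k) (to k ∘ Any.satisfied) (from k)
        where
        open Three th
        present? : ∀ k → Dec (Any.Any (λ i → Incident G i v × c i ≡ k) (allFin (m G)))
        present? k = Any.any? (λ i → incident? G v i ×-dec (c i ≟ k)) (allFin (m G))
        to : ∀ k → (∃ λ i → Incident G i v × c i ≡ k) → does (c e ≟ k) ∨ (does (c f ≟ k) ∨ does (c g ≟ k)) ≡ true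
        to k (i , inc , q) with only i (incident-star inc)
        ... | inj₁ refl        = ∨-trueˡ (dec-true (c i ≟ k) q)
        ... | inj₂ (inj₁ refl) = ∨-trueʳ (does (c e ≟ k)) (∨-trueˡ (dec-true (c i ≟ k) q))
        ... | inj₂ (inj₂ refl) = ∨-trueʳ (does (c e ≟ k)) (∨-trueʳ (does (c f ≟ k)) (dec-true (c i ≟ k) q))
        from : ∀ k → does (c e ≟ k) ∨ (does (c f ≟ k) ∨ does (c g ≟ k)) ≡ true → Any.Any (λ i → Incident G i v × c i ≡ k) (allFin (m G))
        from k h with c e ≟ k | c f ≟ k | c g ≟ k
        ... | yes q | _     | _     = lose (∈-allFin e) (star-incident at₁ , q)
        ... | no _  | yes q | _     = lose (∈-allFin f) (star-incident at₂ , q)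
        ... | no _  | no _  | yes q = lose (∈-allFin g) (star-incident at₃ , q)

      colorSet-local : ∀ {v e f g} → Local v e f g → colorSet G c v ≡ colours τ τ′ (α e) (β e) (α f) (β f)
      colorSet-local {v} {e} {f} {g} l = trans (colorSet-palette three) (cong₃ palette
        (trans (hc e) (cong (λ μ → colour τ τ′ μ (α e) (β e)) e∈M))
        (trans (hc f) (cong (λ μ → colour τ τ′ μ (α f) (β f)) f∉M))
        (trans (hc g) (cong₃ (colour τ τ′) g∉M αg βg)))
        where
        open Local l
        cong₃ : ∀ {A B C D : Set} (h : A → B → C → D) {a a′ b b′ c c′} → a ≡ a′ → b ≡ b′ → c ≡ c′ → h a b c ≡ h a′ b′ c′
        cong₃ h refl refl refl = refl

      isNormal : Fin (m G) → Bool
      isNormal e = does (normal? G c e)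

      at-s : ∀ e → star net (s net e) e ≡ true
      at-s e = incident-star (inj₁ refl)

      at-t : ∀ e → star net (t net e) e ≡ true
      at-t e = incident-star (inj₂ refl)

      normal-M : ∀ e → M e ≡ true → isNormal e ≡ true
      normal-M e e∈M =
        let (f , _ , l) = local-M (at-s e) e∈M
            (f′ , _ , l′) = local-M (at-t e) e∈M
        in trans (cong₂ (λ A B → normalᵇ ∣ A ∪ B ∣) (colorSet-local l) (colorSet-local l′))
                 (matching-normal τ τ′ (α e) (β e) (α f) (β f) (α f′) (β f′) (cover e e∈M))

    -- Counting the abnormal edges

    badness : Bool → Bool → Fin (m G) → Bool
    badness τ τ′ e = bad τ τ′ (α x) (β x) (α y) (β y) (α e) (β e)
      where
      x = proj₁ (mate (s net e))
      y = proj₁ (mate (t net e))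

    bad-at : Bool → Bool → Fin (m G) → Bool
    bad-at τ τ′ e = not (M e) ∧ badness τ τ′ e

    bads-≤ : count (bad-at false true) + (count (bad-at true false) + count (bad-at true true)) ≤ count (not ∘ M)
    bads-≤ = subst (_≤ count (not ∘ M)) (trans (ℕΣ.∑-distrib-+ (bit ∘ bad-at false true) (λ e → bit (bad-at true false e) + bit (bad-at true true e)))
        (cong (count (bad-at false true) +_) (ℕΣ.∑-distrib-+ (bit ∘ bad-at true false) (bit ∘ bad-at true true))))
      (sum-mono each)
      where
      each : ∀ e → bit (bad-at false true e) + (bit (bad-at true false e) + bit (bad-at true true e)) ≤ bit (not (M e))
      each e with M e
      ... | true  = z≤n
      ... | false = bad-once (α (proj₁ (mate (s net e)))) (β (proj₁ (mate (s net e)))) (α (proj₁ (mate (t net e)))) (β (proj₁ (mate (t net e)))) (α e) (β e) (covered (s net e)) (covered (t net e))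
        where
        covered : ∀ v → α (proj₁ (mate v)) ∨ β (proj₁ (mate v)) ≡ true
        covered v = cover (proj₁ (mate v)) (proj₂ (proj₂ (mate v)))

    module _ (τ τ′ : Bool) (c : Coloring6 G) (hc : ∀ e → c e ≡ colour τ τ′ (M e) (α e) (β e)) where

      abnormal : ∀ e → not (isNormal τ τ′ c hc e) ≡ bad-at τ τ′ e
      abnormal e = bool-cases {M e}
        (λ p → trans (cong not (normal-M τ τ′ c hc e p)) (∧-off (badness τ τ′ e) p))
        λ p → trans (cong₂ (λ A B → not (normalᵇ ∣ A ∪ B ∣)) (at (s net e) (at-s τ τ′ c hc e) p) (at (t net e) (at-t τ τ′ c hc e) p)) (∧-on (badness τ τ′ e) p)
        where
        ∧-off : ∀ {a} b → a ≡ true → false ≡ not a ∧ b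
        ∧-off b refl = refl
        ∧-on : ∀ {a} b → a ≡ false → b ≡ not a ∧ b
        ∧-on b refl = refl
        at : ∀ v → star net v e ≡ true → M e ≡ false → colorSet G c v ≡ colours τ τ′ (α (proj₁ (mate v))) (β (proj₁ (mate v))) (α e) (β e)
        at v p q = let (x , xv , x∈M) = mate v in colorSet-local τ τ′ c hc (proj₂ (local xv p x∈M q))

      normal+bad : numNormal G c + count (bad-at τ τ′) ≡ m G
      normal+bad = begin
        numNormal G c + count (bad-at τ τ′)                  ≡⟨ cong₂ _+_ (length-filter (normal? G c) id) (sym (count-cong abnormal)) ⟩
        count N + count (not ∘ N)                            ≡⟨ cong₂ _+_ (count-cong λ e → sym (∧-identityʳ (N e))) (count-cong λ e → sym (∧-identityʳ (not (N e)))) ⟩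
        count (λ e → N e ∧ true) + count (λ e → not (N e) ∧ true)  ≡⟨ count-split N (const true) ⟨
        count {m G} (const true)                             ≡⟨ count-all (m G) ⟩
        m G                                                  ∎
        where
        open ≡-Reasoning
        N = isNormal τ τ′ c hc

    -- Double counting of ends: each vertex has three edges, two of them outside `M`. The common
    -- factor 2 comes from the two ends of an edge.
    outside-count : 3 * count (not ∘ M) ≡ 2 * m G
    outside-count = *-cancelˡ-≡ (3 * count (not ∘ M)) (2 * m G) 2 (begin
      2 * (3 * count (not ∘ M))                      ≡⟨ solve₁ (count (not ∘ M)) ⟩
      3 * (count (not ∘ M) + count (not ∘ M))        ≡⟨ cong (3 *_) total-outside ⟨
      3 * ℕΣ.sum (degOn (not ∘ M) net)               ≡⟨ ℕΣ.*-distribˡ-sum 3 (degOn (not ∘ M) net) ⟩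
      ℕΣ.sum (λ v → 3 * degOn (not ∘ M) net v)       ≡⟨ ℕΣ.sum-cong-≗ (λ v → trans (cong (3 *_) (two-outside v)) (cong (2 *_) (sym (cubic v)))) ⟩
      ℕΣ.sum (λ v → 2 * deg net v)                   ≡⟨ ℕΣ.*-distribˡ-sum 2 (deg net) ⟨
      2 * ℕΣ.sum (deg net)                           ≡⟨ cong (2 *_) (handshake net) ⟩
      2 * (size net + size net)                      ≡⟨ cong (λ k → 2 * (k + k)) (trans (count-cong all-nonloop) (count-all (m G))) ⟩
      2 * (m G + m G)                                ≡⟨ cong (λ k → 2 * (m G + k)) (+-identityʳ (m G)) ⟨
      2 * (2 * m G)                                  ∎)
      where
      open ≡-Reasoning
      solve₁ : ∀ k → 2 * (3 * k) ≡ 3 * (k + k)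
      solve₁ k = trans (sym (*-assoc 2 3 k)) (trans (*-assoc 3 2 k) (cong (λ l → 3 * (k + l)) (+-identityʳ k)))
      two-outside : ∀ v → degOn (not ∘ M) net v ≡ 2
      two-outside v = cutOn-complement net M (δ v) {1} {2} (cubic v) (matched-3-count {G = net} {M} {v} (cubic v) (perfect v))
      total-outside : ℕΣ.sum (degOn (not ∘ M) net) ≡ count (not ∘ M) + count (not ∘ M)
      total-outside = trans (ℕΣ.∑-comm (λ v e → bit (not (M e) ∧ star net v e))) (trans (ℕΣ.sum-cong-≗ at-edge) (∑-bits (not ∘ M)))
        where
        at-edge : ∀ e → count (λ v → not (M e) ∧ star net v e) ≡ bit (not (M e)) + bit (not (M e))
        at-edge e with M e
        ... | true  = count-false {n G} {const false} λ _ → refl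
        ... | false = trans (∑-star net e) (cong₂ (λ a b → bit a + bit b) (all-nonloop e) (all-nonloop e))

    -- Pigeonhole: if the first two numbers exceed the average, the third does not.
    choose : ∀ x y z → 3 * (x + (y + z)) ≤ 2 * m G → (9 * x ≤ 2 * m G ⊎ 9 * y ≤ 2 * m G ⊎ 9 * z ≤ 2 * m G)
    choose x y z h = go (9 * x ≤? 2 * m G) (9 * y ≤? 2 * m G)
      where
      go : Dec (9 * x ≤ 2 * m G) → Dec (9 * y ≤ 2 * m G) → 9 * x ≤ 2 * m G ⊎ 9 * y ≤ 2 * m G ⊎ 9 * z ≤ 2 * m G
      go (yes p) _       = inj₁ p
      go (no _)  (yes q) = inj₂ (inj₁ q)
      go (no p)  (no q)  = inj₂ (inj₂ (+-cancelˡ-≤ (2 * m G + 2 * m G) (9 * z) (2 * m G) (begin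
        2 * m G + 2 * m G + 9 * z        ≤⟨ +-monoˡ-≤ (9 * z) (+-mono-≤ (<⇒≤ (≰⇒> p)) (<⇒≤ (≰⇒> q))) ⟩
        9 * x + 9 * y + 9 * z            ≡⟨ rearrange ⟩
        3 * (3 * (x + (y + z)))          ≤⟨ *-monoʳ-≤ 3 h ⟩
        3 * (2 * m G)                    ≡⟨ triple (2 * m G) ⟩
        2 * m G + 2 * m G + 2 * m G      ∎)))
        where
        open ≤-Reasoning
        triple : ∀ k → 3 * k ≡ k + k + k
        triple k = trans (cong (λ l → k + (k + l)) (+-identityʳ k)) (sym (+-assoc k k k))
        rearrange : 9 * x + 9 * y + 9 * z ≡ 3 * (3 * (x + (y + z)))
        rearrange = trans (+-assoc (9 * x) (9 * y) (9 * z)) (trans (cong (9 * x +_) (sym (*-distribˡ-+ 9 y z)))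
          (trans (sym (*-distribˡ-+ 9 x (y + z))) (*-assoc 3 3 (x + (y + z)))))

    enough : ∀ {x N} → 9 * x ≤ 2 * m G → N + x ≡ m G → 7 * m G ≤ 9 * N
    enough {x} {N} h eq = +-cancelʳ-≤ (2 * m G) (7 * m G) (9 * N) (begin
      7 * m G + 2 * m G    ≡⟨ *-distribʳ-+ (m G) 7 2 ⟨
      9 * m G              ≡⟨ cong (9 *_) eq ⟨
      9 * (N + x)          ≡⟨ *-distribˡ-+ 9 N x ⟩
      9 * N + 9 * x        ≤⟨ +-monoʳ-≤ (9 * N) h ⟩
      9 * N + 2 * m G      ∎)
      where open ≤-Reasoning

    Solution : Vec (Fin 6) (m G) → Set
    Solution w = Proper G (lookup w) × 7 * m G ≤ 9 * numNormal G (lookup w)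

    solution : ∃ Solution
    solution = [ take false true , [ take true false , take true true ]′ ]′
      (choose (count (bad-at false true)) (count (bad-at true false)) (count (bad-at true true)) (≤-trans (*-monoʳ-≤ 3 bads-≤) (≤-reflexive outside-count)))
      where
      take : ∀ τ τ′ → 9 * count (bad-at τ τ′) ≤ 2 * m G → ∃ Solution
      take τ τ′ h = w , proper τ τ′ (lookup w) hc , enough {count (bad-at τ τ′)} h (normal+bad τ τ′ (lookup w) hc)
        where
        w : Vec (Fin 6) (m G)
        w = tabulate λ e → colour τ τ′ (M e) (α e) (β e)
        hc : ∀ e → lookup w e ≡ colour τ τ′ (M e) (α e) (β e)
        hc e = lookup∘tabulate (λ e → colour τ τ′ (M e) (α e) (β e)) e

  solution? : ∀ w → Dec (Proper G (lookup w) × 7 * m G ≤ 9 * numNormal G (lookup w))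
  solution? w = proper? ×-dec (7 * m G ≤? 9 * numNormal G (lookup w))
    where
    proper? : Dec (Proper G (lookup w))
    proper? = all? λ e → all? λ e′ → all? λ v →
      ¬? (e ≟ e′) →-dec (incident? G v e →-dec (incident? G v e′ →-dec ¬? (lookup w e ≟ lookup w e′)))

theorem7 : (G : Multigraph) → Cubic G → Bridgeless G →
    Σ (Coloring6 G) λ f → Proper G f × (7 * m G ≤ 9 * numNormal G f)
theorem7 G cubic bridgeless =
  let (w , solved) = decidable-stable (search (m G) (solution? G)) λ none → structure G cubic bridgeless (none ∘ Colouring.solution G)
  in lookup w , solved
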